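{- Let $W$ be a finite Coxeter group of simply-laced type with set of positive roots $\Phi^+$. Then for any $A \subseteq \Phi^+$, we have $\overline{A}^{\mathrm{pbr}} = \overline{A}$, where $\overline{A}^{\mathrm{pbr}}$ is the palindromic Bruhat preclosure of $A$ and $\overline{A}$ is the $2$-closure of $A$.
   Context: Let $(W,S)$ be a Coxeter system with Coxeter matrix $(m(s,t))_{s,t\in S}$ and length function $\ell$; it is simply-laced if $m(s,t)\in\{2,3\}$ for all $s\neq t$ in $S$. Let $\Phi$ be its root system (in the standard geometric representation), with positive roots $\Phi^+$ with respect to $S$. For $\alpha\in\Phi$, $s_\alpha\in W$ denotes the reflection in $\alpha$. For $A\subseteq\Phi^+$, the palindromic Bruhat preclosure $\overline{A}^{\mathrm{pbr}}$ is the set of those $\alpha \in \Phi^+$ for which there exist $\alpha_1, \ldots, \alpha_m \in A$ such that $s_\alpha = s_{\alpha_1} \cdots s_{\alpha_m}$, $0 < \ell(s_{\alpha_1}) < \ell(s_{\alpha_1} s_{\alpha_2}) < \cdots < \ell(s_{\alpha_1} \cdots s_{\alpha_m})$, and the sequence is palindromic: $\alpha_r=\alpha_{m+1-r}$ for $1\le r\le m$. A subset $A \subseteq \Phi^+$ is $2$-closed if for all $\alpha, \beta \in A$ and $a, b \in \mathbb{R}_{\ge 0}$ such that $a \alpha + b \beta \in \Phi^+$, we have $a \alpha + b \beta \in A$. The $2$-closure $\overline{A}$ of $A \subseteq \Phi^+$ is the intersection of all $2$-closed subsets of $\Phi^+$ containing $A$. -}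

module Defs where

open import Level using (Level; 0ℓ) renaming (suc to lsuc)
open import Algebra.Apartness.Bundles using (HeytingField; HeytingCommutativeRing)
open import Algebra.Bundles using (CommutativeRing; Group)
import Algebra.Definitions.RawMonoid as RawMonoidDefinitions
import Algebra.Properties.Monoid.Sum as MonoidSum
open import Data.Bool using (if_then_else_)
open import Data.Fin using (Fin)
open import Data.Fin.Properties using (_≟_)
open import Data.List using (List; []; _∷_; _++_; [_]; foldr; length; map; reverse)
open import Data.List.Properties using (++-assoc; ++-identityʳ; unfold-reverse; reverse-++; reverse-involutive)
open import Data.List.Relation.Binary.Pointwise using (Pointwise)
open import Data.List.Relation.Unary.All using (All)
open import Data.List.Relation.Unary.Enumerates.Setoid using (IsEnumeration)
open import Data.List.Relation.Unary.Linked using (Linked)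
open import Data.List.Scans.Base using (scanl)
open import Data.Nat using (ℕ)
import Data.Nat as ℕ
open import Data.Product using (∃-syntax; _×_; _,_; proj₁)
open import Data.Sum using (_⊎_; inj₁; inj₂; [_,_]′)
open import Data.Vec.Functional using (Vector)
open import Function using (const; _⇔_; Equivalence)
open import Relation.Binary using (Rel; IsStrictPartialOrder; _Respects_)
open import Relation.Binary.PropositionalEquality as ≡ using (_≡_; _≢_)
open import Relation.Nullary using (¬_; yes; no; does)
open import Relation.Unary using (Pred; _⊆_; _∈_)

-- The field of real numbers, axiomatised as an Archimedean, Cauchy complete
-- ordered field.  Classically these axioms determine ℝ up to isomorphism; they
-- are phrased so that constructions of ℝ by Cauchy sequences with explicit
-- moduli satisfy them without any classical principle.
record RealNumbers : Set₁ where
  field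
    heytingField : HeytingField 0ℓ 0ℓ 0ℓ

  open HeytingField heytingField public

  commutativeRing : CommutativeRing 0ℓ 0ℓ
  commutativeRing = HeytingCommutativeRing.commutativeRing heytingCommutativeRing

  open RawMonoidDefinitions (CommutativeRing.+-rawMonoid commutativeRing) public
    using () renaming (_×_ to _·_)

  infix 4 _<_ _≤_

  field
    _<_                  : Rel Carrier 0ℓ
    isStrictPartialOrder : IsStrictPartialOrder _≈_ _<_
    #⇔<⊎>                : ∀ x y → x # y ⇔ (x < y ⊎ y < x)
    0<1                  : 0# < 1#
    +-monoˡ-<            : ∀ {x y} z → x < y → x + z < y + z
    *-pos                : ∀ {x y} → 0# < x → 0# < y → 0# < x * y
    archimedean          : ∀ x → ∃[ k ] x < (k · 1#)

  _≤_ : Rel Carrier 0ℓ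
  x ≤ y = ¬ (y < x)

  Within : Carrier → Rel Carrier 0ℓ
  Within ε x y = (x - y) < ε × (y - x) < ε

  IsCauchy : (ℕ → Carrier) → Set
  IsCauchy f = ∀ ε → 0# < ε →
    ∃[ N ] (∀ i j → N ℕ.≤ i → N ℕ.≤ j → Within ε (f i) (f j))

  ConvergesTo : (ℕ → Carrier) → Carrier → Set
  ConvergesTo f x = ∀ ε → 0# < ε → ∃[ N ] (∀ i → N ℕ.≤ i → Within ε (f i) x)

  field
    complete : ∀ f → IsCauchy f → ∃[ x ] ConvergesTo f x

  0<2 : 0# < 1# + 1#
  0<2 = <-trans 0<1 (<-respˡ-≈ (+-identityˡ 1#) (+-monoˡ-< 1# 0<1))
    where open IsStrictPartialOrder isStrictPartialOrder
            using (<-respˡ-≈) renaming (trans to <-trans)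

  ½ : Carrier
  ½ = proj₁ (#⇒invertible (Equivalence.from (#⇔<⊎> (1# + 1#) 0#) (inj₂ 0<2)))

-- The entry 0 encodes m(s,t) = ∞.
record CoxeterMatrix (n : ℕ) : Set where
  field
    m           : Fin n → Fin n → ℕ
    symmetric   : ∀ s t → m s t ≡ m t s
    diagonal    : ∀ s → m s s ≡ 1
    offDiagonal : ∀ s t → s ≢ t → m s t ≢ 1

SimplyLaced : ∀ {n} → CoxeterMatrix n → Set
SimplyLaced M = ∀ {s t} → s ≢ t → m s t ≡ 2 ⊎ m s t ≡ 3
  where open CoxeterMatrix M

-- The Coxeter group ⟨ S ∣ (st)^m(s,t) = 1 ⟩ with S = Fin n.  Its elements are
-- words in S (the generators are involutions, so inverses of letters are not
-- needed), and its equality is the congruence generated by the relations.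
module Coxeter {n : ℕ} (M : CoxeterMatrix n) where
  open CoxeterMatrix M

  Word : Set
  Word = List (Fin n)

  alternating : ℕ → Fin n → Fin n → Word
  alternating ℕ.zero    s t = []
  alternating (ℕ.suc k) s t = s ∷ t ∷ alternating k s t

  infix 4 _∼_

  data _∼_ : Rel Word 0ℓ where
    relation : ∀ s t → alternating (m s t) s t ∼ []
    ++-cong  : ∀ {u u′ v v′} → u ∼ u′ → v ∼ v′ → u ++ v ∼ u′ ++ v′
    ∼-refl   : ∀ {u} → u ∼ u
    ∼-sym    : ∀ {u v} → u ∼ v → v ∼ u
    ∼-trans  : ∀ {u v w} → u ∼ v → v ∼ w → u ∼ w

  ≡⇒∼ : ∀ {u v} → u ≡ v → u ∼ v
  ≡⇒∼ ≡.refl = ∼-refl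

  square : ∀ s → s ∷ s ∷ [] ∼ []
  square s = ≡.subst (λ k → alternating k s s ∼ []) (diagonal s) (relation s s)

  reverse-inverseˡ : ∀ u → reverse u ++ u ∼ []
  reverse-inverseˡ []      = ∼-refl
  reverse-inverseˡ (s ∷ u) = ∼-trans (≡⇒∼ regroup)
    (∼-trans (++-cong (∼-refl {reverse u}) (++-cong (square s) (∼-refl {u})))
             (reverse-inverseˡ u))
    where
    regroup : reverse (s ∷ u) ++ s ∷ u ≡ reverse u ++ s ∷ s ∷ u
    regroup = ≡.trans (≡.cong (_++ s ∷ u) (unfold-reverse s u))
                      (++-assoc (reverse u) [ s ] (s ∷ u))

  reverse-inverseʳ : ∀ u → u ++ reverse u ∼ []
  reverse-inverseʳ u = ≡.subst (λ v → v ++ reverse u ∼ [])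
    (reverse-involutive u) (reverse-inverseˡ (reverse u))

  alternating-snoc : ∀ k s t →
    alternating k s t ++ s ∷ t ∷ [] ≡ s ∷ t ∷ alternating k s t
  alternating-snoc ℕ.zero    s t = ≡.refl
  alternating-snoc (ℕ.suc k) s t = ≡.cong (λ u → s ∷ t ∷ u) (alternating-snoc k s t)

  reverse-alternating : ∀ k s t → reverse (alternating k s t) ≡ alternating k t s
  reverse-alternating ℕ.zero    s t = ≡.refl
  reverse-alternating (ℕ.suc k) s t = ≡.trans
    (reverse-++ (s ∷ t ∷ []) (alternating k s t))
    (≡.trans (≡.cong (_++ t ∷ s ∷ []) (reverse-alternating k s t))
             (alternating-snoc k t s))

  reverse-cong : ∀ {u v} → u ∼ v → reverse u ∼ reverse v
  reverse-cong (relation s t) = ∼-trans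
    (≡⇒∼ (≡.trans (reverse-alternating (m s t) s t)
                  (≡.cong (λ k → alternating k t s) (symmetric s t))))
    (relation t s)
  reverse-cong (++-cong {u} {u′} {v} {v′} p q) = ∼-trans (≡⇒∼ (reverse-++ u v))
    (∼-trans (++-cong (reverse-cong q) (reverse-cong p))
             (≡⇒∼ (≡.sym (reverse-++ u′ v′))))
  reverse-cong ∼-refl        = ∼-refl
  reverse-cong (∼-sym p)     = ∼-sym (reverse-cong p)
  reverse-cong (∼-trans p q) = ∼-trans (reverse-cong p) (reverse-cong q)

  W : Group 0ℓ 0ℓ
  W = record
    { Carrier = Word
    ; _≈_     = _∼_
    ; _∙_     = _++_
    ; ε       = []
    ; _⁻¹     = reverse
    ; isGroup = record
      { isMonoid = record
        { isSemigroup = record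
          { isMagma = record
            { isEquivalence = record { refl = ∼-refl ; sym = ∼-sym ; trans = ∼-trans }
            ; ∙-cong        = ++-cong
            }
          ; assoc = λ u v w → ≡⇒∼ (++-assoc u v w)
          }
        ; identity = (λ _ → ∼-refl) , (λ u → ≡⇒∼ (++-identityʳ u))
        }
      ; inverse = reverse-inverseˡ , reverse-inverseʳ
      ; ⁻¹-cong = reverse-cong
      }
    }

  open Group W using (setoid)

  IsFinite : Set
  IsFinite = ∃[ ws ] IsEnumeration setoid ws

  infix 4 ℓ[_]≡_ _<ℓ_

  -- The length function ℓ, given by its graph: deciding minimality needs a
  -- solution of the word problem, so ℓ is not directly a function on words.
  ℓ[_]≡_ : Word → ℕ → Set
  ℓ[ w ]≡ k = (∃[ u ] u ∼ w × length u ≡ k) × (∀ u → u ∼ w → k ℕ.≤ length u)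

  _<ℓ_ : Rel Word 0ℓ
  u <ℓ v = ∃[ j ] ∃[ k ] ℓ[ u ]≡ j × ℓ[ v ]≡ k × j ℕ.< k

module RootSystem (ℝ : RealNumbers) {n : ℕ} (M : CoxeterMatrix n) (simplyLaced : SimplyLaced M) where
  open RealNumbers ℝ
  open Coxeter M public
  open Group W using (_∙_; ε; _⁻¹) renaming (_≈_ to _≈ᵂ_)
  open MonoidSum (CommutativeRing.+-monoid commutativeRing) using (sum)

  infix  4 _≋_
  infixl 6 _+ᵥ_ _-ᵥ_
  infixl 7 _*ᵥ_

  -- Coordinates are taken with respect to the basis of simple roots.
  V : Set
  V = Vector Carrier n

  _≋_ : Rel V 0ℓ
  u ≋ v = ∀ s → u s ≈ v s

  _+ᵥ_ _-ᵥ_ : V → V → V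
  (u +ᵥ v) s = u s + v s
  (u -ᵥ v) s = u s - v s

  _*ᵥ_ : Carrier → V → V
  (c *ᵥ v) s = c * v s

  simpleRoot : Fin n → V
  simpleRoot s t = if does (s ≟ t) then 1# else 0#

  -- B(αₛ, αₜ) = - cos (π / m(s,t)), where m(s,t) ∈ {1, 2, 3}.
  gram : Fin n → Fin n → Carrier
  gram s t with s ≟ t
  ... | yes _   = 1#
  ... | no  s≢t = [ const 0# , const (- ½) ]′ (simplyLaced s≢t)

  B : V → V → Carrier
  B u v = sum (λ s → sum (λ t → (u s * v t) * gram s t))

  simpleReflection : Fin n → V → V
  simpleReflection s v = v -ᵥ ((1# + 1#) * B v (simpleRoot s)) *ᵥ simpleRoot s

  act : Word → V → V
  act w v = foldr simpleReflection v w

  record Φ : Set where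
    field
      vector  : V
      w       : Word
      s       : Fin n
      isImage : vector ≋ act w (simpleRoot s)

  record Φ⁺ : Set where
    field
      root     : Φ
    open Φ root public
    field
      positive : ∀ t → 0# ≤ vector t

  open Φ⁺ using (vector)

  infix 4 _≈ᶲ_

  _≈ᶲ_ : Rel Φ⁺ 0ℓ
  α ≈ᶲ β = vector α ≋ vector β

  -- For α = w αₛ, the reflection in α is w s w⁻¹.  It acts on V as
  -- v ↦ v - 2 B(v,α) α, so, as W acts faithfully, it depends on α only.
  reflection : Φ⁺ → Word
  reflection α = (w ∙ [ s ]) ∙ w ⁻¹
    where open Φ⁺ α using (w; s)

  record Subset (a : Level) : Set (lsuc a) where
    field
      member   : Pred Φ⁺ a
      respects : member Respects _≈ᶲ_

  open Subset public using (member)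

  Palindromic : List Φ⁺ → Set
  Palindromic αs = Pointwise _≈ᶲ_ αs (reverse αs)

  -- The scan lists ε, s_α₁, s_α₁ s_α₂, …, s_α₁ ⋯ s_αₘ, and ℓ(ε) = 0.
  BruhatIncreasing : List Φ⁺ → Set
  BruhatIncreasing αs = Linked _<ℓ_ (scanl _∙_ ε (map reflection αs))

  PalindromicBruhatPreclosure : ∀ {a} → Subset a → Pred Φ⁺ a
  PalindromicBruhatPreclosure A α = ∃[ αs ]
      All (member A) αs
    × reflection α ≈ᵂ foldr _∙_ ε (map reflection αs)
    × BruhatIncreasing αs
    × Palindromic αs

  TwoClosed : ∀ {a} → Subset a → Set a
  TwoClosed A = ∀ α β → α ∈ member A → β ∈ member A →
    ∀ a b → 0# ≤ a → 0# ≤ b →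
    ∀ γ → vector γ ≋ a *ᵥ vector α +ᵥ b *ᵥ vector β → γ ∈ member A

  TwoClosure : ∀ {a} → Subset a → Pred Φ⁺ (lsuc a)
  TwoClosure {a} A α = (C : Subset a) → TwoClosed C → member A ⊆ member C → α ∈ member C

{-# OPTIONS --safe #-}
-- For finite simply-laced W the root lattice is even and positive definite (sum the squares of
-- the W-translates of the coordinates), so each root has norm 2 and is positive or negative, and
-- roots α ≠ ±β have ⟨α,β⟩ ∈ {-1,0,1}.  Sign coherence gives the exchange condition, hence
-- faithfulness and ℓ(x) < ℓ(x s_α) ⇔ xα > 0.
--
-- Call γ a chain root of A if it is obtained from a root of A by repeatedly adding a root
-- α ∈ A with ⟨α,θ⟩ = -1 to the current root θ.  The chain roots form a 2-closed set, since a
-- nonnegative combination of two roots α, β which is a root is α, β or, if ⟨α,β⟩ = -1, α + β.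
-- If γ = α₁ + ⋯ + αₖ along a chain, then α₁ ⋯ αₖ ⋯ α₁ is palindromic with product s_γ, and
-- it is increasing because every splitting of a root into positive roots stays positive.
-- Conversely, comparing the two halves of an increasing palindrome for s_γ shows
-- ⟨αᵢ, αᵢ₊₁ + ⋯ + αₖ⟩ = -1 from the centre outwards, so γ lies in the 2-closure.
module Submission where

open import Defs
open import Data.Nat using (ℕ)
open import Level using (Level)
open import Relation.Unary using (_≐_)

open import Algebra.Bundles using (CommutativeRing; Group)
import Algebra.Properties.AbelianGroup as AbelianGroupProperties
import Algebra.Properties.Ring as RingProperties
import Algebra.Properties.Semiring.Mult as Mult
import Algebra.Properties.Semiring.Sum as SemiringSum
import Algebra.Solver.Ring as RingSolver
import Algebra.Solver.Ring.AlmostCommutativeRing as ACR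
open import Data.Bool using (if_then_else_; true; false)
open import Data.Fin using (Fin; zero; suc)
import Data.Fin.Properties as Fin
open import Data.Integer as Int using (ℤ; +_; -[1+_]; 0ℤ; 1ℤ; ∣_∣; _⊖_; +<+; +≤+; -≤+; -≤-)
import Data.Integer.Properties as ℤ
open import Data.Integer.Tactic.RingSolver using (solve-∀)
open import Data.List using (List; []; _∷_; _++_; [_]; allFin; cartesianProductWith; deduplicate;
  foldr; length; map; reverse)
open import Data.List.Properties using (++-assoc; ++-identityʳ; foldr-++; length-++; length-reverse;
  reverse-++; reverse-involutive; unfold-reverse)
import Data.List.Membership.Propositional as Membership
import Data.List.Membership.Propositional.Properties as Membershipₚ
open import Data.List.Membership.Propositional.Properties.WithK using (unique∧set⇒bag)
open import Data.List.Relation.Binary.BagAndSetEquality using (∼bag⇒↭)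
open import Data.List.Relation.Binary.Permutation.Propositional as Perm using (_↭_)
open import Data.List.Relation.Binary.Pointwise as Pointwise using (Pointwise; []; _∷_)
open import Data.List.Relation.Unary.All as All using (All; []; _∷_)
import Data.List.Relation.Unary.All.Properties as Allₚ
open import Data.List.Relation.Unary.Any using (here; there)
open import Data.List.Relation.Unary.Linked using (Linked; []; [-]; _∷_)
open import Data.List.Relation.Unary.Unique.Propositional using (Unique)
import Data.List.Relation.Unary.Unique.DecPropositional.Properties as DecUnique
import Data.List.Relation.Unary.Unique.Propositional.Properties as Unique
open import Data.List.Reverse using (Reverse; []; _∶_∶ʳ_; reverseView)
open import Data.List.Scans.Base using (scanl)
open import Data.Maybe using (Maybe; just; nothing)
import Data.Nat as ℕ
open import Data.Nat using (z≤n; s≤s)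
import Data.Nat.Properties as ℕₚ
open import Data.Product using (∃-syntax; _×_; _,_; proj₁; proj₂)
open import Data.Sum using (_⊎_; inj₁; inj₂; [_,_]′)
open import Data.Vec using (Vec; lookup; tabulate)
import Data.Vec.Properties as Vec
open import Function using (Equivalence; const; mk⇔)
open import Level using (0ℓ)
open import Relation.Binary using (IsStrictPartialOrder)
open import Relation.Binary.PropositionalEquality as ≡ using (_≡_; _≢_; _≗_)
import Relation.Binary.Reasoning.Setoid as SetoidReasoning
open import Relation.Nullary using (¬_; Dec; contradiction; does; no; yes; ¬?)
open import Relation.Nullary.Decidable using (dec-false; dec-true)
open import Relation.Unary using (Decidable; _∈_; _⊆_)

-- The order on the axiomatised reals is not decidable, while the arguments branch on signs of
-- coordinates and on values of pairings. They therefore take place in the lattice of integer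
-- combinations of simple roots, with the form doubled so that roots have norm 2 and `½` disappears.
-- The embedding `ι` of the integers is injective and reflects nonnegativity, so nothing is lost;
-- arbitrary real coefficients are dealt with in `combination`. Finiteness is given as a list of
-- words that may represent an element of W several times, and words cannot be compared at this
-- stage. The averaged form is hence a sum over a deduplicated orbit of integral functionals. It is
-- proportional to the Cartan form only on each component of the Coxeter graph, which costs an extra
-- splitting by the factor of proportionality. The inductions on chain roots rest on one
-- observation: positive roots pair to at least -1, so if a positive root pairs to -1 with a sum of
-- two positive roots, it pairs to -1 with one of them and to 0 with the other.

-- Bilinear forms over a commutative ring

module FormOver (R : CommutativeRing 0ℓ 0ℓ) where
  open CommutativeRing R hiding (zero)
    renaming (_+_ to _+ᴿ_; _*_ to _*ᴿ_; refl to ≈-refl; sym to ≈-sym; trans to ≈-trans)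
  open SemiringSum semiring public
  open SetoidReasoning setoid

  basis : ∀ {n} → Fin n → Fin n → Carrier
  basis s t = if does (s Fin.≟ t) then 1# else 0#

  sum-zero : ∀ {n} {f : Fin n → Carrier} → (∀ s → f s ≈ 0#) → sum f ≈ 0#
  sum-zero {n} f≈0 = ≈-trans (sum-cong-≋ f≈0) (sum-replicate-zero n)

  sum-basis : ∀ {n} k (f : Fin n → Carrier) → sum (λ s → basis k s *ᴿ f s) ≈ f k
  sum-basis zero    f = ≈-trans
    (+-cong (*-identityˡ (f zero)) (sum-zero {f = λ s → 0# *ᴿ f (suc s)} λ s → zeroˡ (f (suc s))))
    (+-identityʳ (f zero))
  sum-basis (suc k) f = ≈-trans
    (+-cong (zeroˡ (f zero)) (sum-basis k (λ s → f (suc s)))) (+-identityˡ (f (suc k)))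

  module _ {n} (g : Fin n → Fin n → Carrier) where

    -- It has the shape of `B` verbatim, so over the reals its lemmas apply to `B` by definition,
    -- and over the integers they serve the Cartan form.
    form : (u v : Fin n → Carrier) → Carrier
    form u v = sum (λ s → sum (λ t → (u s *ᴿ v t) *ᴿ g s t))

    form-cong : ∀ {u u′ v v′} → (∀ s → u s ≈ u′ s) → (∀ s → v s ≈ v′ s) → form u v ≈ form u′ v′
    form-cong p q = sum-cong-≋ λ s → sum-cong-≋ λ t → *-congʳ (*-cong (p s) (q t))

    form-linearˡ : ∀ a u b v w → form (λ s → a *ᴿ u s +ᴿ b *ᴿ v s) w ≈ a *ᴿ form u w +ᴿ b *ᴿ form v
      w
    form-linearˡ a u b v w = begin
      sum (λ s → sum (λ t → ((a *ᴿ u s +ᴿ b *ᴿ v s) *ᴿ w t) *ᴿ g s t))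
        ≈⟨ sum-cong-≋ (λ s → ≈-trans (sum-cong-≋ (expand s))
             (∑-distrib-+ (λ t → a *ᴿ F s t) (λ t → b *ᴿ G s t))) ⟩
      sum (λ s → sum (λ t → a *ᴿ F s t) +ᴿ sum (λ t → b *ᴿ G s t))
        ≈⟨ ∑-distrib-+ (λ s → sum (λ t → a *ᴿ F s t)) (λ s → sum (λ t → b *ᴿ G s t)) ⟩
      sum (λ s → sum (λ t → a *ᴿ F s t)) +ᴿ sum (λ s → sum (λ t → b *ᴿ G s t))
        ≈⟨ +-cong (pull a F) (pull b G) ⟩
      a *ᴿ form u w +ᴿ b *ᴿ form v w ∎
      where
      F G : Fin n → Fin n → Carrier
      F s t = (u s *ᴿ w t) *ᴿ g s t
      G s t = (v s *ᴿ w t) *ᴿ g s t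
      assoc₃ : ∀ x y z z′ → ((x *ᴿ y) *ᴿ z) *ᴿ z′ ≈ x *ᴿ ((y *ᴿ z) *ᴿ z′)
      assoc₃ x y z z′ = ≈-trans (*-congʳ (*-assoc _ _ _)) (*-assoc _ _ _)
      expand : ∀ s t → ((a *ᴿ u s +ᴿ b *ᴿ v s) *ᴿ w t) *ᴿ g s t ≈ a *ᴿ F s t +ᴿ b *ᴿ G s t
      expand s t = ≈-trans (*-congʳ (distribʳ _ _ _))
        (≈-trans (distribʳ _ _ _) (+-cong (assoc₃ _ _ _ _) (assoc₃ _ _ _ _)))
      pull : ∀ c (H : Fin n → Fin n → Carrier) →
        sum (λ s → sum (λ t → c *ᴿ H s t)) ≈ c *ᴿ sum (λ s → sum (H s))
      pull c H = ≈-sym (≈-trans (*-distribˡ-sum c (λ s → sum (H s)))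
        (sum-cong-≋ λ s → *-distribˡ-sum c (H s)))

    form-sym : (∀ s t → g s t ≈ g t s) → ∀ u v → form u v ≈ form v u
    form-sym g-sym u v = ≈-trans (∑-comm (λ s t → (u s *ᴿ v t) *ᴿ g s t))
      (sum-cong-≋ λ t → sum-cong-≋ λ s → *-cong (*-comm _ _) (g-sym s t))

    form-basisˡ : ∀ k v → form (basis k) v ≈ sum (λ t → v t *ᴿ g k t)
    form-basisˡ k v = begin
      sum (λ s → sum (λ t → (basis k s *ᴿ v t) *ᴿ g s t))
        ≈⟨ sum-cong-≋ (λ s → ≈-trans (sum-cong-≋ λ t → *-assoc (basis k s) (v t) (g s t))
                                 (≈-sym (*-distribˡ-sum (basis k s) (λ t → v t *ᴿ g s t)))) ⟩
      sum (λ s → basis k s *ᴿ sum (λ t → v t *ᴿ g s t))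
        ≈⟨ sum-basis k (λ s → sum (λ t → v t *ᴿ g s t)) ⟩
      sum (λ t → v t *ᴿ g k t) ∎

-- Sums, signs and small inequalities over the integers

module IntegerSums where
  open ≡ using (refl; sym; trans; cong; cong₂; module ≡-Reasoning)
  open Int using (_+_; _*_; _-_; -_; _≤_; _<_)
  open FormOver ℤ.+-*-commutativeRing using (basis; sum; sum-cong-≋; sum-zero; ∑-distrib-+)
  open Membership using () renaming (_∈_ to _∈ˡ_)

  sum-nonneg : ∀ {n} {f : Fin n → ℤ} → (∀ s → 0ℤ ≤ f s) → 0ℤ ≤ sum f
  sum-nonneg {ℕ.zero}  _   = ℤ.≤-refl
  sum-nonneg {ℕ.suc n} 0≤f = ℤ.+-mono-≤ (0≤f zero) (sum-nonneg λ s → 0≤f (suc s))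

  sum-nonpos : ∀ {n} {f : Fin n → ℤ} → (∀ s → f s ≤ 0ℤ) → sum f ≤ 0ℤ
  sum-nonpos {ℕ.zero}  _   = ℤ.≤-refl
  sum-nonpos {ℕ.suc n} f≤0 = ℤ.+-mono-≤ (f≤0 zero) (sum-nonpos λ s → f≤0 (suc s))

  -- Off-diagonal entries cancel modulo 2 in symmetric pairs; the induction removes the first row
  -- together with the first column. This is the source of evenness of the root lattice.
  symmetric-sum-even : ∀ {n} (f : Fin n → Fin n → ℤ) (d : Fin n → ℤ) →
    (∀ s t → f s t ≡ f t s) → (∀ s → f s s ≡ + 2 * d s) →
    ∃[ k ] sum (λ s → sum (f s)) ≡ + 2 * k
  symmetric-sum-even {ℕ.zero}  f d f-sym diag = 0ℤ , refl
  symmetric-sum-even {ℕ.suc n} f d f-sym diag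
    with k , rest ← symmetric-sum-even (λ s t → f (suc s) (suc t)) (λ s → d (suc s))
                      (λ s t → f-sym (suc s) (suc t)) (λ s → diag (suc s))
    = d zero + X + k , (begin
      (f zero zero + X) + sum (λ s → f (suc s) zero + sum (λ t → f (suc s) (suc t)))
        ≡⟨ cong (_+_ (f zero zero + X)) (∑-distrib-+ (λ s → f (suc s) zero)
          (λ s → sum (λ t → f (suc s) (suc t)))) ⟩
      (f zero zero + X) + (sum (λ s → f (suc s) zero) + sum (λ s → sum (λ t → f (suc s) (suc t))))
        ≡⟨ cong₂ (λ x y → (x + X) + y) (diag zero)
                 (cong₂ _+_ (sum-cong-≋ λ s → f-sym (suc s) zero) rest) ⟩
      (+ 2 * d zero + X) + (X + + 2 * k)
        ≡⟨ regroup (d zero) X k ⟩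
      + 2 * (d zero + X + k) ∎)
    where
    open ≡-Reasoning
    X = sum (λ t → f zero (suc t))
    regroup : ∀ d X k → (+ 2 * d + X) + (X + + 2 * k) ≡ + 2 * (d + X + k)
    regroup = solve-∀

  _⁺ _⁻ : ℤ → ℤ
  (+ n) ⁺      = + n
  (-[1+ n ]) ⁺ = 0ℤ
  z ⁻          = (- z) ⁺

  ⁺-nonneg : ∀ z → 0ℤ ≤ z ⁺
  ⁺-nonneg (+ n)      = +≤+ z≤n
  ⁺-nonneg (-[1+ n ]) = ℤ.≤-refl

  ⁺-⁻ : ∀ z → z ⁺ - z ⁻ ≡ z
  ⁺-⁻ (+ ℕ.zero)  = refl
  ⁺-⁻ (+ ℕ.suc n) = ℤ.+-identityʳ _
  ⁺-⁻ (-[1+ n ])  = refl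

  ⁺*⁻≡0 : ∀ z → z ⁺ * z ⁻ ≡ 0ℤ
  ⁺*⁻≡0 (+ ℕ.zero)  = refl
  ⁺*⁻≡0 (+ ℕ.suc n) = ℤ.*-zeroʳ (+ ℕ.suc n)
  ⁺*⁻≡0 (-[1+ n ])  = refl

  *-nonneg : ∀ {x y} → 0ℤ ≤ x → 0ℤ ≤ y → 0ℤ ≤ x * y
  *-nonneg {+ m} {+ n} _ _ = ≡.subst (0ℤ ≤_) (ℤ.pos-* m n) (+≤+ z≤n)

  *-nonneg-nonpos : ∀ {x y} → 0ℤ ≤ x → y ≤ 0ℤ → x * y ≤ 0ℤ
  *-nonneg-nonpos {+ m} {y} _ y≤0 = ≡.subst (+ m * y ≤_) (ℤ.*-zeroʳ (+ m))
    (ℤ.*-monoˡ-≤-nonNeg (+ m) y≤0)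

  Vect : ℕ → Set
  Vect n = Fin n → ℤ

  infixl 6 _⊕_
  _⊕_ : ∀ {n} → Vect n → Vect n → Vect n
  (u ⊕ v) s = u s + v s

  neg : ∀ {n} → Vect n → Vect n
  neg u s = - u s

  Pos Neg : ∀ {n} → Vect n → Set
  Pos v = ∀ s → 0ℤ ≤ v s
  Neg v = ∀ s → v s ≤ 0ℤ

  Pos-resp : ∀ {n} {u v : Vect n} → u ≗ v → Pos u → Pos v
  Pos-resp u≗v 0≤u s = ≡.subst (0ℤ ≤_) (u≗v s) (0≤u s)

  Neg-resp : ∀ {n} {u v : Vect n} → u ≗ v → Neg u → Neg v
  Neg-resp u≗v u≤0 s = ≡.subst (_≤ 0ℤ) (u≗v s) (u≤0 s)

  Pos-⊕ : ∀ {n} {u v : Vect n} → Pos u → Pos v → Pos (u ⊕ v)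
  Pos-⊕ p q s = ℤ.+-mono-≤ (p s) (q s)

  Pos⇒Neg-neg : ∀ {n} {u : Vect n} → Pos u → Neg (neg u)
  Pos⇒Neg-neg p s = ℤ.neg-mono-≤ (p s)

  Pos-basis : ∀ {n} (k : Fin n) → Pos (basis k)
  Pos-basis k s with does (k Fin.≟ s)
  ... | true  = +≤+ z≤n
  ... | false = ℤ.≤-refl

  sum-sub : ∀ {n} (f g : Fin n → ℤ) → sum (λ s → f s - g s) ≡ sum f - sum g
  sum-sub {ℕ.zero}  f g = refl
  sum-sub {ℕ.suc n} f g = trans (cong (_+_ (f zero - g zero))
    (sum-sub (λ s → f (suc s)) (λ s → g (suc s))))
    (regroup (f zero) (g zero) (sum (λ s → f (suc s))) (sum (λ s → g (suc s))))
    where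
    regroup : ∀ a b c d → (a - b) + (c - d) ≡ (a + c) - (b + d)
    regroup = solve-∀

  module _ {A : Set} where

    listSum : (A → ℤ) → List A → ℤ
    listSum g []       = 0ℤ
    listSum g (x ∷ xs) = g x + listSum g xs

    listSum-cong : ∀ {g h} → g ≗ h → ∀ xs → listSum g xs ≡ listSum h xs
    listSum-cong g≗h []       = refl
    listSum-cong g≗h (x ∷ xs) = cong₂ _+_ (g≗h x) (listSum-cong g≗h xs)

    listSum-map : ∀ g (h : A → A) xs → listSum g (map h xs) ≡ listSum (λ x → g (h x)) xs
    listSum-map g h []       = refl
    listSum-map g h (x ∷ xs) = cong (_+_ (g (h x))) (listSum-map g h xs)

    listSum-linear : ∀ a g b h xs → listSum (λ x → a * g x + b * h x) xs ≡ a * listSum g xs + b *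
      listSum h xs
    listSum-linear a g b h []       = sym (trans (cong₂ _+_ (ℤ.*-zeroʳ a) (ℤ.*-zeroʳ b)) refl)
    listSum-linear a g b h (x ∷ xs) = trans (cong (_+_ (a * g x + b * h x))
      (listSum-linear a g b h xs))
      (regroup a (g x) b (h x) (listSum g xs) (listSum h xs))
      where
      regroup : ∀ a x b y s t → (a * x + b * y) + (a * s + b * t) ≡ a * (x + s) + b * (y + t)
      regroup = solve-∀

    listSum-↭ : ∀ g {xs ys} → xs ↭ ys → listSum g xs ≡ listSum g ys
    listSum-↭ g Perm.refl          = refl
    listSum-↭ g (Perm.prep x p)    = cong (_+_ (g x)) (listSum-↭ g p)
    listSum-↭ g (Perm.swap {xs} {ys} x y p) = trans (exchange (g x) (g y) (listSum g xs))
      (cong (λ z → g y + (g x + z)) (listSum-↭ g p))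
      where
      exchange : ∀ a b c → a + (b + c) ≡ b + (a + c)
      exchange = solve-∀
    listSum-↭ g (Perm.trans p q)   = trans (listSum-↭ g p) (listSum-↭ g q)

    listSum-nonneg : ∀ {g} → (∀ x → 0ℤ ≤ g x) → ∀ xs → 0ℤ ≤ listSum g xs
    listSum-nonneg 0≤g []       = ℤ.≤-refl
    listSum-nonneg 0≤g (x ∷ xs) = ℤ.+-mono-≤ (0≤g x) (listSum-nonneg 0≤g xs)

    listSum-sum : ∀ {n} (g : Fin n → A → ℤ) xs → listSum (λ x → sum (λ s → g s x)) xs ≡ sum
      (λ s → listSum (g s) xs)
    listSum-sum {n} g []       = sym (sum-zero {n} {λ _ → 0ℤ} λ _ → refl)
    listSum-sum g (x ∷ xs) = trans (cong (_+_ (sum (λ s → g s x))) (listSum-sum g xs))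
      (sym (∑-distrib-+ (λ s → g s x) (λ s → listSum (g s) xs)))

  nonneg-sum-zero : ∀ {x y} → 0ℤ ≤ x → 0ℤ ≤ y → x + y ≡ 0ℤ → x ≡ 0ℤ × y ≡ 0ℤ
  nonneg-sum-zero {+ 0} {+ 0} _ _ _ = refl , refl

  listSum-zero : ∀ {A : Set} {g : A → ℤ} → (∀ x → 0ℤ ≤ g x) → ∀ xs → listSum g xs ≡ 0ℤ → ∀ {x} → x
    ∈ˡ xs → g x ≡ 0ℤ
  listSum-zero 0≤g (x ∷ xs) eq (here refl) = proj₁
    (nonneg-sum-zero (0≤g x) (listSum-nonneg 0≤g xs) eq)
  listSum-zero 0≤g (x ∷ xs) eq (there x∈)  = listSum-zero 0≤g xs
    (proj₂ (nonneg-sum-zero (0≤g x) (listSum-nonneg 0≤g xs) eq)) x∈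

  square-nonneg : ∀ x → 0ℤ ≤ x * x
  square-nonneg (+ n)      = *-nonneg {+ n} {+ n} (+≤+ z≤n) (+≤+ z≤n)
  square-nonneg (-[1+ n ]) = +≤+ z≤n

  square-zero : ∀ x → x * x ≡ 0ℤ → x ≡ 0ℤ
  square-zero x eq = [ (λ p → p) , (λ p → p) ]′ (ℤ.i*j≡0⇒i≡0∨j≡0 x eq)

  -- The bounds are those for pairings of positive roots: x and y will be the pairings of one
  -- positive root with the two summands of another.
  sum-to-minus-one : ∀ {x y} → -[1+ 0 ] Int.≤ x → -[1+ 0 ] Int.≤ y → x Int.+ y ≡ -[1+ 0 ] →
    (x ≡ 0ℤ × y ≡ -[1+ 0 ]) ⊎ (x ≡ -[1+ 0 ] × y ≡ 0ℤ)
  sum-to-minus-one {+ 0}       {y} _ _ eq = inj₁ (≡.refl , ≡.trans (≡.sym (ℤ.+-identityˡ y)) eq)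
  sum-to-minus-one {+ ℕ.suc x} { -[1+ 0 ]} _ _ ()
  sum-to-minus-one {+ ℕ.suc x} { -[1+ ℕ.suc y ]} _ (-≤- ()) _
  sum-to-minus-one { -[1+ 0 ]} {+ 0} _ _ _ = inj₂ (≡.refl , ≡.refl)
  sum-to-minus-one { -[1+ ℕ.suc x ]} (-≤- ()) _ _

  -- Tailored to `combination`, where w is the slack of an inequality and x, y, z measure how far
  -- three pairings are from their extreme values.
  nonneg-sum≡0 : ∀ {x y z w} → 0ℤ Int.≤ x → 0ℤ Int.≤ y → 0ℤ Int.≤ z → 0ℤ Int.≤ w →
    x Int.+ y Int.+ + 2 Int.* z Int.+ w ≡ 0ℤ → x ≡ 0ℤ × y ≡ 0ℤ × z ≡ 0ℤ
  nonneg-sum≡0 {+ 0} {+ 0} {+ 0} {+ w} _ _ _ _ _ = ≡.refl , ≡.refl , ≡.refl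
  nonneg-sum≡0 {+ 0} {+ 0} {+ ℕ.suc z} {+ w} _ _ _ _ ()
  nonneg-sum≡0 {+ 0} {+ ℕ.suc y} {+ 0} {+ w} _ _ _ _ ()
  nonneg-sum≡0 {+ 0} {+ ℕ.suc y} {+ ℕ.suc z} {+ w} _ _ _ _ ()
  nonneg-sum≡0 {+ ℕ.suc x} {+ y} {+ 0} {+ w} _ _ _ _ ()
  nonneg-sum≡0 {+ ℕ.suc x} {+ y} {+ ℕ.suc z} {+ w} _ _ _ _ ()

open IntegerSums

bounded : ∀ {n} (N : Fin n → ℕ) → ∃[ m ] (∀ s → N s ℕ.< m)
bounded {ℕ.zero}  N = 0 , λ ()
bounded {ℕ.suc n} N with m , N<m ← bounded (λ s → N (suc s)) =
  ℕ.suc (N zero) ℕ.⊔ m , λ { zero → ℕₚ.m≤m⊔n (ℕ.suc (N zero)) m ; (suc s) → ℕₚ.≤-trans (N<m s)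
    (ℕₚ.m≤n⊔m (ℕ.suc (N zero)) m) }

Pointwise-unsnoc : ∀ {A : Set} {R : A → A → Set} xs ys {x y} → Pointwise R (xs ++ [ x ])
  (ys ++ [ y ]) → Pointwise R xs ys
Pointwise-unsnoc []       []       _        = []
Pointwise-unsnoc []       (y ∷ []) (_ ∷ ())
Pointwise-unsnoc []       (y ∷ _ ∷ _) (_ ∷ ())
Pointwise-unsnoc (x ∷ []) []       (_ ∷ ())
Pointwise-unsnoc (x ∷ _ ∷ _) []    (_ ∷ ())
Pointwise-unsnoc (x ∷ xs) (y ∷ ys) (r ∷ rs) = r ∷ Pointwise-unsnoc xs ys rs

-- Even lattices and reflections in norm-2 vectors

module Lattice {n} (a : Fin n → Fin n → ℤ)
  (a-sym : ∀ s t → a s t ≡ a t s)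
  (a-diag : ∀ s → a s s ≡ + 2)
  (a-off : ∀ {s t} → s ≢ t → a s t Int.≤ 0ℤ) where
  open ≡ using (refl; sym; trans; cong; cong₂; module ≡-Reasoning)
  open Int using (_+_; _*_; _-_; -_; _≤_; _<_)
  open FormOver ℤ.+-*-commutativeRing using (basis; sum; sum-basis; form; form-basisˡ; form-cong;
    form-linearˡ; form-sym)


  opaque
    ⟪_,_⟫ : Vect n → Vect n → ℤ
    ⟪ u , v ⟫ = form a u v

    ⟨⟩-cong : ∀ {u u′ v v′} → u ≗ u′ → v ≗ v′ → ⟪ u , v ⟫ ≡ ⟪ u′ , v′ ⟫
    ⟨⟩-cong = form-cong a

    ⟨⟩-sym : ∀ u v → ⟪ u , v ⟫ ≡ ⟪ v , u ⟫
    ⟨⟩-sym = form-sym a a-sym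

    ⟨⟩-linearˡ : ∀ x u y v w → ⟪ (λ s → x * u s + y * v s) , w ⟫ ≡ x * ⟪ u , w ⟫ + y * ⟪ v , w ⟫
    ⟨⟩-linearˡ = form-linearˡ a

    ⟨⟩-form : ∀ u v → ⟪ u , v ⟫ ≡ form a u v
    ⟨⟩-form u v = refl

    ⟨⟩-basisˡ : ∀ k v → ⟪ basis k , v ⟫ ≡ sum (λ t → v t * a k t)
    ⟨⟩-basisˡ = form-basisˡ a

    ⟨⟩-even : ∀ u → ∃[ k ] ⟪ u , u ⟫ ≡ + 2 * k
    ⟨⟩-even u = symmetric-sum-even (λ s t → (u s * u t) * a s t) (λ s → u s * u s)
      (λ s t → cong₂ _*_ (ℤ.*-comm (u s) (u t)) (a-sym s t))
      (λ s → trans (cong (u s * u s *_) (a-diag s)) (ℤ.*-comm (u s * u s) (+ 2)))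

    -- Diagonal terms vanish because the two parts have disjoint supports, and off the diagonal the
    -- matrix entries are nonpositive.
    ⟨⁺,⁻⟩-nonpos : ∀ (u : Vect n) → ⟪ (λ s → u s ⁺) , (λ s → u s ⁻) ⟫ ≤ 0ℤ
    ⟨⁺,⁻⟩-nonpos u = sum-nonpos {f = λ s → sum (λ t → (u s ⁺ * u t ⁻) * a s t)} λ s →
      sum-nonpos {f = λ t → (u s ⁺ * u t ⁻) * a s t} (term s)
      where
      term : ∀ s t → (u s ⁺ * u t ⁻) * a s t ≤ 0ℤ
      term s t with s Fin.≟ t
      ... | yes refl = ℤ.≤-reflexive (cong (_* a s s) (⁺*⁻≡0 (u s)))
      ... | no  s≢t  = *-nonneg-nonpos {u s ⁺ * u t ⁻}
        (*-nonneg {u s ⁺} {u t ⁻} (⁺-nonneg (u s)) (⁺-nonneg (- u t))) (a-off s≢t)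

  -- No reference to W: the sign arguments use only the norm, which the action preserves, so they
  -- apply to every image of a simple root.
  Root : Vect n → Set
  Root v = ⟪ v , v ⟫ ≡ + 2

  ⟨⟩-+ˡ : ∀ u v w → ⟪ u ⊕ v , w ⟫ ≡ ⟪ u , w ⟫ + ⟪ v , w ⟫
  ⟨⟩-+ˡ u v w = begin
    ⟪ u ⊕ v , w ⟫                            ≡⟨ ⟨⟩-cong (λ s → one (u s) (v s)) (λ _ → refl) ⟩
    ⟪ (λ s → 1ℤ * u s + 1ℤ * v s) , w ⟫      ≡⟨ ⟨⟩-linearˡ 1ℤ u 1ℤ v w ⟩
    1ℤ * ⟪ u , w ⟫ + 1ℤ * ⟪ v , w ⟫          ≡⟨ one ⟪ u , w ⟫ ⟪ v , w ⟫ ⟨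
    ⟪ u , w ⟫ + ⟪ v , w ⟫                    ∎
    where
    open ≡-Reasoning
    one : ∀ x y → x + y ≡ 1ℤ * x + 1ℤ * y
    one = solve-∀

  ⟨⟩-+ʳ : ∀ u v w → ⟪ w , u ⊕ v ⟫ ≡ ⟪ w , u ⟫ + ⟪ w , v ⟫
  ⟨⟩-+ʳ u v w = trans (⟨⟩-sym w _) (trans (⟨⟩-+ˡ u v w) (cong₂ _+_ (⟨⟩-sym u w) (⟨⟩-sym v w)))

  ⟨⟩-*ˡ : ∀ c u w → ⟪ (λ s → c * u s) , w ⟫ ≡ c * ⟪ u , w ⟫
  ⟨⟩-*ˡ c u w = begin
    ⟪ (λ s → c * u s) , w ⟫                ≡⟨ ⟨⟩-cong (λ s → pad c (u s)) (λ _ → refl) ⟩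
    ⟪ (λ s → c * u s + 0ℤ * u s) , w ⟫     ≡⟨ ⟨⟩-linearˡ c u 0ℤ u w ⟩
    c * ⟪ u , w ⟫ + 0ℤ * ⟪ u , w ⟫         ≡⟨ pad c ⟪ u , w ⟫ ⟨
    c * ⟪ u , w ⟫                          ∎
    where
    open ≡-Reasoning
    pad : ∀ c x → c * x ≡ c * x + 0ℤ * x
    pad = solve-∀

  ⟨⟩-*ʳ : ∀ c u w → ⟪ w , (λ s → c * u s) ⟫ ≡ c * ⟪ w , u ⟫
  ⟨⟩-*ʳ c u w = trans (⟨⟩-sym w _) (trans (⟨⟩-*ˡ c u w) (cong (c *_) (⟨⟩-sym u w)))

  ⟨⟩-negˡ : ∀ u w → ⟪ neg u , w ⟫ ≡ - ⟪ u , w ⟫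
  ⟨⟩-negˡ u w = trans (⟨⟩-cong {v = w} (λ s → ≡.sym (ℤ.-1*i≡-i (u s))) (λ _ → refl))
    (trans (⟨⟩-*ˡ -[1+ 0 ] u w) (ℤ.-1*i≡-i _))

  ⟨⟩-negʳ : ∀ u w → ⟪ w , neg u ⟫ ≡ - ⟪ w , u ⟫
  ⟨⟩-negʳ u w = trans (⟨⟩-sym w _) (trans (⟨⟩-negˡ u w) (cong -_ (⟨⟩-sym u w)))

  ⟨basis,basis⟩ : ∀ s t → ⟪ basis s , basis t ⟫ ≡ a s t
  ⟨basis,basis⟩ s t = trans (⟨⟩-basisˡ s (basis t)) (sum-basis t (a s))

  Root-basis : ∀ s → Root (basis s)
  Root-basis s = trans (⟨basis,basis⟩ s s) (a-diag s)

  Root-resp : ∀ {u v} → u ≗ v → Root u → Root v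
  Root-resp u≗v r = trans (sym (⟨⟩-cong u≗v u≗v)) r

  reflect : Vect n → Vect n → Vect n
  reflect u v s = v s - ⟪ v , u ⟫ * u s

  reflect-cong : ∀ {u u′ v v′} → u ≗ u′ → v ≗ v′ → reflect u v ≗ reflect u′ v′
  reflect-cong p q s = cong₂ _-_ (q s) (cong₂ _*_ (⟨⟩-cong q p) (p s))

  ⟨reflect,⟩ : ∀ u v w → ⟪ reflect u v , w ⟫ ≡ ⟪ v , w ⟫ - ⟪ v , u ⟫ * ⟪ u , w ⟫
  ⟨reflect,⟩ u v w = begin
    ⟪ reflect u v , w ⟫                                ≡⟨ ⟨⟩-cong {v = w}
      (λ s → shape (v s) ⟪ v , u ⟫ (u s)) (λ _ → refl) ⟩
    ⟪ (λ s → 1ℤ * v s + (- ⟪ v , u ⟫) * u s) , w ⟫     ≡⟨ ⟨⟩-linearˡ 1ℤ v (- ⟪ v , u ⟫) u w ⟩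
    1ℤ * ⟪ v , w ⟫ + (- ⟪ v , u ⟫) * ⟪ u , w ⟫         ≡⟨ shape ⟪ v , w ⟫ ⟪ v , u ⟫ ⟪ u , w ⟫ ⟨
    ⟪ v , w ⟫ - ⟪ v , u ⟫ * ⟪ u , w ⟫                  ∎
    where
    open ≡-Reasoning
    shape : ∀ x c y → x - c * y ≡ 1ℤ * x + (- c) * y
    shape = solve-∀

  module _ {u} (root : Root u) where

    ⟨reflect,root⟩ : ∀ v → ⟪ reflect u v , u ⟫ ≡ - ⟪ v , u ⟫
    ⟨reflect,root⟩ v = trans (⟨reflect,⟩ u v u) (trans (cong (λ x → ⟪ v , u ⟫ - ⟪ v , u ⟫ * x) root)
      (flip ⟪ v , u ⟫))
      where
      flip : ∀ x → x - x * + 2 ≡ - x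
      flip = solve-∀

    reflect-isometry : ∀ v w → ⟪ reflect u v , reflect u w ⟫ ≡ ⟪ v , w ⟫
    reflect-isometry v w = begin
      ⟪ reflect u v , reflect u w ⟫
        ≡⟨ ⟨reflect,⟩ u v _ ⟩
      ⟪ v , reflect u w ⟫ - ⟪ v , u ⟫ * ⟪ u , reflect u w ⟫
        ≡⟨ cong₂ (λ x y → x - ⟪ v , u ⟫ * y)
             (trans (⟨⟩-sym v _) (⟨reflect,⟩ u w v))
             (trans (⟨⟩-sym u _) (⟨reflect,root⟩ w)) ⟩
      (⟪ w , v ⟫ - ⟪ w , u ⟫ * ⟪ u , v ⟫) - ⟪ v , u ⟫ * (- ⟪ w , u ⟫)
        ≡⟨ cong₂ (λ x y → (x - ⟪ w , u ⟫ * y) - ⟪ v , u ⟫ * (- ⟪ w , u ⟫)) (⟨⟩-sym w v) (⟨⟩-sym u v)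
          ⟩
      (⟪ v , w ⟫ - ⟪ w , u ⟫ * ⟪ v , u ⟫) - ⟪ v , u ⟫ * (- ⟪ w , u ⟫)
        ≡⟨ cancel ⟪ v , w ⟫ ⟪ w , u ⟫ ⟪ v , u ⟫ ⟩
      ⟪ v , w ⟫ ∎
      where
      open ≡-Reasoning
      cancel : ∀ x y z → (x - y * z) - z * (- y) ≡ x
      cancel = solve-∀

    reflect-involutive : ∀ v → reflect u (reflect u v) ≗ v
    reflect-involutive v s = trans (cong (λ x → reflect u v s - x * u s) (⟨reflect,root⟩ v))
      (cancel (v s) ⟪ v , u ⟫ (u s))
      where
      cancel : ∀ x c y → (x - c * y) - (- c) * y ≡ x
      cancel = solve-∀

    reflect-self : reflect u u ≗ neg u
    reflect-self s = trans (cong (λ x → u s - x * u s) root) (flip (u s))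
      where
      flip : ∀ x → x - + 2 * x ≡ - x
      flip = solve-∀

    Root-reflect : ∀ {v} → Root v → Root (reflect u v)
    Root-reflect {v} r = trans (reflect-isometry v v) r

    -- Since s_u is a linear isometry, conjugating s_v by it yields the reflection in `s_u v`. The
    -- braid relations and the products along palindromes both reduce to this.
    reflect-conj : ∀ v w → reflect u (reflect v w) ≗ reflect (reflect u v) (reflect u w)
    reflect-conj v w s = trans
      (cong (λ x → reflect v w s - x * u s) (⟨reflect,⟩ v w u))
      (trans (regroup (w s) ⟪ w , v ⟫ (v s) ⟪ w , u ⟫ ⟪ v , u ⟫ (u s))
        (cong (λ x → reflect u w s - x * reflect u v s) (sym (reflect-isometry w v))))
      where
      regroup : ∀ w c v d e u →
        (w - c * v) - (d - c * e) * u ≡ (w - d * u) - c * (v - e * u)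
      regroup = solve-∀

  reflect-⊕ : ∀ u v w → reflect u (v ⊕ w) ≗ reflect u v ⊕ reflect u w
  reflect-⊕ u v w s = trans (cong (λ x → (v s + w s) - x * u s) (⟨⟩-+ˡ v w u))
    (regroup (v s) (w s) ⟪ v , u ⟫ ⟪ w , u ⟫ (u s))
    where
    regroup : ∀ v w c d u → (v + w) - (c + d) * u ≡ (v - c * u) + (w - d * u)
    regroup = solve-∀

  reflect-neg : ∀ u v → reflect u (neg v) ≗ neg (reflect u v)
  reflect-neg u v s = trans (cong (λ x → - v s - x * u s) (⟨⟩-negˡ v u))
    (regroup (v s) ⟪ v , u ⟫ (u s))
    where
    regroup : ∀ v c u → - v - (- c) * u ≡ - (v - c * u)
    regroup = solve-∀

  reflect-orthogonal : ∀ {u v} → ⟪ v , u ⟫ ≡ 0ℤ → reflect u v ≗ v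
  reflect-orthogonal {u} {v} eq s = trans (cong (λ x → v s - x * u s) eq) (simp (v s) (u s))
    where
    simp : ∀ v u → v - 0ℤ * u ≡ v
    simp = solve-∀

  reflect-adjacent : ∀ {u v} → ⟪ v , u ⟫ ≡ -[1+ 0 ] → reflect u v ≗ v ⊕ u
  reflect-adjacent {u} {v} eq s = trans (cong (λ x → v s - x * u s) eq) (simp (v s) (u s))
    where
    simp : ∀ v u → v - -[1+ 0 ] * u ≡ v + u
    simp = solve-∀

  PositiveDefinite : Set
  PositiveDefinite = ∀ u → 0ℤ ≤ ⟪ u , u ⟫ × (⟪ u , u ⟫ ≡ 0ℤ → ∀ s → u s ≡ 0ℤ)

  -- Roots of a positive definite lattice

  module Definite (definite : PositiveDefinite) where

    sum-norm : ∀ {u v} → Root u → Root v → ⟪ u ⊕ v , u ⊕ v ⟫ ≡ + 4 + + 2 * ⟪ u , v ⟫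
    sum-norm {u} {v} ru rv = begin
      ⟪ u ⊕ v , u ⊕ v ⟫                      ≡⟨ ⟨⟩-+ˡ u v _ ⟩
      ⟪ u , u ⊕ v ⟫ + ⟪ v , u ⊕ v ⟫          ≡⟨ cong₂ _+_ (⟨⟩-+ʳ u v u) (⟨⟩-+ʳ u v v) ⟩
      (⟪ u , u ⟫ + ⟪ u , v ⟫) + (⟪ v , u ⟫ + ⟪ v , v ⟫)
        ≡⟨ cong₂ (λ x y → (x + ⟪ u , v ⟫) + y) ru (cong₂ _+_ (⟨⟩-sym v u) rv) ⟩
      (+ 2 + ⟪ u , v ⟫) + (⟪ u , v ⟫ + + 2)  ≡⟨ regroup ⟪ u , v ⟫ ⟩
      + 4 + + 2 * ⟪ u , v ⟫                  ∎
      where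
      open ≡-Reasoning
      regroup : ∀ x → (+ 2 + x) + (x + + 2) ≡ + 4 + + 2 * x
      regroup = solve-∀

    opposite : ∀ {u v} → Root u → Root v → ⟪ u , v ⟫ ≡ -[1+ 1 ] → u ≗ neg v
    opposite {u} {v} ru rv eq s = ℤ.i-j≡0⇒i≡j (u s) (- v s)
      (trans (cong (_+_ (u s)) (ℤ.neg-involutive (v s)))
        (proj₂ (definite (u ⊕ v)) (trans (sum-norm ru rv) (cong (λ x → + 4 + + 2 * x) eq)) s))

    Root-neg : ∀ {v} → Root v → Root (neg v)
    Root-neg {v} rv = trans (⟨⟩-negˡ v _) (trans (cong -_ (⟨⟩-negʳ v v))
      (trans (ℤ.neg-involutive _) rv))

    equal : ∀ {u v} → Root u → Root v → ⟪ u , v ⟫ ≡ + 2 → u ≗ v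
    equal {u} {v} ru rv eq s = trans
      (opposite ru (Root-neg rv) (trans (⟨⟩-negʳ v u) (cong -_ eq)) s) (ℤ.neg-involutive _)

    ≥-2 : ∀ {u v} → Root u → Root v → -[1+ 1 ] ≤ ⟪ u , v ⟫
    ≥-2 {u} {v} ru rv = go ⟪ u , v ⟫ (≡.subst (0ℤ ≤_) (sum-norm ru rv) (proj₁ (definite (u ⊕ v))))
      where
      go : ∀ x → 0ℤ ≤ + 4 + + 2 * x → -[1+ 1 ] ≤ x
      go (+ _) _ = -≤+
      go -[1+ 0 ] _ = -≤- z≤n
      go -[1+ 1 ] _ = -≤- (s≤s z≤n)
      go -[1+ ℕ.suc (ℕ.suc k) ] p = contradiction p λ q → ℤ.<⇒≱ (neg<0 k) q
        where
        neg<0 : ∀ k → + 4 + + 2 * -[1+ ℕ.suc (ℕ.suc k) ] < 0ℤ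
        neg<0 k = ≡.subst (_< 0ℤ) (sym (trans (cong (λ x → + 4 + + 2 * x) (split k))
          (expand (+ k)))) (ℤ.neg-mono-< (pos k))
          where
          split : ∀ k → -[1+ ℕ.suc (ℕ.suc k) ] ≡ - (+ 3 + + k)
          split k = refl
          expand : ∀ x → + 4 + + 2 * - (+ 3 + x) ≡ - (+ 2 + + 2 * x)
          expand = solve-∀
          pos : ∀ k → 0ℤ < + 2 + + 2 * + k
          pos k = ℤ.+-mono-<-≤ (+<+ (s≤s z≤n)) (*-nonneg {+ 2} {+ k} (+≤+ z≤n) (+≤+ z≤n))

    not-both : ∀ {v} → Root v → Pos v → ¬ Neg v
    not-both {v} rv pos nonpos = contradiction (trans (sym rv) zero-norm) λ ()
      where
      v≗0 : v ≗ λ _ → 0ℤ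
      v≗0 s = ℤ.≤-antisym (nonpos s) (pos s)
      zero-norm : ⟪ v , v ⟫ ≡ 0ℤ
      zero-norm = trans (⟨⟩-cong {v = v} v≗0 (λ _ → refl)) (⟨⟩-*ˡ 0ℤ v v)

    -- The value -2 would force `u = - v`, making u positive and negative at once.
    ≥-1 : ∀ {u v} → Root u → Root v → Pos u → Pos v → -[1+ 0 ] ≤ ⟪ u , v ⟫
    ≥-1 {u} {v} ru rv pu pv = go ⟪ u , v ⟫ refl (≥-2 ru rv)
      where
      go : ∀ x → x ≡ ⟪ u , v ⟫ → -[1+ 1 ] ≤ x → -[1+ 0 ] ≤ x
      go (+ _)    _  _ = -≤+
      go -[1+ 0 ] _  _ = -≤- z≤n
      go -[1+ 1 ] eq _ = contradiction
        (λ s → ≡.subst (_≤ 0ℤ) (sym (opposite ru rv (sym eq) s)) (ℤ.neg-mono-≤ (pv s)))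
        (not-both ru pu)
      go -[1+ ℕ.suc (ℕ.suc k) ] _ (-≤- (s≤s ()))

    ≤2 : ∀ {u v} → Root u → Root v → ⟪ u , v ⟫ ≤ + 2
    ≤2 {u} {v} ru rv = ≡.subst (_≤ + 2) (trans (cong -_ (⟨⟩-negʳ v u)) (ℤ.neg-involutive _))
      (ℤ.neg-mono-≤ (≥-2 ru (Root-neg rv)))

    -- Writing v = p - q with p, q ≥ 0 of disjoint support, 2 = ⟨p,p⟩ + ⟨q,q⟩ - 2⟨p,q⟩,
    -- where ⟨p,q⟩ ≤ 0 and the lattice is even, so p or q vanishes.
    sign : ∀ {v} → Root v → Pos v ⊎ Neg v
    sign {v} rv with ⟪ p , p ⟫ ℤ.≟ 0ℤ | ⟪ q , q ⟫ ℤ.≟ 0ℤ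
      where
      p q : Vect n
      p s = v s ⁺
      q s = v s ⁻
    ... | yes p≡0 | _ = inj₂ λ s → ≡.subst (_≤ 0ℤ)
      (trans (cong (_- v s ⁻) (sym (proj₂ (definite _) p≡0 s))) (⁺-⁻ (v s)))
      (≡.subst (_≤ 0ℤ) (sym (ℤ.+-identityˡ _)) (ℤ.neg-mono-≤ (⁺-nonneg (- v s))))
    ... | no _ | yes q≡0 = inj₁ λ s → ≡.subst (0ℤ ≤_)
      (trans (trans (sym (ℤ.+-identityʳ _)) (cong (λ x → v s ⁺ - x)
        (sym (proj₂ (definite _) q≡0 s)))) (⁺-⁻ (v s)))
      (⁺-nonneg (v s))
    ... | no p≢0 | no q≢0 = contradiction (absurd-sum {y = ⟪ p , q ⟫} (half p p≢0) (half q q≢0)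
      (⟨⁺,⁻⟩-nonpos v) norm) λ { (+≤+ ()) }
      where
      p q : Vect n
      p s = v s ⁺
      q s = v s ⁻
      half : ∀ u → ⟪ u , u ⟫ ≢ 0ℤ → ∃[ k ] ⟪ u , u ⟫ ≡ + 2 * (1ℤ + + k)
      half u u≢0 with k , eq ← ⟨⟩-even u | proj₁ (definite u)
      ... | 0≤ with k
      ... | + 0 = contradiction eq u≢0
      ... | + ℕ.suc j = j , eq
      ... | -[1+ j ] = contradiction (≡.subst (0ℤ ≤_) eq 0≤) λ ()
      norm : + 2 ≡ ⟪ p , p ⟫ - + 2 * ⟪ p , q ⟫ + ⟪ q , q ⟫
      norm = begin
        + 2                           ≡⟨ rv ⟨
        ⟪ v , v ⟫                     ≡⟨ ⟨⟩-cong (λ s → sym (⁺-⁻ (v s))) (λ s → sym (⁺-⁻ (v s))) ⟩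
        ⟪ p ⊕ neg q , p ⊕ neg q ⟫     ≡⟨ ⟨⟩-+ˡ p (neg q) _ ⟩
        ⟪ p , p ⊕ neg q ⟫ + ⟪ neg q , p ⊕ neg q ⟫
          ≡⟨ cong₂ _+_ (⟨⟩-+ʳ p (neg q) p) (trans (⟨⟩-negˡ q _) (cong -_ (⟨⟩-+ʳ p (neg q) q))) ⟩
        (⟪ p , p ⟫ + ⟪ p , neg q ⟫) + - (⟪ q , p ⟫ + ⟪ q , neg q ⟫)
          ≡⟨ cong₂ (λ x y → (⟪ p , p ⟫ + x) + - y) (⟨⟩-negʳ q p)
            (cong₂ _+_ (⟨⟩-sym q p) (⟨⟩-negʳ q q)) ⟩
        (⟪ p , p ⟫ + - ⟪ p , q ⟫) + - (⟪ p , q ⟫ + - ⟪ q , q ⟫)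
          ≡⟨ regroup ⟪ p , p ⟫ ⟪ p , q ⟫ ⟪ q , q ⟫ ⟩
        ⟪ p , p ⟫ - + 2 * ⟪ p , q ⟫ + ⟪ q , q ⟫ ∎
        where
        open ≡-Reasoning
        regroup : ∀ x y z → (x + - y) + - (y + - z) ≡ x - + 2 * y + z
        regroup = solve-∀
      absurd-sum : ∀ {x y z} → ∃[ k ] x ≡ + 2 * (1ℤ + + k) → ∃[ l ] z ≡ + 2 * (1ℤ + + l) → y ≤ 0ℤ →
        + 2 ≡ x - + 2 * y + z → 1ℤ ≤ 0ℤ
      absurd-sum {y = y} (k , refl) (l , refl) y≤0 eq = ≡.subst (1ℤ ≤_) small big
        where
        big : 1ℤ ≤ 1ℤ + (+ k + (- y + + l))
        big = ℤ.+-monoʳ-≤ 1ℤ (ℤ.+-mono-≤ {0ℤ} {+ k} (+≤+ z≤n)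
          (ℤ.+-mono-≤ {0ℤ} { - y} (ℤ.neg-mono-≤ y≤0) (+≤+ z≤n)))
        regroup : ∀ k y l → + 2 * (1ℤ + k) - + 2 * y + + 2 * (1ℤ + l) ≡ + 2 *
          (+ 2 + (k + (- y + l)))
        regroup = solve-∀
        one : 1ℤ ≡ + 2 + (+ k + (- y + + l))
        one = ℤ.*-cancelˡ-≡ (+ 2) 1ℤ _ (trans eq (regroup (+ k) y (+ l)))
        shift : ∀ x → 1ℤ + x ≡ (+ 2 + x) - 1ℤ
        shift = solve-∀
        small : 1ℤ + (+ k + (- y + + l)) ≡ 0ℤ
        small = trans (shift (+ k + (- y + + l))) (cong (_- 1ℤ) (sym one))

    -- A simple reflection changes only the coordinate at t. All other coordinates of β are thus
    -- both nonnegative and nonpositive, so β is a nonnegative multiple `k α_t`, and its norm `2 k²`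
    -- must be 2.
    simple-flip : ∀ {β} t → Root β → Pos β → Neg (reflect (basis t) β) → β ≗ basis t
    simple-flip {β} t rβ pβ nβ = λ s → trans (β≗ s)
      (trans (cong (_* basis t s) k≡1) (ℤ.*-identityˡ _))
      where
      k c : ℤ
      k = β t
      c = ⟪ β , basis t ⟫
      β≗ : β ≗ λ s → k * basis t s
      β≗ s with t Fin.≟ s | nβ s
      ... | yes refl | _ = sym (ℤ.*-identityʳ _)
      ... | no  _    | q = trans (ℤ.≤-antisym (≡.subst (_≤ 0ℤ) (simp (β s) c) q) (pβ s))
        (sym (ℤ.*-zeroʳ k))
        where
        simp : ∀ x c → x - c * 0ℤ ≡ x
        simp = solve-∀
      norm : + 2 ≡ k * (k * + 2)
      norm = begin
        + 2                                             ≡⟨ rβ ⟨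
        ⟪ β , β ⟫                                       ≡⟨ ⟨⟩-cong β≗ β≗ ⟩
        ⟪ (λ s → k * basis t s) , (λ s → k * basis t s) ⟫ ≡⟨ ⟨⟩-*ˡ k (basis t) _ ⟩
        k * ⟪ basis t , (λ s → k * basis t s) ⟫         ≡⟨ cong (k *_) (⟨⟩-*ʳ k (basis t) (basis t))
          ⟩
        k * (k * ⟪ basis t , basis t ⟫)                 ≡⟨ cong (λ x → k * (k * x)) (Root-basis t) ⟩
        k * (k * + 2)                                   ∎
        where open ≡-Reasoning
      k≡1 : k ≡ 1ℤ
      k≡1 = go k (pβ t) norm
        where
        go : ∀ k → 0ℤ ≤ k → + 2 ≡ k * (k * + 2) → k ≡ 1ℤ
        go (+ 0) _ ()
        go (+ 1) _ _ = refl
        go (+ ℕ.suc (ℕ.suc k)) _ ()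

    -- If `x + y = α_t`, then `⟨x,α_t⟩ = 2 - 1 = 1`, so `s_t x = x - α_t = - y` is negative. By
    -- `simple-flip` x is α_t, whose pairing with α_t is 2.
    simple-indecomposable : ∀ {x y} t → Root x → Root y → Pos x → Pos y → ⟪ x , y ⟫ ≡ -[1+ 0 ] → ¬
      (x ⊕ y ≗ basis t)
    simple-indecomposable {x} {y} t rx ry px py eq sum≗ =
      contradiction (trans (sym ⟨x,t⟩) (trans (⟨⟩-cong {u = x} {v = basis t} x≗t (λ _ → refl))
        (Root-basis t))) λ ()
      where
      ⟨x,t⟩ : ⟪ x , basis t ⟫ ≡ 1ℤ
      ⟨x,t⟩ = trans (⟨⟩-cong {u = x} (λ _ → refl) (λ s → sym (sum≗ s)))
        (trans (⟨⟩-+ʳ x y x) (cong₂ _+_ rx eq))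
      reflected : neg y ≗ reflect (basis t) x
      reflected s = trans (rearrange (x s) (y s)) (cong₂ (λ c e → x s - c * e) (sym ⟨x,t⟩) (sum≗ s))
        where
        rearrange : ∀ x y → - y ≡ x - 1ℤ * (x + y)
        rearrange = solve-∀
      x≗t : x ≗ basis t
      x≗t = simple-flip t rx px (Neg-resp reflected (Pos⇒Neg-neg py))

-- The root lattice, its action of W, and the dual action

module RootLattice {n} (M : CoxeterMatrix n) (simplyLaced : SimplyLaced M) where
  open ≡ using (refl; sym; trans; cong; cong₂; module ≡-Reasoning)
  open Int using (_+_; _*_; _-_; -_; _≤_; _<_)
  open FormOver ℤ.+-*-commutativeRing using (basis; sum; sum-basis; sum-cong-≋; sum-zero;
    *-distribˡ-sum; *-distribʳ-sum)
  open Membership using (find) renaming (_∈_ to _∈ˡ_)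
  open Membershipₚ using (∈-map⁺; ∈-map⁻; ∈-deduplicate⁺; ∈-deduplicate⁻; ∈-cartesianProductWith⁺;
    ∈-cartesianProductWith⁻; ∈-allFin)
  open CoxeterMatrix M
  open Coxeter M

  -- Twice the Gram matrix of the standard geometric representation, which is integral in the
  -- simply-laced case.
  cartan : Fin n → Fin n → ℤ
  cartan s t with s Fin.≟ t
  ... | yes _   = + 2
  ... | no  s≢t = [ const 0ℤ , const -[1+ 0 ] ]′ (simplyLaced s≢t)

  cartan-diag : ∀ s → cartan s s ≡ + 2
  cartan-diag s with s Fin.≟ s
  ... | yes _   = refl
  ... | no  s≢s = contradiction refl s≢s

  cartan-off : ∀ {s t} → s ≢ t → cartan s t ≤ 0ℤ
  cartan-off {s} {t} s≢t with s Fin.≟ t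
  ... | yes s≡t = contradiction s≡t s≢t
  ... | no  s≢t′ with simplyLaced s≢t′
  ... | inj₁ _ = ℤ.≤-refl
  ... | inj₂ _ = -≤+

  -- Both `cartan` and the relations of W depend on the answer of `simplyLaced`, which takes a proof
  -- of `s ≢ t`; this type ties the order `m s t` to the Cartan entry actually computed.
  data Related (s t : Fin n) : Set where
    orthogonal : m s t ≡ 2 → cartan s t ≡ 0ℤ → Related s t
    adjacent   : m s t ≡ 3 → cartan s t ≡ -[1+ 0 ] → Related s t

  related : ∀ {s t} → s ≢ t → Related s t
  related {s} {t} s≢t with s Fin.≟ t in eq
  ... | yes s≡t = contradiction s≡t s≢t
  ... | no  s≢t′ with simplyLaced s≢t′ in eq′
  ... | inj₁ m≡2 = orthogonal m≡2 (lemma eq eq′)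
    where
    lemma : ∀ {s≢t m≡2} → (s Fin.≟ t) ≡ no s≢t → simplyLaced s≢t ≡ inj₁ m≡2 → cartan s t ≡ 0ℤ
    lemma p q rewrite p | q = refl
  ... | inj₂ m≡3 = adjacent m≡3 (lemma eq eq′)
    where
    lemma : ∀ {s≢t m≡3} → (s Fin.≟ t) ≡ no s≢t → simplyLaced s≢t ≡ inj₂ m≡3 → cartan s t ≡ -[1+ 0 ]
    lemma p q rewrite p | q = refl

  cartan-sym : ∀ s t → cartan s t ≡ cartan t s
  cartan-sym s t with s Fin.≟ t
  ... | yes refl = sym (cartan-diag s)
  ... | no  s≢t with simplyLaced s≢t | related {t} {s} (λ p → s≢t (sym p))
  ... | inj₁ m≡2 | orthogonal _ c = sym c
  ... | inj₂ m≡3 | adjacent _ c   = sym c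
  ... | inj₁ m≡2 | adjacent m≡3 _ = contradiction (trans (sym m≡2) (trans (symmetric s t) m≡3)) λ ()
  ... | inj₂ m≡3 | orthogonal m≡2 _ = contradiction (trans (sym m≡3) (trans (symmetric s t) m≡2))
    λ ()

  open Lattice cartan cartan-sym cartan-diag cartan-off public

  ρ : Fin n → Vect n → Vect n
  ρ s = reflect (basis s)

  actᶻ : Word → Vect n → Vect n
  actᶻ w v = foldr ρ v w

  ρ-cong : ∀ s {u v} → u ≗ v → ρ s u ≗ ρ s v
  ρ-cong s = reflect-cong (λ _ → refl)

  ρ-involutive : ∀ s v → ρ s (ρ s v) ≗ v
  ρ-involutive s = reflect-involutive (Root-basis s)

  actᶻ-cong : ∀ w {u v} → u ≗ v → actᶻ w u ≗ actᶻ w v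
  actᶻ-cong []      p = p
  actᶻ-cong (s ∷ w) p = ρ-cong s (actᶻ-cong w p)

  actᶻ-++ : ∀ u w v → actᶻ (u ++ w) v ≡ actᶻ u (actᶻ w v)
  actᶻ-++ u w v = foldr-++ ρ v u w

  actᶻ-isometry : ∀ w u v → ⟪ actᶻ w u , actᶻ w v ⟫ ≡ ⟪ u , v ⟫
  actᶻ-isometry []      u v = refl
  actᶻ-isometry (s ∷ w) u v = trans (reflect-isometry (Root-basis s) _ _) (actᶻ-isometry w u v)

  Root-actᶻ : ∀ w {v} → Root v → Root (actᶻ w v)
  Root-actᶻ w {v} rv = trans (actᶻ-isometry w v v) rv

  -- Both sides are the reflection in `α_s + α_t`, which is `s α_t` as well as `t α_s`.
  ρ-braid : ∀ s t → cartan s t ≡ -[1+ 0 ] → ∀ v → ρ s (ρ t (ρ s v)) ≗ ρ t (ρ s (ρ t v))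
  ρ-braid s t c v i = begin
    ρ s (ρ t (ρ s v)) i                   ≡⟨ reflect-conj (Root-basis s) (basis t) (ρ s v) i ⟩
    reflect (ρ s (basis t)) (ρ s (ρ s v)) i
      ≡⟨ reflect-cong swapped (λ j → trans (ρ-involutive s v j) (sym (ρ-involutive t v j))) i ⟩
    reflect (ρ t (basis s)) (ρ t (ρ t v)) i ≡⟨ reflect-conj (Root-basis t) (basis s) (ρ t v) i ⟨
    ρ t (ρ s (ρ t v)) i                   ∎
    where
    open ≡-Reasoning
    swapped : ρ s (basis t) ≗ ρ t (basis s)
    swapped j = trans (reflect-adjacent (trans (⟨basis,basis⟩ t s) (trans (cartan-sym t s) c)) j)
      (trans (ℤ.+-comm (basis t j) (basis s j))
        (sym (reflect-adjacent (trans (⟨basis,basis⟩ s t) c) j)))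

  ρ-commute : ∀ s t → cartan s t ≡ 0ℤ → ∀ v → ρ s (ρ t v) ≗ ρ t (ρ s v)
  ρ-commute s t c v i = trans (reflect-conj (Root-basis s) (basis t) v i)
    (reflect-cong {v = ρ s v} (reflect-orthogonal (trans (⟨basis,basis⟩ t s)
      (trans (cartan-sym t s) c))) (λ _ → refl) i)

  actᶻ-relation : ∀ s t v → actᶻ (alternating (m s t) s t) v ≗ v
  actᶻ-relation s t v with s Fin.≟ t
  ... | yes refl rewrite diagonal s = ρ-involutive s v
  ... | no s≢t with related s≢t
  ... | orthogonal m≡2 c rewrite m≡2 = λ i → begin
    ρ s (ρ t (ρ s (ρ t v))) i ≡⟨ ρ-commute s t c (ρ s (ρ t v)) i ⟩
    ρ t (ρ s (ρ s (ρ t v))) i ≡⟨ ρ-cong t (ρ-involutive s (ρ t v)) i ⟩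
    ρ t (ρ t v) i             ≡⟨ ρ-involutive t v i ⟩
    v i                       ∎
    where open ≡-Reasoning
  ... | adjacent m≡3 c rewrite m≡3 = λ i → begin
    ρ s (ρ t (ρ s (ρ t (ρ s (ρ t v))))) i ≡⟨ ρ-braid s t c (ρ t (ρ s (ρ t v))) i ⟩
    ρ t (ρ s (ρ t (ρ t (ρ s (ρ t v))))) i ≡⟨ ρ-cong t (ρ-cong s (ρ-involutive t (ρ s (ρ t v)))) i ⟩
    ρ t (ρ s (ρ s (ρ t v))) i             ≡⟨ ρ-cong t (ρ-involutive s (ρ t v)) i ⟩
    ρ t (ρ t v) i                         ≡⟨ ρ-involutive t v i ⟩
    v i                                   ∎
    where open ≡-Reasoning

  actᶻ-∼ : ∀ {u w} → u ∼ w → ∀ v → actᶻ u v ≗ actᶻ w v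
  actᶻ-∼ (relation s t) v i = actᶻ-relation s t v i
  actᶻ-∼ (++-cong {u} {u′} {w} {w′} p q) v i = begin
    actᶻ (u ++ w) v i       ≡⟨ ≡.cong-app (actᶻ-++ u w v) i ⟩
    actᶻ u (actᶻ w v) i     ≡⟨ actᶻ-∼ p (actᶻ w v) i ⟩
    actᶻ u′ (actᶻ w v) i    ≡⟨ actᶻ-cong u′ (actᶻ-∼ q v) i ⟩
    actᶻ u′ (actᶻ w′ v) i   ≡⟨ ≡.cong-app (actᶻ-++ u′ w′ v) i ⟨
    actᶻ (u′ ++ w′) v i     ∎
    where open ≡-Reasoning
  actᶻ-∼ ∼-refl        v i = refl
  actᶻ-∼ (∼-sym p)     v i = sym (actᶻ-∼ p v i)
  actᶻ-∼ (∼-trans p q) v i = trans (actᶻ-∼ p v i) (actᶻ-∼ q v i)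

  ⟨⟩-expandˡ : ∀ u v → ⟪ u , v ⟫ ≡ sum (λ s → u s * ⟪ basis s , v ⟫)
  ⟨⟩-expandˡ u v = trans (⟨⟩-form u v) (sum-cong-≋ λ s → begin
    sum (λ t → (u s * v t) * cartan s t)  ≡⟨ sum-cong-≋ (λ t → ℤ.*-assoc (u s) (v t) (cartan s t)) ⟩
    sum (λ t → u s * (v t * cartan s t))  ≡⟨ *-distribˡ-sum (u s) (λ t → v t * cartan s t) ⟨
    u s * sum (λ t → v t * cartan s t)    ≡⟨ cong (u s *_) (⟨⟩-basisˡ s v) ⟨
    u s * ⟪ basis s , v ⟫                 ∎)
    where open ≡-Reasoning

  -- Covectors are kept as `Vec` rather than as functions to have a decidable propositional
  -- equality, on which the deduplication of the orbit relies.
  pairing : Vec ℤ n → Vect n → ℤ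
  pairing f u = sum (λ s → u s * lookup f s)

  pairing-cong : ∀ f {u v} → u ≗ v → pairing f u ≡ pairing f v
  pairing-cong f p = sum-cong-≋ λ s → cong (_* lookup f s) (p s)

  pairing-basis : ∀ f s → pairing f (basis s) ≡ lookup f s
  pairing-basis f s = sum-basis s (lookup f)

  pairing-ext : ∀ f g → (∀ u → pairing f u ≡ pairing g u) → f ≡ g
  pairing-ext f g p = trans (sym (Vec.tabulate∘lookup f))
    (trans (Vec.tabulate-cong λ s → trans (sym (pairing-basis f s))
      (trans (p (basis s)) (pairing-basis g s)))
           (Vec.tabulate∘lookup g))

  pairing-ρ : ∀ f s u → pairing f (ρ s u) ≡ pairing f u - ⟪ u , basis s ⟫ * lookup f s
  pairing-ρ f s u = begin
    sum (λ t → (u t - c * basis s t) * lookup f t)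
      ≡⟨ sum-cong-≋ (λ t → expand (u t) c (basis s t) (lookup f t)) ⟩
    sum (λ t → u t * lookup f t - c * (basis s t * lookup f t))
      ≡⟨ sum-sub (λ t → u t * lookup f t) (λ t → c * (basis s t * lookup f t)) ⟩
    pairing f u - sum (λ t → c * (basis s t * lookup f t))
      ≡⟨ cong (_-_ (pairing f u)) (*-distribˡ-sum c (λ t → basis s t * lookup f t)) ⟨
    pairing f u - c * pairing f (basis s)
      ≡⟨ cong (λ x → pairing f u - c * x) (pairing-basis f s) ⟩
    pairing f u - c * lookup f s ∎
    where
    open ≡-Reasoning
    c = ⟪ u , basis s ⟫
    expand : ∀ u c e f → (u - c * e) * f ≡ u * f - c * (e * f)
    expand = solve-∀

  -- The contragredient action: covectors are given by their values at the simple roots.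
  coreflect : Fin n → Vec ℤ n → Vec ℤ n
  coreflect s f = tabulate λ t → lookup f t - cartan s t * lookup f s

  pairing-coreflect : ∀ s f u → pairing (coreflect s f) u ≡ pairing f (ρ s u)
  pairing-coreflect s f u = begin
    sum (λ t → u t * lookup (coreflect s f) t)
      ≡⟨ sum-cong-≋ (λ t → trans (cong (u t *_) (Vec.lookup∘tabulate _ t))
        (expand (u t) (lookup f t) (cartan s t) (lookup f s))) ⟩
    sum (λ t → u t * lookup f t - (u t * cartan s t) * lookup f s)
      ≡⟨ sum-sub (λ t → u t * lookup f t) (λ t → (u t * cartan s t) * lookup f s) ⟩
    pairing f u - sum (λ t → (u t * cartan s t) * lookup f s)
      ≡⟨ cong (_-_ (pairing f u)) (*-distribʳ-sum (lookup f s) (λ t → u t * cartan s t)) ⟨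
    pairing f u - sum (λ t → u t * cartan s t) * lookup f s
      ≡⟨ cong (λ x → pairing f u - x * lookup f s) (trans (⟨⟩-sym u (basis s)) (⟨⟩-basisˡ s u)) ⟨
    pairing f u - ⟪ u , basis s ⟫ * lookup f s
      ≡⟨ pairing-ρ f s u ⟨
    pairing f (ρ s u) ∎
    where
    open ≡-Reasoning
    expand : ∀ u f a g → u * (f - a * g) ≡ u * f - (u * a) * g
    expand = solve-∀

  coreflect-involutive : ∀ s f → coreflect s (coreflect s f) ≡ f
  coreflect-involutive s f = pairing-ext _ _ λ u → trans (pairing-coreflect s (coreflect s f) u)
    (trans (pairing-coreflect s f (ρ s u)) (pairing-cong f (ρ-involutive s u)))

  -- This is `f ∘ w`, a right action: the first letter of the word acts first.
  coact : Word → Vec ℤ n → Vec ℤ n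
  coact []      f = f
  coact (s ∷ w) f = coact w (coreflect s f)

  pairing-coact : ∀ w f u → pairing (coact w f) u ≡ pairing f (actᶻ w u)
  pairing-coact []      f u = refl
  pairing-coact (s ∷ w) f u = trans (pairing-coact w (coreflect s f) u)
    (pairing-coreflect s f (actᶻ w u))

  coact-∼ : ∀ {u w} → u ∼ w → ∀ f → coact u f ≡ coact w f
  coact-∼ {u} {w} p f = pairing-ext _ _ λ v → trans (pairing-coact u f v)
    (trans (pairing-cong f (actᶻ-∼ p v)) (sym (pairing-coact w f v)))

  coact-∷ʳ : ∀ w s f → coact (w ++ [ s ]) f ≡ coreflect s (coact w f)
  coact-∷ʳ []      s f = refl
  coact-∷ʳ (t ∷ w) s f = coact-∷ʳ w s (coreflect t f)

  cobasis : Fin n → Vec ℤ n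
  cobasis s = tabulate (basis s)

  pairing-cobasis : ∀ s u → pairing (cobasis s) u ≡ u s
  pairing-cobasis s u = trans
    (sum-cong-≋ λ t → trans (cong (u t *_) (Vec.lookup∘tabulate (basis s) t))
      (ℤ.*-comm (u t) (basis s t)))
    (sum-basis s u)

  -- Positive definiteness from finiteness of W

  module Finite (finite : IsFinite) where

    _≟ⱽ_ : (f g : Vec ℤ n) → Dec (f ≡ g)
    _≟ⱽ_ = Vec.≡-dec ℤ._≟_

    elements : List Word
    elements = proj₁ finite

    opaque
      -- The W-translates of the coordinate functionals. The same functional can arise from several
      -- words, and a repetition would spoil the multiplicities under the action; without
      -- repetitions each simple reflection permutes the list.
      orbit : List (Vec ℤ n)
      orbit = deduplicate _≟ⱽ_ (cartesianProductWith (λ w s → coact w (cobasis s)) elements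
        (allFin n))

      ∈-orbit⁺ : ∀ w s → coact w (cobasis s) ∈ˡ orbit
      ∈-orbit⁺ w s with w′ , w′∈ , p ← find (proj₂ finite w) =
        ≡.subst (_∈ˡ orbit) (sym (coact-∼ p (cobasis s)))
          (∈-deduplicate⁺ _≟ⱽ_ (∈-cartesianProductWith⁺ (λ w s → coact w (cobasis s)) w′∈
            (∈-allFin s)))

      ∈-orbit⁻ : ∀ {f} → f ∈ˡ orbit → ∃[ w ] ∃[ s ] f ≡ coact w (cobasis s)
      ∈-orbit⁻ f∈ with w , s , _ , _ , eq ← ∈-cartesianProductWith⁻ (λ w s → coact w (cobasis s))
        elements (allFin n) (∈-deduplicate⁻ _≟ⱽ_ _ f∈) = w , s , eq

      orbit-unique : Unique orbit
      orbit-unique = DecUnique.deduplicate-! _≟ⱽ_ _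

    coreflect-orbit : ∀ s {f} → f ∈ˡ orbit → coreflect s f ∈ˡ orbit
    coreflect-orbit s f∈ with w , t , refl ← ∈-orbit⁻ f∈ = ≡.subst (_∈ˡ orbit)
      (coact-∷ʳ w s (cobasis t)) (∈-orbit⁺ (w ++ [ s ]) t)

    -- An involution that maps a set into itself permutes it; for lists without repetitions, having
    -- the same members is the same as being permutations of each other.
    orbit-↭ : ∀ s → map (coreflect s) orbit ↭ orbit
    orbit-↭ s = ∼bag⇒↭ (unique∧set⇒bag
      (Unique.map⁺ (λ {f} {g} eq → trans (sym (coreflect-involutive s f))
        (trans (cong (coreflect s) eq) (coreflect-involutive s g)))
        orbit-unique)
      orbit-unique
      (mk⇔ to from))
      where
      to : ∀ {f} → f ∈ˡ map (coreflect s) orbit → f ∈ˡ orbit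
      to f∈ with g , g∈ , refl ← ∈-map⁻ (coreflect s) f∈ = coreflect-orbit s g∈
      from : ∀ {f} → f ∈ˡ orbit → f ∈ˡ map (coreflect s) orbit
      from {f} f∈ = ≡.subst (_∈ˡ _) (coreflect-involutive s f)
        (∈-map⁺ (coreflect s) (coreflect-orbit s f∈))

    invariant : Vect n → Vect n → ℤ
    invariant u v = listSum (λ f → pairing f u * pairing f v) orbit

    invariant-ρ : ∀ s u v → invariant (ρ s u) (ρ s v) ≡ invariant u v
    invariant-ρ s u v = begin
      listSum (λ f → pairing f (ρ s u) * pairing f (ρ s v)) orbit
        ≡⟨ listSum-cong (λ f → sym (cong₂ _*_ (pairing-coreflect s f u) (pairing-coreflect s f v)))
          orbit ⟩
      listSum (λ f → pairing (coreflect s f) u * pairing (coreflect s f) v) orbit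
        ≡⟨ listSum-map (λ f → pairing f u * pairing f v) (coreflect s) orbit ⟨
      listSum (λ f → pairing f u * pairing f v) (map (coreflect s) orbit)
        ≡⟨ listSum-↭ (λ f → pairing f u * pairing f v) (orbit-↭ s) ⟩
      invariant u v ∎
      where open ≡-Reasoning

    invariant-nonneg : ∀ u → 0ℤ ≤ invariant u u
    invariant-nonneg u = listSum-nonneg (λ f → square-nonneg (pairing f u)) orbit

    invariant-definite : ∀ u → invariant u u ≡ 0ℤ → ∀ s → u s ≡ 0ℤ
    invariant-definite u eq s = trans (sym (pairing-cobasis s u))
      (square-zero _ (listSum-zero (λ f → square-nonneg (pairing f u)) orbit eq (∈-orbit⁺ [] s)))

    weight : Fin n → ℤ
    weight s = invariant (basis s) (basis s)

    weight-pos : ∀ s → 0ℤ < weight s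
    weight-pos s = ℤ.≤∧≢⇒< (invariant-nonneg (basis s)) λ eq →
      -- Weight zero would make all coordinates of α_s vanish, but they add up to 1.
      contradiction (trans (sym (sum-basis s (λ _ → 1ℤ))) (sum-zero {f = λ t → basis s t * 1ℤ} λ t →
        cong (_* 1ℤ) (invariant-definite (basis s) (sym eq) t))) λ ()

    -- Apply s to both arguments: with `c = ⟨α_s,v⟩`, the invariant form `I` satisfies `I(α_s,v) =
    -- I(- α_s, v - c α_s) = - I(α_s,v) + c I(α_s,α_s)`.
    invariant-basis : ∀ s v → + 2 * invariant (basis s) v ≡ ⟪ basis s , v ⟫ * weight s
    invariant-basis s v = trans (two (invariant (basis s) v))
      (trans (cong (_+_ (invariant (basis s) v)) expand)
      (cancel (invariant (basis s) v) (⟪ basis s , v ⟫ * weight s)))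
      where
      open ≡-Reasoning
      two : ∀ x → + 2 * x ≡ x + x
      two = solve-∀
      cancel : ∀ x y → x + (-[1+ 0 ] * x + y) ≡ y
      cancel = solve-∀
      c = ⟪ basis s , v ⟫
      term : ∀ x p c → (x - + 2 * x) * (p - c * x) ≡ -[1+ 0 ] * (x * p) + c * (x * x)
      term = solve-∀
      expand : invariant (basis s) v ≡ -[1+ 0 ] * invariant (basis s) v + c * weight s
      expand = begin
        invariant (basis s) v
          ≡⟨ invariant-ρ s (basis s) v ⟨
        listSum (λ f → pairing f (ρ s (basis s)) * pairing f (ρ s v)) orbit
          ≡⟨ listSum-cong (λ f → begin
               pairing f (ρ s (basis s)) * pairing f (ρ s v)
                 ≡⟨ cong₂ _*_ (pairing-ρ f s (basis s)) (pairing-ρ f s v) ⟩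
               (pairing f (basis s) - ⟪ basis s , basis s ⟫ * lookup f s) *
                 (pairing f v - ⟪ v , basis s ⟫ * lookup f s)
                 ≡⟨ cong₂ (λ x y → (pairing f (basis s) - x) * (pairing f v - y))
                      (cong₂ _*_ (Root-basis s) (sym (pairing-basis f s)))
                      (cong₂ _*_ (⟨⟩-sym v (basis s)) (sym (pairing-basis f s))) ⟩
               (pairing f (basis s) - + 2 * pairing f (basis s)) *
                 (pairing f v - c * pairing f (basis s))
                 ≡⟨ term (pairing f (basis s)) (pairing f v) c ⟩
               -[1+ 0 ] * (pairing f (basis s) * pairing f v) + c *
                 (pairing f (basis s) * pairing f (basis s)) ∎) orbit ⟩
        listSum (λ f → -[1+ 0 ] * (pairing f (basis s) * pairing f v) + c *
          (pairing f (basis s) * pairing f (basis s))) orbit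
          ≡⟨ listSum-linear -[1+ 0 ] (λ f → pairing f (basis s) * pairing f v) c
            (λ f → pairing f (basis s) * pairing f (basis s)) orbit ⟩
        -[1+ 0 ] * invariant (basis s) v + c * weight s ∎

    -- By symmetry of the invariant form, its doubled value at `(α_s,α_t)` can be computed by
    -- `invariant-basis` from either side; a nonzero Cartan entry cancels.
    weight-adjacent : ∀ s t → cartan s t ≡ 0ℤ ⊎ weight s ≡ weight t
    weight-adjacent s t with cartan s t ℤ.≟ 0ℤ
    ... | yes c≡0 = inj₁ c≡0
    ... | no  c≢0 = inj₂ (ℤ.*-cancelˡ-≡ (cartan s t) _ _ {{Int.≢-nonZero c≢0}} (begin
      cartan s t * weight s                 ≡⟨ cong (_* weight s) (⟨basis,basis⟩ s t) ⟨
      ⟪ basis s , basis t ⟫ * weight s      ≡⟨ invariant-basis s (basis t) ⟨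
      + 2 * invariant (basis s) (basis t)   ≡⟨ cong (_*_ (+ 2))
        (listSum-cong (λ f → ℤ.*-comm (pairing f (basis s)) (pairing f (basis t))) orbit) ⟩
      + 2 * invariant (basis t) (basis s)   ≡⟨ invariant-basis t (basis s) ⟩
      ⟪ basis t , basis s ⟫ * weight t      ≡⟨ cong (_* weight t)
        (trans (⟨⟩-sym (basis t) (basis s)) (⟨basis,basis⟩ s t)) ⟩
      cartan s t * weight t                 ∎))
      where open ≡-Reasoning

    invariant-expand : ∀ u v → invariant u v ≡ sum (λ s → u s * invariant (basis s) v)
    invariant-expand u v = begin
      listSum (λ f → pairing f u * pairing f v) orbit
        ≡⟨ listSum-cong (λ f → trans (*-distribʳ-sum (pairing f v) (λ s → u s * lookup f s))
             (sum-cong-≋ λ s → trans (ℤ.*-assoc (u s) (lookup f s) (pairing f v))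
               (trans (cong (λ x → u s * (x * pairing f v)) (sym (pairing-basis f s)))
                 (pad (u s) (pairing f (basis s) * pairing f v))))) orbit ⟩
      listSum (λ f → sum (λ s → u s * (pairing f (basis s) * pairing f v) + 0ℤ *
        (pairing f (basis s) * pairing f v))) orbit
        ≡⟨ listSum-sum (λ s f → u s * (pairing f (basis s) * pairing f v) + 0ℤ *
          (pairing f (basis s) * pairing f v)) orbit ⟩
      sum (λ s → listSum (λ f → u s * (pairing f (basis s) * pairing f v) + 0ℤ *
        (pairing f (basis s) * pairing f v)) orbit)
        ≡⟨ sum-cong-≋ (λ s → trans (listSum-linear (u s) (λ f → pairing f (basis s) * pairing f v)
          0ℤ (λ f → pairing f (basis s) * pairing f v) orbit)
                                   (sym (pad (u s) (invariant (basis s) v)))) ⟩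
      sum (λ s → u s * invariant (basis s) v) ∎
      where
      open ≡-Reasoning
      pad : ∀ x y → x * y ≡ x * y + 0ℤ * y
      pad = solve-∀

    -- The hypothesis says that u is supported on simple roots of weight c. Expanding u in simple
    -- roots turns `invariant-basis` into proportionality of the two forms with factor c.
    homogeneous : ∀ c u v → (∀ s → u s * weight s ≡ u s * c) → + 2 * invariant u v ≡ c * ⟪ u , v ⟫
    homogeneous c u v hom = begin
      + 2 * invariant u v                                     ≡⟨ cong (_*_ (+ 2))
        (invariant-expand u v) ⟩
      + 2 * sum (λ s → u s * invariant (basis s) v)           ≡⟨ *-distribˡ-sum (+ 2)
        (λ s → u s * invariant (basis s) v) ⟩
      sum (λ s → + 2 * (u s * invariant (basis s) v))         ≡⟨ sum-cong-≋ term ⟩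
      sum (λ s → c * (u s * ⟪ basis s , v ⟫))                 ≡⟨ *-distribˡ-sum c
        (λ s → u s * ⟪ basis s , v ⟫) ⟨
      c * sum (λ s → u s * ⟪ basis s , v ⟫)                   ≡⟨ cong (c *_) (⟨⟩-expandˡ u v) ⟨
      c * ⟪ u , v ⟫                                           ∎
      where
      open ≡-Reasoning
      swap₁ : ∀ x y → + 2 * (x * y) ≡ x * (+ 2 * y)
      swap₁ = solve-∀
      swap₂ : ∀ x y z → x * (y * z) ≡ (x * z) * y
      swap₂ = solve-∀
      swap₃ : ∀ x y z → (x * z) * y ≡ z * (x * y)
      swap₃ = solve-∀
      term : ∀ s → + 2 * (u s * invariant (basis s) v) ≡ c * (u s * ⟪ basis s , v ⟫)
      term s = begin
        + 2 * (u s * invariant (basis s) v)          ≡⟨ swap₁ (u s) (invariant (basis s) v) ⟩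
        u s * (+ 2 * invariant (basis s) v)          ≡⟨ cong (u s *_) (invariant-basis s v) ⟩
        u s * (⟪ basis s , v ⟫ * weight s)           ≡⟨ swap₂ (u s) ⟪ basis s , v ⟫ (weight s) ⟩
        (u s * weight s) * ⟪ basis s , v ⟫           ≡⟨ cong (_* ⟪ basis s , v ⟫) (hom s) ⟩
        (u s * c) * ⟪ basis s , v ⟫                  ≡⟨ swap₃ (u s) ⟪ basis s , v ⟫ c ⟩
        c * (u s * ⟪ basis s , v ⟫)                  ∎

    homogeneous-definite : ∀ c u → 0ℤ < c → (∀ s → u s * weight s ≡ u s * c) →
      0ℤ ≤ ⟪ u , u ⟫ × (⟪ u , u ⟫ ≡ 0ℤ → ∀ s → u s ≡ 0ℤ)
    homogeneous-definite c u 0<c hom =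
      ℤ.*-cancelˡ-≤-pos 0ℤ ⟪ u , u ⟫ c {{Int.positive 0<c}}
        (≡.subst₂ _≤_ (sym (ℤ.*-zeroʳ c)) (homogeneous c u u hom)
        (*-nonneg {+ 2} {invariant u u} (+≤+ z≤n) (invariant-nonneg u))) ,
      λ eq → invariant-definite u (ℤ.*-cancelˡ-≡ (+ 2) (invariant u u) 0ℤ
        (trans (homogeneous c u u hom) (trans (cong (c *_) eq) (ℤ.*-zeroʳ c))))

    restrict : ∀ {P : Fin n → Set} → Decidable P → Vect n → Vect n
    restrict P? u s = if does (P? s) then u s else 0ℤ

    restrict-yes : ∀ {P : Fin n → Set} (P? : Decidable P) u {s} → P s → restrict P? u s ≡ u s
    restrict-yes P? u {s} p = cong (if_then u s else 0ℤ) (dec-true (P? s) p)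

    restrict-no : ∀ {P : Fin n → Set} (P? : Decidable P) u {s} → ¬ P s → restrict P? u s ≡ 0ℤ
    restrict-no P? u {s} ¬p = cong (if_then u s else 0ℤ) (dec-false (P? s) ¬p)

    hasWeight : ∀ k → Decidable (λ s → ∣ weight s ∣ ≡ k)
    hasWeight k s = ∣ weight s ∣ ℕ.≟ k

    weight-abs : ∀ s → weight s ≡ + ∣ weight s ∣
    weight-abs s = sym (ℤ.0≤i⇒+∣i∣≡i (ℤ.<⇒≤ (weight-pos s)))

    zero-definite : ∀ u → (∀ s → u s ≡ 0ℤ) → ⟪ u , u ⟫ ≡ 0ℤ
    zero-definite u u≡0 = trans (⟨⟩-cong {v = u} u≡0 (λ _ → refl)) (⟨⟩-*ˡ 0ℤ u u)

    -- The case split provides positivity of k: either some simple root has weight k, and weights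
    -- are positive, or the restricted vector is zero.
    top-definite : ∀ k u → let top = restrict (hasWeight k) u in
      0ℤ ≤ ⟪ top , top ⟫ × (⟪ top , top ⟫ ≡ 0ℤ → ∀ s → top s ≡ 0ℤ)
    top-definite k u with Fin.any? (hasWeight k)
    ... | yes (s , eq) = homogeneous-definite (+ k) (restrict (hasWeight k) u)
      (≡.subst (0ℤ <_) (trans (weight-abs s) (cong (λ x → + x) eq)) (weight-pos s)) λ t → hom t
        (hasWeight k t)
      where
      hom : ∀ t → Dec (∣ weight t ∣ ≡ k) → restrict (hasWeight k) u t * weight t ≡ restrict
        (hasWeight k) u t * + k
      hom t (yes eq) = cong (restrict (hasWeight k) u t *_)
        (trans (weight-abs t) (cong (λ x → + x) eq))
      hom t (no ≢k)  = trans (cong (_* weight t) (restrict-no (hasWeight k) u ≢k))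
        (sym (cong (_* + k) (restrict-no (hasWeight k) u ≢k)))
    ... | no none = ℤ.≤-reflexive (sym (zero-definite _ empty)) , λ _ → empty
      where
      empty : ∀ s → restrict (hasWeight k) u s ≡ 0ℤ
      empty s = restrict-no (hasWeight k) u λ eq → none (s , eq)

    -- The weight is constant on each component of the Coxeter graph, where the form is a
    -- multiple of the invariant one; vectors are therefore split by the weights of their supports.
    definite-below : ∀ k u → (∀ s → k ℕ.≤ ∣ weight s ∣ → u s ≡ 0ℤ) →
      0ℤ ≤ ⟪ u , u ⟫ × (⟪ u , u ⟫ ≡ 0ℤ → ∀ s → u s ≡ 0ℤ)
    definite-below ℕ.zero    u u≡0 =
      ℤ.≤-reflexive (sym (zero-definite u λ s → u≡0 s z≤n)) , λ _ s → u≡0 s z≤n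
    definite-below (ℕ.suc k) u u≡0 = nonneg , zero-norm
      where
      open ≡-Reasoning
      low top : Vect n
      low = restrict (λ s → ¬? (hasWeight k s)) u
      top = restrict (hasWeight k) u
      low-yes : ∀ {s} → ∣ weight s ∣ ≢ k → low s ≡ u s
      low-yes = restrict-yes (λ s → ¬? (hasWeight k s)) u
      low-no : ∀ {s} → ∣ weight s ∣ ≡ k → low s ≡ 0ℤ
      low-no eq = restrict-no (λ s → ¬? (hasWeight k s)) u λ ≢k → ≢k eq
      split : ∀ s → Dec (∣ weight s ∣ ≡ k) → u s ≡ low s + top s
      split s (yes eq) = sym (trans (cong₂ _+_ (low-no eq) (restrict-yes (hasWeight k) u eq))
        (ℤ.+-identityˡ (u s)))
      split s (no ≢k)  = sym (trans (cong₂ _+_ (low-yes ≢k) (restrict-no (hasWeight k) u ≢k))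
        (ℤ.+-identityʳ (u s)))
      low-zero : ∀ s → k ℕ.≤ ∣ weight s ∣ → Dec (∣ weight s ∣ ≡ k) → low s ≡ 0ℤ
      low-zero s k≤ (yes eq) = low-no eq
      low-zero s k≤ (no ≢k)  = trans (low-yes ≢k) (u≡0 s (ℕₚ.≤∧≢⇒< k≤ (λ eq → ≢k (sym eq))))
      cross-term : ∀ s t → Dec (∣ weight s ∣ ≡ k) → Dec (∣ weight t ∣ ≡ k) → (low s * top t) *
        cartan s t ≡ 0ℤ
      cross-term s t (yes ≡k) _ = cong (λ x → (x * top t) * cartan s t) (low-no ≡k)
      cross-term s t (no _)  (no ≢k) = cong (_* cartan s t)
        (trans (cong (low s *_) (restrict-no (hasWeight k) u ≢k)) (ℤ.*-zeroʳ (low s)))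
      cross-term s t (no ≢k) (yes ≡k) = trans
        (cong (low s * top t *_) ([ (λ c≡0 → c≡0) , (λ eq → contradiction (trans (cong ∣_∣ eq) ≡k)
          ≢k) ]′ (weight-adjacent s t)))
        (ℤ.*-zeroʳ (low s * top t))
      cross : ⟪ low , top ⟫ ≡ 0ℤ
      cross = trans (⟨⟩-form low top) (sum-zero {f = λ s → sum (λ t → (low s * top t) * cartan s t)}
        λ s →
        sum-zero {f = λ t → (low s * top t) * cartan s t} λ t → cross-term s t (hasWeight k s)
          (hasWeight k t))
      norm : ⟪ u , u ⟫ ≡ ⟪ low , low ⟫ + ⟪ top , top ⟫
      norm = begin
        ⟪ u , u ⟫                              ≡⟨ ⟨⟩-cong (λ s → split s (hasWeight k s))
          (λ s → split s (hasWeight k s)) ⟩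
        ⟪ low ⊕ top , low ⊕ top ⟫              ≡⟨ ⟨⟩-+ˡ low top _ ⟩
        ⟪ low , low ⊕ top ⟫ + ⟪ top , low ⊕ top ⟫ ≡⟨ cong₂ _+_ (⟨⟩-+ʳ low top low)
          (⟨⟩-+ʳ low top top) ⟩
        (⟪ low , low ⟫ + ⟪ low , top ⟫) + (⟪ top , low ⟫ + ⟪ top , top ⟫)
          ≡⟨ cong₂ (λ x y → (⟪ low , low ⟫ + x) + (y + ⟪ top , top ⟫)) cross
            (trans (⟨⟩-sym top low) cross) ⟩
        (⟪ low , low ⟫ + 0ℤ) + (0ℤ + ⟪ top , top ⟫)
          ≡⟨ cong₂ _+_ (ℤ.+-identityʳ ⟪ low , low ⟫) (ℤ.+-identityˡ ⟪ top , top ⟫) ⟩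
        ⟪ low , low ⟫ + ⟪ top , top ⟫ ∎
      low-definite : 0ℤ ≤ ⟪ low , low ⟫ × (⟪ low , low ⟫ ≡ 0ℤ → ∀ s → low s ≡ 0ℤ)
      low-definite = definite-below k low λ s k≤ → low-zero s k≤ (hasWeight k s)
      nonneg : 0ℤ ≤ ⟪ u , u ⟫
      nonneg = ≡.subst (0ℤ ≤_) (sym norm) (ℤ.+-mono-≤ (proj₁ low-definite)
        (proj₁ (top-definite k u)))
      zero-norm : ⟪ u , u ⟫ ≡ 0ℤ → ∀ s → u s ≡ 0ℤ
      zero-norm eq s = trans (split s (hasWeight k s))
        (cong₂ _+_ (proj₂ low-definite (proj₁ both) s) (proj₂ (top-definite k u) (proj₂ both) s))
        where
        both : ⟪ low , low ⟫ ≡ 0ℤ × ⟪ top , top ⟫ ≡ 0ℤ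
        both = nonneg-sum-zero (proj₁ low-definite) (proj₁ (top-definite k u)) (trans (sym norm) eq)

    positiveDefinite : PositiveDefinite
    positiveDefinite u = definite-below (proj₁ bound) u λ s k≤w → contradiction k≤w
      (ℕₚ.<⇒≱ (proj₂ bound s))
      where
      bound : ∃[ k ] (∀ s → ∣ weight s ∣ ℕ.< k)
      bound = bounded (λ s → ∣ weight s ∣)

-- The exchange condition and faithfulness

module Words {n} (M : CoxeterMatrix n) (simplyLaced : SimplyLaced M) (finite : Coxeter.IsFinite M)
  where
  open ≡ using (refl; sym; trans; cong)
  open Int using (-_)
  open FormOver ℤ.+-*-commutativeRing using (basis)
  open CoxeterMatrix M
  open Coxeter M
  open RootLattice M simplyLaced public
  open Finite finite using (positiveDefinite)
  open Definite positiveDefinite public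
  open Group W using (setoid)
  open SetoidReasoning setoid

  actᶻ-reverseˡ : ∀ w v → actᶻ (reverse w) (actᶻ w v) ≗ v
  actᶻ-reverseˡ w v i = trans (sym (≡.cong-app (actᶻ-++ (reverse w) w v) i))
    (actᶻ-∼ (reverse-inverseˡ w) v i)

  actᶻ-reverseʳ : ∀ w v → actᶻ w (actᶻ (reverse w) v) ≗ v
  actᶻ-reverseʳ w v i = trans (sym (≡.cong-app (actᶻ-++ w (reverse w) v) i))
    (actᶻ-∼ (reverse-inverseʳ w) v i)

  actᶻ-⊕ : ∀ w u v → actᶻ w (u ⊕ v) ≗ actᶻ w u ⊕ actᶻ w v
  actᶻ-⊕ []      u v i = refl
  actᶻ-⊕ (s ∷ w) u v i = trans (ρ-cong s (actᶻ-⊕ w u v) i)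
    (reflect-⊕ (basis s) (actᶻ w u) (actᶻ w v) i)

  actᶻ-neg : ∀ w v → actᶻ w (neg v) ≗ neg (actᶻ w v)
  actᶻ-neg []      v i = refl
  actᶻ-neg (s ∷ w) v i = trans (ρ-cong s (actᶻ-neg w v) i) (reflect-neg (basis s) (actᶻ w v) i)

  actᶻ-reflect : ∀ w u v → Root u → actᶻ w (reflect u v) ≗ reflect (actᶻ w u) (actᶻ w v)
  actᶻ-reflect []      u v ru i = refl
  actᶻ-reflect (s ∷ w) u v ru i = trans (ρ-cong s (actᶻ-reflect w u v ru) i)
    (reflect-conj (Root-basis s) (actᶻ w u) (actᶻ w v) i)

  Root-simple : ∀ w s → Root (actᶻ w (basis s))
  Root-simple w s = Root-actᶻ w (Root-basis s)

  ∷-cong : ∀ s {u v} → u ∼ v → s ∷ u ∼ s ∷ v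
  ∷-cong s p = ++-cong (∼-refl {[ s ]}) p

  ++-congˡ : ∀ w {u v} → u ∼ v → w ++ u ∼ w ++ v
  ++-congˡ w p = ++-cong (∼-refl {w}) p

  ++-congʳ : ∀ {u v} w → u ∼ v → u ++ w ∼ v ++ w
  ++-congʳ w p = ++-cong p (∼-refl {w})

  cancel-∷ : ∀ s w → s ∷ s ∷ w ∼ w
  cancel-∷ s w = ++-congʳ w (square s)

  cancel-∷ʳ : ∀ w s → (w ++ [ s ]) ++ [ s ] ∼ w
  cancel-∷ʳ w s = begin
    (w ++ [ s ]) ++ [ s ] ≡⟨ ++-assoc w [ s ] [ s ] ⟩
    w ++ s ∷ s ∷ []       ≈⟨ ++-congˡ w (square s) ⟩
    w ++ []               ≡⟨ ++-identityʳ w ⟩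
    w                     ∎

  commute : ∀ {s t} → m s t ≡ 2 → s ∷ t ∷ [] ∼ t ∷ s ∷ []
  commute {s} {t} m≡2 = begin
    s ∷ t ∷ []                   ≈⟨ ++-congˡ (s ∷ t ∷ []) (square s) ⟨
    s ∷ t ∷ s ∷ s ∷ []           ≈⟨ ++-congˡ (s ∷ t ∷ s ∷ []) (cancel-∷ t [ s ]) ⟨
    s ∷ t ∷ s ∷ t ∷ t ∷ s ∷ []   ≈⟨ ++-congʳ (t ∷ s ∷ [])
      (≡.subst (λ k → alternating k s t ∼ []) m≡2 (relation s t)) ⟩
    t ∷ s ∷ []                   ∎

  braid : ∀ {s t} → m s t ≡ 3 → s ∷ t ∷ s ∷ [] ∼ t ∷ s ∷ t ∷ []
  braid {s} {t} m≡3 = begin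
    s ∷ t ∷ s ∷ []                           ≈⟨ ++-congˡ (s ∷ t ∷ s ∷ []) (square t) ⟨
    s ∷ t ∷ s ∷ t ∷ t ∷ []                   ≈⟨ ++-congˡ (s ∷ t ∷ s ∷ t ∷ []) (cancel-∷ s [ t ]) ⟨
    s ∷ t ∷ s ∷ t ∷ s ∷ s ∷ t ∷ []           ≈⟨ ++-congˡ (s ∷ t ∷ s ∷ t ∷ s ∷ [])
      (cancel-∷ t (s ∷ t ∷ [])) ⟨
    s ∷ t ∷ s ∷ t ∷ s ∷ t ∷ t ∷ s ∷ t ∷ []   ≈⟨ ++-congʳ (t ∷ s ∷ t ∷ [])
      (≡.subst (λ k → alternating k s t ∼ []) m≡3 (relation s t)) ⟩
    t ∷ s ∷ t ∷ []                           ∎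

  reverse-∷ʳ : ∀ (w : Word) s → reverse (w ++ [ s ]) ≡ s ∷ reverse w
  reverse-∷ʳ w s = reverse-++ w [ s ]

  mutual
    -- Starting from α_s, the letters of w act from the right. At a letter t that turns a positive
    -- root negative, that root is α_t by `simple-flip`, and `transport` moves s to the left, where
    -- it meets t and cancels.
    exchange : ∀ k w s → length w ℕ.≤ k → Neg (actᶻ w (basis s)) →
      ∃[ u ] w ++ [ s ] ∼ u × ℕ.suc (length u) ≡ length w
    exchange k [] s _ nonpos = contradiction nonpos (not-both (Root-basis s) (Pos-basis s))
    exchange (ℕ.suc k) (t ∷ w) s (s≤s |w|≤k) nonpos with sign (Root-simple w s)
    ... | inj₂ nonpos′ with u , p , eq ← exchange k w s |w|≤k nonpos′ = t ∷ u , ∷-cong t p , cong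
      ℕ.suc eq
    ... | inj₁ pos = w , ∼-trans (∷-cong t (transport k w s t |w|≤k
      (simple-flip t (Root-simple w s) pos nonpos))) (cancel-∷ t w) , refl

    -- Faithfulness would give this at once, but it is itself deduced from `exchange`; the relation
    -- is therefore derived on words, by cases on the first letter. The bound k drives the recursion
    -- because the words supplied by `exchange` are shorter without being tails of the given one.
    transport : ∀ k w s t → length w ℕ.≤ k → actᶻ w (basis s) ≗ basis t → w ++ [ s ] ∼ t ∷ w
    transport k [] s t _ eq with s Fin.≟ t
    ... | yes refl = ∼-refl
    ... | no  s≢t  = contradiction (trans (sym (eq t)) (basis-off s≢t)) λ 1≡0 → contradiction
      (trans (sym (basis-on t)) 1≡0) λ ()
      where
      basis-off : ∀ {s t} → s ≢ t → basis s t ≡ 0ℤ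
      basis-off {s} {t} s≢t with s Fin.≟ t
      ... | yes s≡t = contradiction s≡t s≢t
      ... | no _    = refl
      basis-on : ∀ t → basis t t ≡ 1ℤ
      basis-on t with t Fin.≟ t
      ... | yes _  = refl
      ... | no t≢t = contradiction refl t≢t
    transport (ℕ.suc k) (r ∷ w) s t (s≤s |w|≤k) eq with r Fin.≟ t
    ... | yes refl = begin
      r ∷ w ++ [ s ]   ≈⟨ ∷-cong r p ⟩
      r ∷ u            ≈⟨ transport k u s r |u|≤k u-eq ⟨
      u ++ [ s ]       ≈⟨ ++-congʳ [ s ] p ⟨
      (w ++ [ s ]) ++ [ s ] ≈⟨ cancel-∷ʳ w s ⟩
      w                ≈⟨ cancel-∷ r w ⟨
      r ∷ r ∷ w        ∎
      where
      w-eq : actᶻ w (basis s) ≗ neg (basis r)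
      w-eq i = trans (sym (ρ-involutive r (actᶻ w (basis s)) i))
        (trans (ρ-cong r eq i) (reflect-self (Root-basis r) i))
      shorter = exchange k w s |w|≤k (Neg-resp (λ i → sym (w-eq i)) (Pos⇒Neg-neg (Pos-basis r)))
      u = proj₁ shorter
      p = proj₁ (proj₂ shorter)
      |u|≤k : length u ℕ.≤ k
      |u|≤k = ℕₚ.≤-trans (ℕₚ.n≤1+n _) (ℕₚ.≤-trans (ℕₚ.≤-reflexive (proj₂ (proj₂ shorter))) |w|≤k)
      u-eq : actᶻ u (basis s) ≗ basis r
      u-eq i = trans (sym (actᶻ-∼ p (basis s) i)) (trans (≡.cong-app (actᶻ-++ w [ s ] (basis s)) i)
        (trans (actᶻ-cong w (reflect-self (Root-basis s)) i)
        (trans (actᶻ-neg w (basis s) i) (trans (cong -_ (w-eq i)) (ℤ.neg-involutive (basis r i))))))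
    ... | no r≢t with related r≢t
    ... | orthogonal m≡2 c = begin
      r ∷ w ++ [ s ]   ≈⟨ ∷-cong r (transport k w s t |w|≤k w-eq) ⟩
      r ∷ t ∷ w        ≈⟨ ++-congʳ w (commute m≡2) ⟩
      t ∷ r ∷ w        ∎
      where
      w-eq : actᶻ w (basis s) ≗ basis t
      w-eq i = trans (sym (ρ-involutive r (actᶻ w (basis s)) i)) (trans (ρ-cong r eq i)
        (reflect-orthogonal (trans (⟨basis,basis⟩ t r) (trans (cartan-sym t r) c)) i))
    ... | adjacent m≡3 c = result
      where
      w-eq : actᶻ w (basis s) ≗ basis t ⊕ basis r
      w-eq i = trans (sym (ρ-involutive r (actᶻ w (basis s)) i)) (trans (ρ-cong r eq i)
        (reflect-adjacent (trans (⟨basis,basis⟩ t r) (trans (cartan-sym t r) c)) i))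
      -- Now `w α_s = α_t + α_r`, so `α_s = x + y` with `⟨x,y⟩ = -1`. As a simple root is
      -- indecomposable, x or y is negative, and `exchange` for the reversed word shortens `t w` or
      -- `r w` respectively.
      x y : Vect n
      x = actᶻ (reverse w) (basis t)
      y = actᶻ (reverse w) (basis r)
      x⊕y : x ⊕ y ≗ basis s
      x⊕y i = trans (sym (actᶻ-⊕ (reverse w) (basis t) (basis r) i))
        (trans (actᶻ-cong (reverse w) (λ j → sym (w-eq j)) i) (actᶻ-reverseˡ w (basis s) i))
      |rev|≤k : length (reverse w) ℕ.≤ k
      |rev|≤k = ≡.subst (ℕ._≤ k) (sym (length-reverse w)) |w|≤k
      reversed : ∀ q → Neg (actᶻ (reverse w) (basis q)) → ∃[ u ] q ∷ w ∼ u × length u ℕ.≤ k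
      reversed q nonpos with u , p , len ← exchange k (reverse w) q |rev|≤k nonpos =
        reverse u
        , ≡.subst (_∼ reverse u) (trans (reverse-∷ʳ (reverse w) q)
          (cong (q ∷_) (reverse-involutive w))) (reverse-cong p)
        , ℕₚ.≤-trans (ℕₚ.≤-reflexive (length-reverse u))
          (ℕₚ.≤-trans (ℕₚ.n≤1+n _) (ℕₚ.≤-trans (ℕₚ.≤-reflexive len) |rev|≤k))
      result : r ∷ w ++ [ s ] ∼ t ∷ r ∷ w
      result with sign (Root-simple (reverse w) t) | sign (Root-simple (reverse w) r)
      ... | inj₁ px | inj₁ py = contradiction x⊕y (simple-indecomposable s
        (Root-simple (reverse w) t) (Root-simple (reverse w) r) px py
        (trans (actᶻ-isometry (reverse w) (basis t) (basis r))
          (trans (⟨basis,basis⟩ t r) (trans (cartan-sym t r) c))))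
      ... | _ | inj₂ ny with u , p , len ← reversed r ny = begin
        r ∷ w ++ [ s ] ≈⟨ ++-congʳ [ s ] p ⟩
        u ++ [ s ]     ≈⟨ transport k u s t len (λ i → trans (sym (actᶻ-∼ p (basis s) i)) (eq i)) ⟩
        t ∷ u          ≈⟨ ∷-cong t p ⟨
        t ∷ r ∷ w      ∎
      ... | inj₂ nx | inj₁ _ with u , p , len ← reversed t nx = begin
        r ∷ w ++ [ s ]         ≈⟨ ++-congˡ [ r ] (++-congʳ [ s ] w∼) ⟩
        r ∷ t ∷ u ++ [ s ]     ≈⟨ ++-congˡ (r ∷ t ∷ []) (transport k u s r len u-eq) ⟩
        r ∷ t ∷ r ∷ u          ≈⟨ ++-congʳ u (braid m≡3) ⟩
        t ∷ r ∷ t ∷ u          ≈⟨ ++-congˡ (t ∷ r ∷ []) w∼ ⟨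
        t ∷ r ∷ w              ∎
        where
        w∼ : w ∼ t ∷ u
        w∼ = ∼-trans (∼-sym (cancel-∷ t w)) (∷-cong t p)
        u-eq : actᶻ u (basis s) ≗ basis r
        u-eq i = trans (sym (actᶻ-∼ p (basis s) i)) (trans (ρ-cong t w-eq i)
          (trans (ρ-cong t (λ j → trans (ℤ.+-comm (basis t j) (basis r j))
            (sym (reflect-adjacent (trans (⟨basis,basis⟩ r t) c) j))) i)
            (ρ-involutive t (basis r) i)))

  -- If `r w` acts trivially, then w acts as r and makes α_r negative, so `exchange` yields a word
  -- for `w r` that is shorter than w and again acts trivially.
  trivial-action : ∀ k w → length w ℕ.≤ k → (∀ v → actᶻ w v ≗ v) → w ∼ []
  trivial-action k [] _ _ = ∼-refl
  trivial-action (ℕ.suc k) (r ∷ w) (s≤s |w|≤k) triv = begin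
    r ∷ w                       ≈⟨ ∷-cong r (cancel-∷ʳ w r) ⟨
    r ∷ (w ++ [ r ]) ++ [ r ]   ≈⟨ ++-congˡ [ r ] (++-congʳ [ r ] (∼-trans p u∼[])) ⟩
    r ∷ r ∷ []                  ≈⟨ square r ⟩
    []                          ∎
    where
    w-act : ∀ v → actᶻ w v ≗ ρ r v
    w-act v i = trans (sym (ρ-involutive r (actᶻ w v) i)) (ρ-cong r (triv v) i)
    shorter = exchange k w r |w|≤k (Neg-resp (λ i → sym (trans (w-act (basis r) i)
      (reflect-self (Root-basis r) i))) (Pos⇒Neg-neg (Pos-basis r)))
    u = proj₁ shorter
    p = proj₁ (proj₂ shorter)
    u∼[] : u ∼ []
    u∼[] = trivial-action k u
      (ℕₚ.≤-trans (ℕₚ.n≤1+n _) (ℕₚ.≤-trans (ℕₚ.≤-reflexive (proj₂ (proj₂ shorter))) |w|≤k))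
      λ v i → trans (sym (actᶻ-∼ p v i)) (trans (≡.cong-app (actᶻ-++ w [ r ] v) i)
        (trans (w-act (ρ r v) i) (ρ-involutive r v i)))

  faithful : ∀ {u w} → (∀ v → actᶻ u v ≗ actᶻ w v) → u ∼ w
  faithful {u} {w} same = begin
    u                      ≡⟨ ++-identityʳ u ⟨
    u ++ []                ≈⟨ ++-congˡ u (reverse-inverseˡ w) ⟨
    u ++ (reverse w ++ w)  ≡⟨ ++-assoc u (reverse w) w ⟨
    (u ++ reverse w) ++ w  ≈⟨ ++-congʳ w (trivial-action (length (u ++ reverse w)) (u ++ reverse w)
      ℕₚ.≤-refl λ v i →
                                trans (≡.cong-app (actᶻ-++ u (reverse w) v) i)
                                  (trans (same (actᶻ (reverse w) v) i) (actᶻ-reverseʳ w v i))) ⟩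
    w                      ∎

  conjugate : Word → Fin n → Word
  conjugate w s = (w ++ [ s ]) ++ reverse w

  actᶻ-conjugate : ∀ w s v → actᶻ (conjugate w s) v ≗ reflect (actᶻ w (basis s)) v
  actᶻ-conjugate w s v i = trans (≡.cong-app (actᶻ-++ (w ++ [ s ]) (reverse w) v) i)
    (trans (≡.cong-app (actᶻ-++ w [ s ] (actᶻ (reverse w) v)) i)
    (trans (actᶻ-reflect w (basis s) (actᶻ (reverse w) v) (Root-basis s) i)
      (reflect-cong {u = actᶻ w (basis s)} (λ _ → refl) (actᶻ-reverseʳ w v) i)))

  -- The argument of `exchange` for an arbitrary reflection. With faithfulness available, the
  -- deletion of the letter t can be verified on vectors instead of words.
  strong-exchange : ∀ x w s → Pos (actᶻ w (basis s)) → Neg (actᶻ x (actᶻ w (basis s))) →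
    ∃[ u ] x ++ conjugate w s ∼ u × ℕ.suc (length u) ≡ length x
  strong-exchange [] w s pos nonpos = contradiction nonpos (not-both (Root-simple w s) pos)
  strong-exchange (t ∷ x) w s pos nonpos with sign (Root-actᶻ x (Root-simple w s))
  ... | inj₂ nonpos′ with u , p , eq ← strong-exchange x w s pos nonpos′ = t ∷ u , ∷-cong t p , cong
    ℕ.suc eq
  ... | inj₁ pos′ = x , p , refl
    where
    xw-eq : actᶻ x (actᶻ w (basis s)) ≗ basis t
    xw-eq = simple-flip t (Root-actᶻ x (Root-simple w s)) pos′ nonpos
    p : t ∷ x ++ conjugate w s ∼ x
    p = faithful λ v i → trans (ρ-cong t (λ j → ≡.cong-app (actᶻ-++ x (conjugate w s) v) j) i)
      (trans (ρ-cong t (actᶻ-cong x (actᶻ-conjugate w s v)) i)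
      (trans (ρ-cong t (actᶻ-reflect x (actᶻ w (basis s)) v (Root-simple w s)) i)
      (trans (ρ-cong t (reflect-cong {v = actᶻ x v} xw-eq (λ _ → refl)) i)
        (ρ-involutive t (actᶻ x v) i))))

  -- Length and reflections

  ℓ-resp : ∀ {u v k} → u ∼ v → ℓ[ u ]≡ k → ℓ[ v ]≡ k
  ℓ-resp p ((r , r∼u , |r|≡k) , minimal) = (r , ∼-trans r∼u p , |r|≡k) , λ r′ q → minimal r′
    (∼-trans q (∼-sym p))

  ℓ-unique : ∀ {u j k} → ℓ[ u ]≡ j → ℓ[ u ]≡ k → j ≡ k
  ℓ-unique ((r , r∼u , refl) , minimal) ((r′ , r′∼u , refl) , minimal′) = ℕₚ.≤-antisym
    (minimal r′ r′∼u) (minimal′ r r∼u)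

  -- For a shortest word u of w, the decidable sign of `u α_s` tells whether appending s raises or
  -- lowers the length by one. In the positive case every word for `w s` makes α_s negative, so
  -- `exchange` turns it into a shorter word for w. Iterated over letters, this makes ℓ total.
  ℓ-∷ʳ : ∀ {w k} s → ℓ[ w ]≡ k → ∃[ j ] ℓ[ w ++ [ s ] ]≡ j
  ℓ-∷ʳ {w} {k} s ((u , u∼w , |u|≡k) , minimal) with sign (Root-simple u s)
  ... | inj₁ pos = ℕ.suc k , (u ++ [ s ] , ++-congʳ [ s ] u∼w , trans (length-++ u)
    (trans (ℕₚ.+-comm (length u) 1) (cong ℕ.suc |u|≡k))) , minimal′
    where
    minimal′ : ∀ v → v ∼ w ++ [ s ] → ℕ.suc k ℕ.≤ length v
    minimal′ v v∼ = ≡.subst (ℕ.suc k ℕ.≤_) (proj₂ (proj₂ shorter))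
      (s≤s (minimal (proj₁ shorter) (∼-trans (∼-sym (proj₁ (proj₂ shorter)))
        (∼-trans (++-congʳ [ s ] v∼) (cancel-∷ʳ w s)))))
      where
      v-eq : neg (actᶻ u (basis s)) ≗ actᶻ v (basis s)
      v-eq i = trans (sym (actᶻ-neg u (basis s) i))
        (trans (actᶻ-cong u (λ j → sym (reflect-self (Root-basis s) j)) i)
        (trans (sym (≡.cong-app (actᶻ-++ u [ s ] (basis s)) i))
          (actᶻ-∼ (∼-trans (++-congʳ [ s ] u∼w) (∼-sym v∼)) (basis s) i)))
      shorter : ∃[ v′ ] v ++ [ s ] ∼ v′ × ℕ.suc (length v′) ≡ length v
      shorter = exchange (length v) v s ℕₚ.≤-refl (Neg-resp v-eq (Pos⇒Neg-neg pos))
  ... | inj₂ nonpos with u′ , p , eq ← exchange (length u) u s ℕₚ.≤-refl nonpos =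
    length u′ , (u′ , ∼-trans (∼-sym p) (++-congʳ [ s ] u∼w) , refl) , λ v v∼ →
      ℕₚ.≤-pred (ℕₚ.≤-trans (ℕₚ.≤-reflexive (trans eq |u|≡k))
        (ℕₚ.≤-trans (minimal (v ++ [ s ]) (∼-trans (++-congʳ [ s ] v∼) (cancel-∷ʳ w s)))
          (ℕₚ.≤-reflexive (trans (length-++ v) (ℕₚ.+-comm (length v) 1)))))

  ℓ-exists : ∀ w → ∃[ k ] ℓ[ w ]≡ k
  ℓ-exists w = go (reverseView w)
    where
    go : ∀ {w} → Reverse w → ∃[ k ] ℓ[ w ]≡ k
    go []              = 0 , ([] , ∼-refl , refl) , λ _ _ → z≤n
    go (xs ∶ rs ∶ʳ x) = ℓ-∷ʳ x (proj₂ (go rs))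

  <ℓ-resp : ∀ {u u′ v v′} → u ∼ u′ → v ∼ v′ → u <ℓ v → u′ <ℓ v′
  <ℓ-resp p q (j , k , lj , lk , j<k) = j , k , ℓ-resp p lj , ℓ-resp q lk , j<k

  <ℓ-asym : ∀ {u v} → u <ℓ v → ¬ v <ℓ u
  <ℓ-asym (j , k , uj , vk , j<k) (k′ , j′ , vk′ , uj′ , k′<j′)
    with refl ← ℓ-unique uj uj′ | refl ← ℓ-unique vk vk′ = ℕₚ.<-asym j<k k′<j′

  conjugate-involutive : ∀ x w s → (x ++ conjugate w s) ++ conjugate w s ∼ x
  conjugate-involutive x w s = faithful λ v i →
    trans (≡.cong-app (actᶻ-++ (x ++ conjugate w s) (conjugate w s) v) i)
    (trans (≡.cong-app (actᶻ-++ x (conjugate w s) (actᶻ (conjugate w s) v)) i)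
      (actᶻ-cong x (λ j → trans (actᶻ-conjugate w s (actᶻ (conjugate w s) v) j)
        (trans (reflect-cong {u = actᶻ w (basis s)} (λ _ → refl) (actᶻ-conjugate w s v) j)
          (reflect-involutive (Root-simple w s) v j))) i))

  reflection-descends : ∀ x w s → Pos (actᶻ w (basis s)) → Neg (actᶻ x (actᶻ w (basis s))) → x ++
    conjugate w s <ℓ x
  reflection-descends x w s pos nonpos with ℓ-exists x
  ... | j , ((u , u∼x , refl) , minimal)
    with u′ , p , eq ← strong-exchange u w s pos
      (Neg-resp (λ i → sym (actᶻ-∼ u∼x (actᶻ w (basis s)) i)) nonpos)
    with k , ℓk ← ℓ-exists (x ++ conjugate w s) =
    k , j , ℓk , ((u , u∼x , refl) , minimal) ,
      ≡.subst (k ℕ.<_) eq (s≤s (proj₂ ℓk u′ (∼-trans (∼-sym p) (++-congʳ (conjugate w s) u∼x))))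

  -- With `α = w α_s`, the element `x s_α` sends α to `- x α`, so it descends under s_α, and
  -- descends to x.
  reflection-ascends : ∀ x w s → Pos (actᶻ w (basis s)) → Pos (actᶻ x (actᶻ w (basis s))) → x <ℓ x
    ++ conjugate w s
  reflection-ascends x w s pos pos′ = <ℓ-resp (conjugate-involutive x w s) ∼-refl
    (reflection-descends (x ++ conjugate w s) w s pos (Neg-resp eq (Pos⇒Neg-neg pos′)))
    where
    α = actᶻ w (basis s)
    eq : neg (actᶻ x α) ≗ actᶻ (x ++ conjugate w s) α
    eq i = sym (trans (≡.cong-app (actᶻ-++ x (conjugate w s) α) i)
      (trans (actᶻ-cong x (λ j → trans (actᶻ-conjugate w s α j) (reflect-self (Root-simple w s) j))
        i)
        (actᶻ-neg x α i)))

  ascends⇒Pos : ∀ x w s → Pos (actᶻ w (basis s)) → x <ℓ x ++ conjugate w s → Pos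
    (actᶻ x (actᶻ w (basis s)))
  ascends⇒Pos x w s pos x< with sign (Root-actᶻ x (Root-simple w s))
  ... | inj₁ pos′ = pos′
  ... | inj₂ nonpos = contradiction (reflection-descends x w s pos nonpos) (<ℓ-asym x<)

-- The integers inside the reals

module IntegerEmbedding (ℝ : RealNumbers) where
  open RealNumbers ℝ hiding (zero)
  open CommutativeRing commutativeRing using (ring; semiring; +-abelianGroup)
  open RingProperties ring using (-‿distribˡ-*; -‿distribʳ-*; -0#≈0#; -‿involutive)
  open AbelianGroupProperties +-abelianGroup using (⁻¹-∙-comm)
  open Mult semiring using (×-homo-+; ×1-homo-*)
  open IsStrictPartialOrder isStrictPartialOrder
    using (<-respˡ-≈; <-respʳ-≈) renaming (irrefl to <-irrefl; trans to <-trans; asym to <-asym)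
  open SetoidReasoning setoid

  ι : ℤ → Carrier
  ι (+ k)    = k · 1#
  ι -[1+ k ] = - (ℕ.suc k · 1#)

  ι-neg : ∀ i → ι (Int.- i) ≈ - ι i
  ι-neg (+ 0)         = sym -0#≈0#
  ι-neg (+ ℕ.suc k)   = refl
  ι-neg -[1+ k ]      = sym (-‿involutive _)

  ι-⊖ : ∀ m n → ι (m ⊖ n) ≈ m · 1# - n · 1#
  ι-⊖ ℕ.zero    ℕ.zero    = sym (-‿inverseʳ 0#)
  ι-⊖ ℕ.zero    (ℕ.suc n) = sym (+-identityˡ _)
  ι-⊖ (ℕ.suc m) ℕ.zero    = sym (trans (+-congˡ -0#≈0#) (+-identityʳ _))
  ι-⊖ (ℕ.suc m) (ℕ.suc n) = begin
    ι (ℕ.suc m ⊖ ℕ.suc n)             ≡⟨ ≡.cong ι (ℤ.[1+m]⊖[1+n]≡m⊖n m n) ⟩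
    ι (m ⊖ n)                         ≈⟨ ι-⊖ m n ⟩
    x - y                             ≈⟨ +-identityˡ _ ⟨
    0# + (x - y)                      ≈⟨ +-congʳ (-‿inverseʳ 1#) ⟨
    (1# - 1#) + (x - y)               ≈⟨ +-assoc 1# (- 1#) (x - y) ⟩
    1# + (- 1# + (x - y))             ≈⟨ +-congˡ (trans (sym (+-assoc _ _ _))
      (trans (+-congʳ (+-comm _ _)) (+-assoc _ _ _))) ⟩
    1# + (x + (- 1# - y))             ≈⟨ +-assoc _ _ _ ⟨
    (1# + x) + (- 1# - y)             ≈⟨ +-congˡ (⁻¹-∙-comm 1# y) ⟩
    (1# + x) - (1# + y)               ∎
    where
    x y : Carrier
    x = m · 1#
    y = n · 1#

  ι-+ : ∀ i j → ι (i Int.+ j) ≈ ι i + ι j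
  ι-+ (+ m)    (+ n)    = ×-homo-+ 1# m n
  ι-+ (+ m)    -[1+ n ] = ι-⊖ m (ℕ.suc n)
  ι-+ -[1+ m ] (+ n)    = trans (ι-⊖ n (ℕ.suc m)) (+-comm _ _)
  ι-+ -[1+ m ] -[1+ n ] = trans (-‿cong (begin
    1# + (1# + (m ℕ.+ n) · 1#)      ≈⟨ +-congˡ (+-congˡ (×-homo-+ 1# m n)) ⟩
    1# + (1# + (m · 1# + n · 1#))   ≈⟨ +-congˡ (trans (sym (+-assoc _ _ _))
      (trans (+-congʳ (+-comm _ _)) (+-assoc _ _ _))) ⟩
    1# + (m · 1# + (1# + n · 1#))   ≈⟨ +-assoc _ _ _ ⟨
    (1# + m · 1#) + (1# + n · 1#)   ∎)) (sym (⁻¹-∙-comm _ _))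

  ι-*-pos : ∀ m j → ι (+ m Int.* j) ≈ ι (+ m) * ι j
  ι-*-pos m (+ n) = trans (reflexive (≡.cong ι (≡.sym (ℤ.pos-* m n)))) (×1-homo-* m n)
  ι-*-pos m -[1+ n ] = begin
    ι (+ m Int.* -[1+ n ])               ≡⟨ ≡.cong ι (ℤ.neg-distribʳ-* (+ m) (+ ℕ.suc n)) ⟨
    ι (Int.- (+ m Int.* + ℕ.suc n))      ≈⟨ ι-neg (+ m Int.* + ℕ.suc n) ⟩
    - ι (+ m Int.* + ℕ.suc n)            ≈⟨ -‿cong (ι-*-pos m (+ ℕ.suc n)) ⟩
    - (ι (+ m) * ι (+ ℕ.suc n))          ≈⟨ -‿distribʳ-* _ _ ⟩
    ι (+ m) * ι -[1+ n ]                 ∎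

  ι-* : ∀ i j → ι (i Int.* j) ≈ ι i * ι j
  ι-* (+ m) j = ι-*-pos m j
  ι-* -[1+ m ] j = begin
    ι (-[1+ m ] Int.* j)                 ≡⟨ ≡.cong ι (ℤ.neg-distribˡ-* (+ ℕ.suc m) j) ⟨
    ι (Int.- (+ ℕ.suc m Int.* j))        ≈⟨ ι-neg (+ ℕ.suc m Int.* j) ⟩
    - ι (+ ℕ.suc m Int.* j)              ≈⟨ -‿cong (ι-*-pos (ℕ.suc m) j) ⟩
    - (ι (+ ℕ.suc m) * ι j)              ≈⟨ -‿distribˡ-* _ _ ⟩
    ι -[1+ m ] * ι j                     ∎

  almostCommutativeRing : ACR.AlmostCommutativeRing 0ℓ 0ℓ
  almostCommutativeRing = ACR.fromCommutativeRing commutativeRing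

  ι-morphism : Int.+-*-rawRing ACR.-Raw-AlmostCommutative⟶ almostCommutativeRing
  ι-morphism = record
    { ⟦_⟧ = ι ; +-homo = ι-+ ; *-homo = ι-* ; -‿homo = ι-neg ; 0-homo = refl ; 1-homo = +-identityʳ
      1# }

  ι-≟ : ∀ i j → Maybe (ι i ≈ ι j)
  ι-≟ i j with i ℤ.≟ j
  ... | yes i≡j = just (reflexive (≡.cong ι i≡j))
  ... | no  _   = nothing

  module Solver = RingSolver Int.+-*-rawRing almostCommutativeRing ι-morphism ι-≟

  module ℝSum = FormOver commutativeRing

  ι-sum : ∀ {n} (f : Fin n → ℤ) → ι (FormOver.sum ℤ.+-*-commutativeRing f) ≈ ℝSum.sum
    (λ s → ι (f s))
  ι-sum {ℕ.zero}  f = refl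
  ι-sum {ℕ.suc n} f = trans (ι-+ (f zero) _) (+-congˡ (ι-sum (λ s → f (suc s))))

  0≤-resp : ∀ {x y} → x ≈ y → 0# ≤ x → 0# ≤ y
  0≤-resp x≈y 0≤x y<0 = 0≤x (<-respˡ-≈ (sym x≈y) y<0)

  -- A constructive substitute for trichotomy. It is what makes the negatively defined `_≤_`
  -- compatible with addition.
  <-cotrans : ∀ {x y} → x < y → ∀ z → x < z ⊎ z < y
  <-cotrans {x} {y} x<y z with #-cotrans (Equivalence.from (#⇔<⊎> x y) (inj₁ x<y)) z
  ... | inj₁ x#z with Equivalence.to (#⇔<⊎> x z) x#z
  ... | inj₁ x<z = inj₁ x<z
  ... | inj₂ z<x = inj₂ (<-trans z<x x<y)
  <-cotrans {x} {y} x<y z | inj₂ z#y with Equivalence.to (#⇔<⊎> z y) z#y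
  ... | inj₁ z<y = inj₂ z<y
  ... | inj₂ y<z = inj₁ (<-trans x<y y<z)

  0≤-+ : ∀ {x y} → 0# ≤ x → 0# ≤ y → 0# ≤ x + y
  0≤-+ {x} {y} 0≤x 0≤y x+y<0 with <-cotrans x+y<0 x
  ... | inj₂ x<0   = 0≤x x<0
  ... | inj₁ x+y<x = 0≤y (<-respʳ-≈ (-‿inverseʳ x) (<-respˡ-≈ cancel (+-monoˡ-< (- x) x+y<x)))
    where
    cancel : (x + y) - x ≈ y
    cancel = trans (+-congʳ (+-comm x y)) (trans (+-assoc y x (- x))
      (trans (+-congˡ (-‿inverseʳ x)) (+-identityʳ y)))

  -- An integral multiple is a repeated sum, so `0≤-+` suffices; in `combination` each such product
  -- has an integral factor.
  0≤-ι* : ∀ {k x} → 0ℤ Int.≤ k → 0# ≤ x → 0# ≤ ι k * x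
  0≤-ι* {+ k} {x} _ 0≤x = go k
    where
    go : ∀ k → 0# ≤ (k · 1#) * x
    go ℕ.zero    0x<0 = <-irrefl (zeroˡ x) 0x<0
    go (ℕ.suc k) = 0≤-resp (sym (trans (distribʳ x 1# (k · 1#)) (+-congʳ (*-identityˡ x))))
      (0≤-+ 0≤x (go k))

  0<ι-suc : ∀ k → 0# < ι (+ ℕ.suc k)
  0<ι-suc ℕ.zero    = <-respʳ-≈ (sym (+-identityʳ 1#)) 0<1
  0<ι-suc (ℕ.suc k) = <-trans (0<ι-suc k) (<-respˡ-≈ (+-identityˡ _) (+-monoˡ-< (ℕ.suc k · 1#) 0<1))

  ι-nonneg : ∀ {i} → 0ℤ Int.≤ i → 0# ≤ ι i
  ι-nonneg {+ ℕ.zero}  _ 0<0 = <-irrefl refl 0<0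
  ι-nonneg {+ ℕ.suc k} _ ι<0 = <-asym (0<ι-suc k) ι<0

  ι-negative : ∀ k → ι -[1+ k ] < 0#
  ι-negative k = <-respˡ-≈ (+-identityˡ _) (<-respʳ-≈ (-‿inverseʳ _)
    (+-monoˡ-< (- (ℕ.suc k · 1#)) (0<ι-suc k)))

  ι-reflects-nonneg : ∀ {i} → 0# ≤ ι i → 0ℤ Int.≤ i
  ι-reflects-nonneg {+ k}      _ = +≤+ z≤n
  ι-reflects-nonneg { -[1+ k ]} 0≤ = contradiction (ι-negative k) 0≤

  ι-zero : ∀ {i} → ι i ≈ 0# → i ≡ 0ℤ
  ι-zero {+ ℕ.zero}  _  = ≡.refl
  ι-zero {+ ℕ.suc k} eq = contradiction (0<ι-suc k) (<-irrefl (sym eq))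
  ι-zero { -[1+ k ]} eq = contradiction (ι-negative k) (<-irrefl eq)

  ι-injective : ∀ {i j} → ι i ≈ ι j → i ≡ j
  ι-injective {i} {j} eq = ℤ.i-j≡0⇒i≡j i j (ι-zero (begin
    ι (i Int.- j)     ≈⟨ ι-+ i (Int.- j) ⟩
    ι i + ι (Int.- j) ≈⟨ +-cong eq (ι-neg j) ⟩
    ι j - ι j         ≈⟨ -‿inverseʳ (ι j) ⟩
    0#                ∎))

  double-½ : (1# + 1#) * ½ ≈ 1#
  -- `½` is by construction the inverse of the difference `(1# + 1#) - 0#`.
  double-½ = trans (*-congʳ (trans (sym (+-identityʳ _)) (+-congˡ (sym -0#≈0#))))
    (proj₂ (proj₂ (#⇒invertible (Equivalence.from (#⇔<⊎> (1# + 1#) 0#) (inj₂ 0<2)))))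

-- Integral coordinates of roots, and 2-closedness of chain roots

module Roots (ℝ : RealNumbers) {n} (M : CoxeterMatrix n) (simplyLaced : SimplyLaced M)
  (finite : Coxeter.IsFinite M) where
  open RealNumbers ℝ hiding (zero)
  open RootSystem ℝ M simplyLaced
  open Words M simplyLaced finite
  open IntegerEmbedding ℝ
  open Φ⁺ using (vector; w; s; isImage; positive)

  module ℤForm = FormOver ℤ.+-*-commutativeRing
  open ℤForm using (basis)
  open SetoidReasoning setoid

  ιᵥ : Vect n → V
  ιᵥ u s = ι (u s)

  ι-1 : ι 1ℤ ≈ 1#
  ι-1 = +-identityʳ 1#

  ι-2 : ι (+ 2) ≈ 1# + 1#
  ι-2 = +-congˡ ι-1

  gram-ι : ∀ s t → (1# + 1#) * gram s t ≈ ι (cartan s t)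
  gram-ι s t with s Fin.≟ t
  ... | yes _ = trans (*-identityʳ _) (sym ι-2)
  ... | no  s≢t with simplyLaced s≢t
  ... | inj₁ _ = zeroʳ _
  ... | inj₂ _ = begin
    (1# + 1#) * (- ½)   ≈⟨ Solver.solve 2 (λ x y → x Solver.:* (Solver.:- y) Solver.:= Solver.:-
      (x Solver.:* y)) refl (1# + 1#) ½ ⟩
    - ((1# + 1#) * ½)   ≈⟨ -‿cong (trans double-½ (sym ι-1)) ⟩
    ι -[1+ 0 ]          ∎

  B-ι : ∀ u v → (1# + 1#) * B (ιᵥ u) (ιᵥ v) ≈ ι ⟪ u , v ⟫
  B-ι u v = begin
    two * ℝSum.sum (λ s → ℝSum.sum (λ t → (ι (u s) * ι (v t)) * gram s t))
      ≈⟨ ℝSum.*-distribˡ-sum two (λ s → ℝSum.sum (λ t → (ι (u s) * ι (v t)) * gram s t)) ⟩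
    ℝSum.sum (λ s → two * ℝSum.sum (λ t → (ι (u s) * ι (v t)) * gram s t))
      ≈⟨ ℝSum.sum-cong-≋ (λ s → begin
           two * ℝSum.sum (λ t → (ι (u s) * ι (v t)) * gram s t)
             ≈⟨ ℝSum.*-distribˡ-sum two (λ t → (ι (u s) * ι (v t)) * gram s t) ⟩
           ℝSum.sum (λ t → two * ((ι (u s) * ι (v t)) * gram s t))
             ≈⟨ ℝSum.sum-cong-≋ (λ t → term s t) ⟩
           ℝSum.sum (λ t → ι ((u s Int.* v t) Int.* cartan s t))
             ≈⟨ ι-sum (λ t → (u s Int.* v t) Int.* cartan s t) ⟨
           ι (ℤForm.sum (λ t → (u s Int.* v t) Int.* cartan s t)) ∎) ⟩
    ℝSum.sum (λ s → ι (ℤForm.sum (λ t → (u s Int.* v t) Int.* cartan s t)))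
      ≈⟨ ι-sum (λ s → ℤForm.sum (λ t → (u s Int.* v t) Int.* cartan s t)) ⟨
    ι (ℤForm.form cartan u v)
      ≡⟨ ≡.cong ι (⟨⟩-form u v) ⟨
    ι ⟪ u , v ⟫ ∎
    where
    two = 1# + 1#
    term : ∀ s t → two * ((ι (u s) * ι (v t)) * gram s t) ≈ ι ((u s Int.* v t) Int.* cartan s t)
    term s t = begin
      two * ((ι (u s) * ι (v t)) * gram s t)
        ≈⟨ Solver.solve 3 (λ x y z → x Solver.:* (y Solver.:* z) Solver.:= y Solver.:*
          (x Solver.:* z)) refl two (ι (u s) * ι (v t)) (gram s t) ⟩
      (ι (u s) * ι (v t)) * (two * gram s t)
        ≈⟨ *-cong (sym (ι-* (u s) (v t))) (gram-ι s t) ⟩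
      ι (u s Int.* v t) * ι (cartan s t)
        ≈⟨ ι-* (u s Int.* v t) (cartan s t) ⟨
      ι ((u s Int.* v t) Int.* cartan s t) ∎

  B-cong : ∀ {u u′ v v′} → u ≋ u′ → v ≋ v′ → B u v ≈ B u′ v′
  B-cong = ℝSum.form-cong gram

  B-integral : ∀ {x y u v} → x ≋ ιᵥ u → y ≋ ιᵥ v → (1# + 1#) * B x y ≈ ι ⟪ u , v ⟫
  B-integral {u = u} {v} p q = trans (*-congˡ (B-cong p q)) (B-ι u v)

  simpleRoot-ι : ∀ s → simpleRoot s ≋ ιᵥ (basis s)
  simpleRoot-ι s t with does (s Fin.≟ t)
  ... | true  = sym ι-1
  ... | false = refl

  act-ι : ∀ w {x u} → x ≋ ιᵥ u → act w x ≋ ιᵥ (actᶻ w u)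
  act-ι []      p = p
  act-ι (s ∷ w) {x} {u} p t = begin
    act w x t - ((1# + 1#) * B (act w x) (simpleRoot s)) * simpleRoot s t
      ≈⟨ +-cong (act-ι w p t) (-‿cong (*-cong (B-integral (act-ι w p) (simpleRoot-ι s))
        (simpleRoot-ι s t))) ⟩
    ι (u′ t) - ι c * ι (basis s t)
      ≈⟨ +-congˡ (-‿cong (ι-* c (basis s t))) ⟨
    ι (u′ t) - ι (c Int.* basis s t)
      ≈⟨ +-congˡ (ι-neg (c Int.* basis s t)) ⟨
    ι (u′ t) + ι (Int.- (c Int.* basis s t))
      ≈⟨ ι-+ (u′ t) (Int.- (c Int.* basis s t)) ⟨
    ι (u′ t Int.- c Int.* basis s t) ∎
    where
    u′ = actᶻ w u
    c = ⟪ u′ , basis s ⟫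

  -- The integral coordinates of α, computed from its presentation `w α_s`. Injectivity of `ι` makes
  -- them independent of the presentation, see `≈ᶲ⇒≗`.
  vec : Φ⁺ → Vect n
  vec α = actᶻ (w α) (basis (s α))

  vector-ι : ∀ α → vector α ≋ ιᵥ (vec α)
  vector-ι α t = trans (isImage α t) (act-ι (w α) (simpleRoot-ι (s α)) t)

  vec-Root : ∀ α → Root (vec α)
  vec-Root α = Root-simple (w α) (s α)

  vec-Pos : ∀ α → Pos (vec α)
  vec-Pos α t = ι-reflects-nonneg (0≤-resp (vector-ι α t) (positive α t))

  ≈ᶲ⇒≗ : ∀ {α β} → α ≈ᶲ β → vec α ≗ vec β
  ≈ᶲ⇒≗ {α} {β} p t = ι-injective (trans (sym (vector-ι α t)) (trans (p t) (vector-ι β t)))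

  ≗⇒≈ᶲ : ∀ {α β} → vec α ≗ vec β → α ≈ᶲ β
  ≗⇒≈ᶲ {α} {β} p t = trans (vector-ι α t) (trans (reflexive (≡.cong ι (p t))) (sym (vector-ι β t)))

  positiveRoot : ∀ w s → Pos (actᶻ w (basis s)) → Φ⁺
  positiveRoot w s pos = record
    { root = record { vector = act w (simpleRoot s) ; w = w ; s = s ; isImage = λ _ → refl }
    ; positive = λ t → 0≤-resp (sym (act-ι w (simpleRoot-ι s) t)) (ι-nonneg (pos t))
    }

  actᶻ-reflection : ∀ α v → actᶻ (reflection α) v ≗ reflect (vec α) v
  actᶻ-reflection α v = actᶻ-conjugate (w α) (s α) v

  actᶻ-++-reflection : ∀ x α v → actᶻ (x ++ reflection α) v ≗ actᶻ x (reflect (vec α) v)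
  actᶻ-++-reflection x α v t = ≡.trans (≡.cong-app (actᶻ-++ x (reflection α) v) t)
    (actᶻ-cong x (actᶻ-reflection α v) t)

  opaque
    -- The sum is `s_α β`, presented by the word of s_α followed by that of β.
    root-sum : ∀ α β → ⟪ vec α , vec β ⟫ ≡ -[1+ 0 ] → ∃[ γ ] vec γ ≗ vec α ⊕ vec β
    root-sum α β eq = positiveRoot (reflection α ++ w β) (s β)
      (Pos-resp (λ t → ≡.sym (sum≗ t)) (Pos-⊕ (vec-Pos α) (vec-Pos β))) , sum≗
      where
      sum≗ : actᶻ (reflection α ++ w β) (basis (s β)) ≗ vec α ⊕ vec β
      sum≗ t = ≡.trans (≡.cong-app (actᶻ-++ (reflection α) (w β) (basis (s β))) t)
        (≡.trans (actᶻ-reflection α (vec β) t)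
        (≡.trans (reflect-adjacent (≡.trans (⟨⟩-sym (vec β) (vec α)) eq) t)
          (ℤ.+-comm (vec β t) (vec α t))))

  split-minus-one : ∀ {u x y} → Root u → Root x → Root y → Pos u → Pos x → Pos y →
    ⟪ u , x ⊕ y ⟫ ≡ -[1+ 0 ] →
    (⟪ u , x ⟫ ≡ 0ℤ × ⟪ u , y ⟫ ≡ -[1+ 0 ]) ⊎ (⟪ u , x ⟫ ≡ -[1+ 0 ] × ⟪ u , y ⟫ ≡ 0ℤ)
  split-minus-one {u} {x} {y} ru rx ry pu px py eq =
    sum-to-minus-one (≥-1 ru rx pu px) (≥-1 ru ry pu py) (≡.trans (≡.sym (⟨⟩-+ʳ x y u)) eq)

  module _ {a : Level} (A : Subset a) where

    data Chain : Φ⁺ → Set a where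
      base : ∀ {α} → member A α → Chain α
      step : ∀ {α β γ} → member A α → Chain β → ⟪ vec α , vec β ⟫ ≡ -[1+ 0 ] →
             vec γ ≗ vec α ⊕ vec β → Chain γ

    Chain-resp : ∀ {α β} → vec α ≗ vec β → Chain α → Chain β
    Chain-resp {α} {β} p (base α∈A) = base (Subset.respects A (≗⇒≈ᶲ {α} {β} p) α∈A)
    Chain-resp p (step α∈A c eq q) = step α∈A c eq λ t → ≡.trans (≡.sym (p t)) (q t)

    -- Induction on the chain of `β = α + θ`. The pairing -1 of γ with β falls on one summand. If it
    -- falls on θ, then `θ + γ` is a chain root by induction and α is added to it; if it falls on α,
    -- then `α + γ` is one step beyond γ, and θ is joined to it by induction.
    Chain-+ : ∀ {β γ δ} → Chain β → Chain γ → ⟪ vec β , vec γ ⟫ ≡ -[1+ 0 ] → vec δ ≗ vec β ⊕ vec γ →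
      Chain δ
    Chain-+ (base β∈A) cγ eq sum≗ = step β∈A cγ eq sum≗
    Chain-+ {β} {γ} {δ} (step {α} {θ} α∈A cθ αθ β≗) cγ eq δ≗ = [ γ⊥α , γ⊥θ ]′
      (split-minus-one (vec-Root γ) (vec-Root α) (vec-Root θ) (vec-Pos γ) (vec-Pos α) (vec-Pos θ)
        (≡.trans (⟨⟩-cong {u = vec γ} (λ _ → ≡.refl) (λ t → ≡.sym (β≗ t)))
          (≡.trans (⟨⟩-sym (vec γ) (vec β)) eq)))
      where
      δ-split : ∀ t → vec δ t ≡ (vec α t Int.+ vec θ t) Int.+ vec γ t
      δ-split t = ≡.trans (δ≗ t) (≡.cong (Int._+ vec γ t) (β≗ t))
      γ⊥α : ⟪ vec γ , vec α ⟫ ≡ 0ℤ × ⟪ vec γ , vec θ ⟫ ≡ -[1+ 0 ] → Chain δ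
      γ⊥α (γα , γθ) = step {α} {proj₁ θ+γ} {δ} α∈A
        (Chain-+ {θ} {γ} {proj₁ θ+γ} cθ cγ θγ (proj₂ θ+γ))
        (≡.trans (⟨⟩-cong {u = vec α} (λ _ → ≡.refl) (proj₂ θ+γ))
          (≡.trans (⟨⟩-+ʳ (vec θ) (vec γ) (vec α))
          (≡.cong₂ Int._+_ αθ (≡.trans (⟨⟩-sym (vec α) (vec γ)) γα))))
        λ t → ≡.trans (δ-split t)
          (≡.trans (ℤ.+-assoc (vec α t) (vec θ t) (vec γ t))
            (≡.cong (λ x → vec α t Int.+ x) (≡.sym (proj₂ θ+γ t))))
        where
        θγ : ⟪ vec θ , vec γ ⟫ ≡ -[1+ 0 ]
        θγ = ≡.trans (⟨⟩-sym (vec θ) (vec γ)) γθ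
        θ+γ : ∃[ ε ] vec ε ≗ vec θ ⊕ vec γ
        θ+γ = root-sum θ γ θγ
      γ⊥θ : ⟪ vec γ , vec α ⟫ ≡ -[1+ 0 ] × ⟪ vec γ , vec θ ⟫ ≡ 0ℤ → Chain δ
      γ⊥θ (γα , γθ) = Chain-+ {θ} {proj₁ α+γ} {δ} cθ
        (step {α} {γ} {proj₁ α+γ} α∈A cγ αγ (proj₂ α+γ))
        (≡.trans (⟨⟩-cong {u = vec θ} (λ _ → ≡.refl) (proj₂ α+γ))
          (≡.trans (⟨⟩-+ʳ (vec α) (vec γ) (vec θ))
          (≡.cong₂ Int._+_ (≡.trans (⟨⟩-sym (vec θ) (vec α)) αθ)
            (≡.trans (⟨⟩-sym (vec θ) (vec γ)) γθ))))
        λ t → ≡.trans (δ-split t)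
          (≡.trans (regroup (vec α t) (vec θ t) (vec γ t))
            (≡.cong (λ x → vec θ t Int.+ x) (≡.sym (proj₂ α+γ t))))
        where
        αγ : ⟪ vec α , vec γ ⟫ ≡ -[1+ 0 ]
        αγ = ≡.trans (⟨⟩-sym (vec α) (vec γ)) γα
        α+γ : ∃[ ε ] vec ε ≗ vec α ⊕ vec γ
        α+γ = root-sum α γ αγ
        regroup : ∀ x y z → (x Int.+ y) Int.+ z ≡ y Int.+ (x Int.+ z)
        regroup = solve-∀

    chainSubset : Subset a
    chainSubset = record { member = Chain ; respects = λ {α} {β} p → Chain-resp (≈ᶲ⇒≗ {α} {β} p) }

  -- No case distinction on the reals a and b is made. With p, q, c the pairings of γ with α, of γ
  -- with β and of α with β, bilinearity gives `2 = a p + b q` and `p + q = (2 + c)(a + b)`. If γ is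
  -- neither α nor β, then `p, q ≤ 1`, hence `a + b ≥ 2` and `2 ≥ p + q ≥ 2 (2 + c) ≥ 2`, so
  -- equality holds throughout.
  combination : ∀ α β γ a b → 0# ≤ a → 0# ≤ b → vector γ ≋ a *ᵥ vector α +ᵥ b *ᵥ vector β →
    vec γ ≗ vec α ⊎ vec γ ≗ vec β ⊎ (⟪ vec α , vec β ⟫ ≡ -[1+ 0 ] × vec γ ≗ vec α ⊕ vec β)
  combination α β γ a b 0≤a 0≤b γ≋ with ⟪ vec γ , vec α ⟫ ℤ.≟ + 2 | ⟪ vec γ , vec β ⟫ ℤ.≟ + 2
  ... | yes p≡2 | _       = inj₁ (equal (vec-Root γ) (vec-Root α) p≡2)
  ... | no _    | yes q≡2 = inj₂ (inj₁ (equal (vec-Root γ) (vec-Root β) q≡2))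
  ... | no p≢2  | no q≢2  = inj₂ (inj₂ (c≡-1 , γ≗))
    where
    p q c : ℤ
    p = ⟪ vec γ , vec α ⟫
    q = ⟪ vec γ , vec β ⟫
    c = ⟪ vec α , vec β ⟫
    two = 1# + 1#
    expand : ∀ δ → ι ⟪ vec γ , vec δ ⟫ ≈ a * ι ⟪ vec α , vec δ ⟫ + b * ι ⟪ vec β , vec δ ⟫
    expand δ = begin
      ι ⟪ vec γ , vec δ ⟫ ≈⟨ B-integral {u = vec γ} {v = vec δ} (vector-ι γ) (vector-ι δ) ⟨
      two * B (vector γ) (vector δ) ≈⟨ *-congˡ (B-cong γ≋ (λ _ → refl)) ⟩
      two * B (a *ᵥ vector α +ᵥ b *ᵥ vector β) (vector δ)
        ≈⟨ *-congˡ (ℝSum.form-linearˡ gram a (vector α) b (vector β) (vector δ)) ⟩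
      two * (a * B (vector α) (vector δ) + b * B (vector β) (vector δ))
        ≈⟨ Solver.solve 5 (λ t a b x y → t Solver.:* (a Solver.:* x Solver.:+ b Solver.:* y)
          Solver.:=
             a Solver.:* (t Solver.:* x) Solver.:+ b Solver.:* (t Solver.:* y)) refl two a b
               (B (vector α) (vector δ)) (B (vector β) (vector δ)) ⟩
      a * (two * B (vector α) (vector δ)) + b * (two * B (vector β) (vector δ))
        ≈⟨ +-cong (*-congˡ (B-integral {u = vec α} {v = vec δ} (vector-ι α) (vector-ι δ)))
                  (*-congˡ (B-integral {u = vec β} {v = vec δ} (vector-ι β) (vector-ι δ))) ⟩
      a * ι ⟪ vec α , vec δ ⟫ + b * ι ⟪ vec β , vec δ ⟫ ∎
    norm-eq : ι (+ 2) ≈ a * ι p + b * ι q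
    norm-eq = trans (reflexive (≡.cong ι (≡.sym (vec-Root γ)))) (trans (expand γ)
      (+-cong (*-congˡ (reflexive (≡.cong ι (⟨⟩-sym (vec α) (vec γ)))))
              (*-congˡ (reflexive (≡.cong ι (⟨⟩-sym (vec β) (vec γ)))))))
    p-eq : ι p ≈ a * ι (+ 2) + b * ι c
    p-eq = trans (expand α) (+-cong (*-congˡ (reflexive (≡.cong ι (vec-Root α))))
      (*-congˡ (reflexive (≡.cong ι (⟨⟩-sym (vec β) (vec α))))))
    q-eq : ι q ≈ a * ι c + b * ι (+ 2)
    q-eq = trans (expand β) (+-congˡ (*-congˡ (reflexive (≡.cong ι (vec-Root β)))))
    0≤1- : ∀ {δ ε} → ⟪ vec δ , vec ε ⟫ ≢ + 2 → 0ℤ Int.≤ 1ℤ Int.- ⟪ vec δ , vec ε ⟫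
    0≤1- {δ} {ε} ≢2 = ℤ.i≤j⇒0≤j-i (ℤ.i<j⇒i≤pred[j] (ℤ.≤∧≢⇒< (≤2 (vec-Root δ) (vec-Root ε)) ≢2))
    -- An integer whose image in the reals equals `(2 + c)((1 - p) a + (1 - q) b)`, a sum of
    -- nonnegative terms.
    excess : 0ℤ Int.≤ p Int.+ q Int.- + 2 Int.* (+ 2 Int.+ c)
    excess = ι-reflects-nonneg (0≤-resp identity
      (0≤-ι* {+ 2 Int.+ c} (ℤ.≤-trans (+≤+ z≤n) (ℤ.+-monoʳ-≤ (+ 2) (≥-2 (vec-Root α) (vec-Root β))))
        (0≤-+ (0≤-ι* (0≤1- {γ} {α} p≢2) 0≤a) (0≤-ι* (0≤1- {γ} {β} q≢2) 0≤b))))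
      where
      ι-sub : ∀ x y → ι (x Int.- y) ≈ ι x - ι y
      ι-sub x y = trans (ι-+ x (Int.- y)) (+-congˡ (ι-neg y))
      identity : ι (+ 2 Int.+ c) * (ι (1ℤ Int.- p) * a + ι (1ℤ Int.- q) * b) ≈ ι
        (p Int.+ q Int.- + 2 Int.* (+ 2 Int.+ c))
      identity = begin
        ι (+ 2 Int.+ c) * (ι (1ℤ Int.- p) * a + ι (1ℤ Int.- q) * b)
          ≈⟨ *-cong (ι-+ (+ 2) c) (+-cong (*-congʳ (ι-sub 1ℤ p)) (*-congʳ (ι-sub 1ℤ q))) ⟩
        (ι (+ 2) + ι c) * ((ι 1ℤ - ι p) * a + (ι 1ℤ - ι q) * b)
          ≈⟨ Solver.solve 5 (λ a b P Q C → (Solver.con (+ 2) Solver.:+ C) Solver.:*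
            ((Solver.con 1ℤ Solver.:- P) Solver.:* a Solver.:+ (Solver.con 1ℤ Solver.:- Q) Solver.:*
            b)
               Solver.:= (a Solver.:* Solver.con (+ 2) Solver.:+ b Solver.:* C) Solver.:+
                 (a Solver.:* C Solver.:+ b Solver.:* Solver.con (+ 2))
                 Solver.:- (Solver.con (+ 2) Solver.:+ C) Solver.:*
                   (a Solver.:* P Solver.:+ b Solver.:* Q)) refl a b (ι p) (ι q) (ι c) ⟩
        (a * ι (+ 2) + b * ι c) + (a * ι c + b * ι (+ 2)) - (ι (+ 2) + ι c) * (a * ι p + b * ι q)
          ≈⟨ +-cong (+-cong (sym p-eq) (sym q-eq)) (-‿cong (*-congˡ (sym norm-eq))) ⟩
        ι p + ι q - (ι (+ 2) + ι c) * ι (+ 2)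
          ≈⟨ +-cong (sym (ι-+ p q)) (-‿cong (trans (*-comm (ι (+ 2) + ι c) (ι (+ 2)))
            (trans (*-congˡ (sym (ι-+ (+ 2) c))) (sym (ι-* (+ 2) (+ 2 Int.+ c)))))) ⟩
        ι (p Int.+ q) - ι (+ 2 Int.* (+ 2 Int.+ c))
          ≈⟨ ι-sub (p Int.+ q) (+ 2 Int.* (+ 2 Int.+ c)) ⟨
        ι (p Int.+ q Int.- + 2 Int.* (+ 2 Int.+ c)) ∎
    extremal : 1ℤ Int.- p ≡ 0ℤ × 1ℤ Int.- q ≡ 0ℤ × 1ℤ Int.+ c ≡ 0ℤ
    extremal = nonneg-sum≡0 (0≤1- {γ} {α} p≢2) (0≤1- {γ} {β} q≢2)
      (ℤ.+-monoʳ-≤ 1ℤ (≥-1 (vec-Root α) (vec-Root β) (vec-Pos α) (vec-Pos β))) excess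
        (collect p q c)
      where
      collect : ∀ p q c → (1ℤ Int.- p) Int.+ (1ℤ Int.- q) Int.+ + 2 Int.* (1ℤ Int.+ c) Int.+
        (p Int.+ q Int.- + 2 Int.* (+ 2 Int.+ c)) ≡ 0ℤ
      collect = solve-∀
    p≡1 : p ≡ 1ℤ
    p≡1 = ≡.sym (ℤ.i-j≡0⇒i≡j 1ℤ p (proj₁ extremal))
    q≡1 : q ≡ 1ℤ
    q≡1 = ≡.sym (ℤ.i-j≡0⇒i≡j 1ℤ q (proj₁ (proj₂ extremal)))
    c≡-1 : c ≡ -[1+ 0 ]
    c≡-1 = ≡.trans (shift c) (≡.cong (λ x → x Int.- 1ℤ) (proj₂ (proj₂ extremal)))
      where
      shift : ∀ c → c ≡ (1ℤ Int.+ c) Int.- 1ℤ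
      shift = solve-∀
    -- The coefficients a and b are never determined: γ and the root `α + β` pair to `1 + 1 = 2`,
    -- hence coincide.
    γ≗ : vec γ ≗ vec α ⊕ vec β
    γ≗ t = ≡.trans (equal (vec-Root γ) (vec-Root (proj₁ δ))
      (≡.trans (⟨⟩-cong {u = vec γ} (λ _ → ≡.refl) (proj₂ δ))
        (≡.trans (⟨⟩-+ʳ (vec α) (vec β) (vec γ)) (≡.cong₂ Int._+_ p≡1 q≡1))) t) (proj₂ δ t)
      where
      δ : ∃[ δ ] vec δ ≗ vec α ⊕ vec β
      δ = root-sum α β c≡-1

  chainSubset-closed : ∀ {a} (A : Subset a) → TwoClosed (chainSubset A)
  chainSubset-closed A α β cα cβ a b 0≤a 0≤b γ γ≋ with combination α β γ a b 0≤a 0≤b γ≋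
  ... | inj₁ γ≗α              = Chain-resp A (λ t → ≡.sym (γ≗α t)) cα
  ... | inj₂ (inj₁ γ≗β)       = Chain-resp A (λ t → ≡.sym (γ≗β t)) cβ
  ... | inj₂ (inj₂ (c , γ≗))  = Chain-+ A cα cβ c γ≗

-- Increasing palindromes and chain roots

module Preclosure (ℝ : RealNumbers) {n} (M : CoxeterMatrix n) (simplyLaced : SimplyLaced M)
  (finite : Coxeter.IsFinite M) where
  open RealNumbers ℝ using (0#; 1#; _≤_)
  open RootSystem ℝ M simplyLaced
  open Words M simplyLaced finite
  open Roots ℝ M simplyLaced finite
  open Φ⁺ using (vector; w; s)

  ascends : ∀ x α → Pos (actᶻ x (vec α)) → x <ℓ x ++ reflection α
  ascends x α = reflection-ascends x (w α) (s α) (vec-Pos α)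

  ascends⁻ : ∀ x α → x <ℓ x ++ reflection α → Pos (actᶻ x (vec α))
  ascends⁻ x α = ascends⇒Pos x (w α) (s α) (vec-Pos α)

  -- The Bruhat condition with the running product as an index, so that inductions on the list may
  -- start at any element x.
  data Ascending : Word → List Φ⁺ → Set where
    []  : ∀ {x} → Ascending x []
    _∷_ : ∀ {x α αs} → x <ℓ x ++ reflection α → Ascending (x ++ reflection α) αs → Ascending x
      (α ∷ αs)

  product : List Φ⁺ → Word
  product αs = foldr _++_ [] (map reflection αs)

  linked⇒ascending : ∀ x αs → Linked _<ℓ_ (scanl _++_ x (map reflection αs)) → Ascending x αs
  linked⇒ascending x []       _       = []
  linked⇒ascending x (α ∷ αs) (p ∷ ps) = p ∷ linked⇒ascending (x ++ reflection α) αs ps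

  ascending⇒linked : ∀ x αs → Ascending x αs → Linked _<ℓ_ (scanl _++_ x (map reflection αs))
  ascending⇒linked x []       _        = [-]
  ascending⇒linked x (α ∷ αs) (p ∷ ps) = p ∷ ascending⇒linked (x ++ reflection α) αs ps

  ascending-∷ʳ : ∀ x αs α → Ascending x αs → Pos (actᶻ x (actᶻ (product αs) (vec α))) → Ascending x
    (αs ++ [ α ])
  ascending-∷ʳ x []       α []       pos = ascends x α pos ∷ []
  ascending-∷ʳ x (β ∷ αs) α (p ∷ ps) pos = p ∷ ascending-∷ʳ (x ++ reflection β) αs α ps
    (Pos-resp (λ t → ≡.trans (actᶻ-cong x (λ t → ≡.cong-app
      (actᶻ-++ (reflection β) (product αs) (vec α)) t) t)
                             (≡.sym (≡.cong-app (actᶻ-++ x (reflection β)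
                               (actᶻ (product αs) (vec α))) t))) pos)

  ascending-∷ʳ⁻ : ∀ x αs α → Ascending x (αs ++ [ α ]) → Ascending x αs × Pos
    (actᶻ x (actᶻ (product αs) (vec α)))
  ascending-∷ʳ⁻ x []       α (p ∷ []) = [] , ascends⁻ x α p
  ascending-∷ʳ⁻ x (β ∷ αs) α (p ∷ ps) = p ∷ proj₁ rest ,
    Pos-resp (λ t → ≡.trans (≡.cong-app (actᶻ-++ x (reflection β) (actᶻ (product αs) (vec α))) t)
      (actᶻ-cong x (λ t → ≡.sym (≡.cong-app (actᶻ-++ (reflection β) (product αs) (vec α)) t)) t))
        (proj₂ rest)
    where
    rest : Ascending (x ++ reflection β) αs × Pos
      (actᶻ (x ++ reflection β) (actᶻ (product αs) (vec α)))
    rest = ascending-∷ʳ⁻ (x ++ reflection β) αs α ps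

  actᶻ-product-∷ʳ : ∀ αs α v → actᶻ (product (αs ++ [ α ])) v ≗ actᶻ (product αs)
    (reflect (vec α) v)
  actᶻ-product-∷ʳ []       α v t = ≡.trans (≡.cong-app (actᶻ-++ (reflection α) [] v) t)
    (actᶻ-reflection α v t)
  actᶻ-product-∷ʳ (β ∷ αs) α v t = ≡.trans (≡.cong-app
    (actᶻ-++ (reflection β) (product (αs ++ [ α ])) v) t)
    (≡.trans (actᶻ-cong (reflection β) (actᶻ-product-∷ʳ αs α v) t)
      (≡.sym (≡.cong-app (actᶻ-++ (reflection β) (product αs) (reflect (vec α) v)) t)))

  actᶻ-product-∷ : ∀ α αs v → actᶻ (product (α ∷ αs)) v ≗ reflect (vec α) (actᶻ (product αs) v)
  actᶻ-product-∷ α αs v t = ≡.trans (≡.cong-app (actᶻ-++ (reflection α) (product αs) v) t)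
    (actᶻ-reflection α (actᶻ (product αs) v) t)

  module _ {a : Level} {A : Subset a} where

    unfolding-list : ∀ {γ} → Chain A γ → List Φ⁺
    unfolding-list (base {α} _)       = [ α ]
    unfolding-list (step {α} _ c _ _) = α ∷ unfolding-list c ++ [ α ]

    unfolding-members : ∀ {γ} (c : Chain A γ) → All (member A) (unfolding-list c)
    unfolding-members (base α∈A)       = α∈A ∷ []
    unfolding-members (step α∈A c _ _) = α∈A ∷ Allₚ.++⁺ (unfolding-members c) (α∈A ∷ [])

    unfolding-palindrome : ∀ {γ} (c : Chain A γ) → reverse (unfolding-list c) ≡ unfolding-list c
    unfolding-palindrome (base _) = ≡.refl
    unfolding-palindrome (step {α} _ c _ _) = ≡.trans (unfold-reverse α (unfolding-list c ++ [ α ]))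
      (≡.cong (_++ [ α ]) (≡.trans (reverse-++ (unfolding-list c) [ α ])
        (≡.cong (α ∷_) (unfolding-palindrome c))))

    -- At a step `γ = α + θ`, conjugating s_θ by s_α gives the reflection in `s_α θ = γ`.
    unfolding-product : ∀ {γ} (c : Chain A γ) v → actᶻ (product (unfolding-list c)) v ≗ reflect
      (vec γ) v
    unfolding-product (base {α} _) v t = ≡.trans (≡.cong-app (actᶻ-++ (reflection α) [] v) t)
      (actᶻ-reflection α v t)
    unfolding-product {γ} (step {α} {θ} _ c αθ γ≗) v t =
      ≡.trans (actᶻ-product-∷ α (unfolding-list c ++ [ α ]) v t)
      (≡.trans (reflect-cong {u = vec α} (λ _ → ≡.refl) (λ t → ≡.trans
        (actᶻ-product-∷ʳ (unfolding-list c) α v t) (unfolding-product c (reflect (vec α) v) t)) t)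
      (≡.trans (reflect-conj (vec-Root α) (vec θ) (reflect (vec α) v) t)
        (reflect-cong (λ t → ≡.trans (reflect-adjacent (≡.trans (⟨⟩-sym (vec θ) (vec α)) αθ) t)
                                     (≡.trans (ℤ.+-comm (vec θ t) (vec α t)) (≡.sym (γ≗ t))))
                      (reflect-involutive (vec-Root α) v) t)))

    -- Keeping track of the splittings of θ makes the condition inductive: if δ + η = θ with
    -- ⟨α,θ⟩ = -1, then s_α δ ∈ {δ, δ + α} is a summand of a splitting of θ + α.
    Admissible : Word → Vect n → Set
    Admissible x θ = Pos (actᶻ x θ) ×
      (∀ δ η → Root δ → Root η → Pos δ → Pos η → δ ⊕ η ≗ θ → Pos (actᶻ x δ))

    admissible-step : ∀ x α θ γ → ⟪ vec α , vec θ ⟫ ≡ -[1+ 0 ] → vec γ ≗ vec α ⊕ vec θ →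
      Admissible x (vec γ) → Admissible (x ++ reflection α) (vec θ)
    admissible-step x α θ γ αθ γ≗ (posγ , splits) =
      Pos-resp (λ t → ≡.sym (≡.trans (actᶻ-++-reflection x α (vec θ) t) (actᶻ-cong x (λ t →
        ≡.trans (reflect-adjacent (≡.trans (⟨⟩-sym (vec θ) (vec α)) αθ) t)
          (≡.trans (ℤ.+-comm (vec θ t) (vec α t)) (≡.sym (γ≗ t)))) t))) posγ
      , splits′
      where
      splits′ : ∀ δ η → Root δ → Root η → Pos δ → Pos η → δ ⊕ η ≗ vec θ → Pos
        (actᶻ (x ++ reflection α) δ)
      splits′ δ η rδ rη pδ pη sum≗ = Pos-resp (λ t → ≡.sym (actᶻ-++-reflection x α δ t))
        ([ fixed , moved ]′ (split-minus-one (vec-Root α) rδ rη (vec-Pos α) pδ pη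
          (≡.trans (⟨⟩-cong {u = vec α} (λ _ → ≡.refl) sum≗) αθ)))
        where
        rearrange₁ : ∀ d e a → d Int.+ (e Int.+ a) ≡ a Int.+ (d Int.+ e)
        rearrange₁ = solve-∀
        rearrange₂ : ∀ d e a → (d Int.+ a) Int.+ e ≡ a Int.+ (d Int.+ e)
        rearrange₂ = solve-∀
        to-γ : ∀ t → vec α t Int.+ (δ t Int.+ η t) ≡ vec γ t
        to-γ t = ≡.trans (≡.cong (λ x → vec α t Int.+ x) (sum≗ t)) (≡.sym (γ≗ t))
        fixed : ⟪ vec α , δ ⟫ ≡ 0ℤ × ⟪ vec α , η ⟫ ≡ -[1+ 0 ] → Pos (actᶻ x (reflect (vec α) δ))
        fixed (αδ , αη) = Pos-resp (actᶻ-cong x λ t → ≡.sym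
          (reflect-orthogonal (≡.trans (⟨⟩-sym δ (vec α)) αδ) t))
          (splits δ (η ⊕ vec α) rδ
            (Root-resp (reflect-adjacent (≡.trans (⟨⟩-sym η (vec α)) αη))
              (Root-reflect (vec-Root α) rη))
            pδ (Pos-⊕ pη (vec-Pos α)) λ t → ≡.trans (rearrange₁ (δ t) (η t) (vec α t)) (to-γ t))
        moved : ⟪ vec α , δ ⟫ ≡ -[1+ 0 ] × ⟪ vec α , η ⟫ ≡ 0ℤ → Pos (actᶻ x (reflect (vec α) δ))
        moved (αδ , αη) = Pos-resp (actᶻ-cong x λ t → ≡.sym (δ+α t))
          (splits (δ ⊕ vec α) η (Root-resp δ+α (Root-reflect (vec-Root α) rδ)) rη
            (Pos-⊕ pδ (vec-Pos α)) pη λ t → ≡.trans (rearrange₂ (δ t) (η t) (vec α t)) (to-γ t))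
          where
          δ+α : reflect (vec α) δ ≗ δ ⊕ vec α
          δ+α = reflect-adjacent (≡.trans (⟨⟩-sym δ (vec α)) αδ)

    unfolding-ascending : ∀ {γ} (c : Chain A γ) x → Admissible x (vec γ) → Ascending x
      (unfolding-list c)
    unfolding-ascending (base {α} _) x (pos , _) = ascends x α pos ∷ []
    unfolding-ascending {γ} (step {α} {θ} _ c αθ γ≗) x adm =
      ascends x α (proj₂ adm (vec α) (vec θ) (vec-Root α) (vec-Root θ) (vec-Pos α) (vec-Pos θ)
        (λ t → ≡.sym (γ≗ t)))
      ∷ ascending-∷ʳ (x ++ reflection α) (unfolding-list c) α
          (unfolding-ascending c (x ++ reflection α) (admissible-step x α θ γ αθ γ≗ adm))
          (Pos-resp (λ t → ≡.sym (last t))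
            (proj₂ adm (vec θ) (vec α) (vec-Root θ) (vec-Root α) (vec-Pos θ) (vec-Pos α)
              λ t → ≡.trans (ℤ.+-comm (vec θ t) (vec α t)) (≡.sym (γ≗ t))))
      where
      θ+α : reflect (vec α) (vec θ) ≗ vec θ ⊕ vec α
      θ+α = reflect-adjacent (≡.trans (⟨⟩-sym (vec θ) (vec α)) αθ)
      α+θ : reflect (vec θ) (vec α) ≗ reflect (vec α) (vec θ)
      α+θ t = ≡.trans (reflect-adjacent αθ t)
        (≡.trans (ℤ.+-comm (vec α t) (vec θ t)) (≡.sym (θ+α t)))
      -- Before the final s_α the product is `x s_α s_θ`. Since `s_θ α = α + θ = s_α θ`, it sends α
      -- to `x θ`, and θ is the other summand of γ.
      last : actᶻ (x ++ reflection α) (actᶻ (product (unfolding-list c)) (vec α)) ≗ actᶻ x (vec θ)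
      last t = ≡.trans (actᶻ-cong (x ++ reflection α)
        (λ t → ≡.trans (unfolding-product c (vec α) t) (α+θ t)) t)
        (≡.trans (actᶻ-++-reflection x α (reflect (vec α) (vec θ)) t)
          (actᶻ-cong x (reflect-involutive (vec-Root α) (vec θ)) t))

    chain⇒preclosure : ∀ {γ} → Chain A γ → γ ∈ PalindromicBruhatPreclosure A
    chain⇒preclosure {γ} c = unfolding-list c , unfolding-members c
      , faithful (λ v t → ≡.trans (actᶻ-reflection γ v t) (≡.sym (unfolding-product c v t)))
      -- At the identity, admissibility asks only that summands assumed positive be positive.
      , ascending⇒linked [] (unfolding-list c) (unfolding-ascending c []
        (vec-Pos γ , λ _ _ _ _ pδ _ _ → pδ))
      , ≡.subst (Pointwise _≈ᶲ_ (unfolding-list c)) (≡.sym (unfolding-palindrome c))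
        (Pointwise.refl (λ {α} t → RealNumbers.refl ℝ))

  -- Matching letters agree as vectors only; their presentations by words may differ.
  data Palindrome : List Φ⁺ → Set where
    empty  : Palindrome []
    single : ∀ α → Palindrome [ α ]
    wrap   : ∀ {α β αs} → α ≈ᶲ β → Palindrome αs → Palindrome (α ∷ αs ++ [ β ])

  palindrome : ∀ k αs → length αs ℕ.≤ k → Palindromic αs → Palindrome αs
  palindrome k [] _ _ = empty
  palindrome (ℕ.suc k) (α ∷ αs) (s≤s |αs|≤k) pal = go (reverseView αs) |αs|≤k pal
    where
    go : ∀ {αs} → Reverse αs → length αs ℕ.≤ k → Palindromic (α ∷ αs) → Palindrome (α ∷ αs)
    go [] _ _ = single α
    go (βs ∶ _ ∶ʳ β) |αs|≤k pal = inner (≡.subst (Pointwise _≈ᶲ_ (α ∷ βs ++ [ β ])) unfold pal)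
      where
      unfold : reverse (α ∷ βs ++ [ β ]) ≡ β ∷ reverse βs ++ [ α ]
      unfold = ≡.trans (unfold-reverse α (βs ++ [ β ])) (≡.cong (_++ [ α ]) (reverse-++ βs [ β ]))
      |βs|≤k : length βs ℕ.≤ k
      |βs|≤k = ℕₚ.≤-trans (ℕₚ.m≤m+n (length βs) 1) (≡.subst (ℕ._≤ k) (length-++ βs) |αs|≤k)
      inner : Pointwise _≈ᶲ_ (α ∷ βs ++ [ β ]) (β ∷ reverse βs ++ [ α ]) → Palindrome
        (α ∷ βs ++ [ β ])
      inner (p ∷ ps) = wrap p (palindrome k βs |βs|≤k (Pointwise-unsnoc βs (reverse βs) ps))

  -- Pairing the hypothesis with β gives `-2 = 2 - c²` for `c = ⟨β,α⟩`; positivity excludes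
  -- `c = -2`, and `c = 2` means equality.
  same-reflection : ∀ {β α} → Root β → Root α → Pos β → Pos α → neg β ≗ reflect α β → β ≗ α
  same-reflection {β} {α} rβ rα pβ pα eq = equal rβ rα
    (go ⟪ β , α ⟫ (≥-1 rβ rα pβ pα) (≤2 rβ rα) norm-eq)
    where
    norm-eq : -[1+ 1 ] ≡ + 2 Int.- ⟪ β , α ⟫ Int.* ⟪ β , α ⟫
    norm-eq = ≡.trans (≡.cong (λ x → Int.- x) (≡.sym rβ))
      (≡.trans (≡.sym (⟨⟩-negˡ β β)) (≡.trans (⟨⟩-cong {v = β} eq (λ _ → ≡.refl))
      (≡.trans (⟨reflect,⟩ α β β) (≡.cong₂ (λ x y → x Int.- ⟪ β , α ⟫ Int.* y) rβ (⟨⟩-sym α β)))))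
    go : ∀ c → -[1+ 0 ] Int.≤ c → c Int.≤ + 2 → -[1+ 1 ] ≡ + 2 Int.- c Int.* c → c ≡ + 2
    go (+ 2) _ _ _ = ≡.refl
    go (+ 0) _ _ ()
    go (+ 1) _ _ ()
    go (+ ℕ.suc (ℕ.suc (ℕ.suc c))) _ (+≤+ (s≤s (s≤s ()))) _
    go -[1+ 0 ] _ _ ()
    go -[1+ ℕ.suc c ] (-≤- ()) _ _

  module _ {a : Level} (C : Subset a) (closed : TwoClosed C) where

    closed-+ : ∀ α β γ → member C α → member C β → vec γ ≗ vec α ⊕ vec β → member C γ
    closed-+ α β γ α∈C β∈C γ≗ = closed α β α∈C β∈C 1# 1# 0≤1 0≤1 γ λ t →
      trans (vector-ι γ t) (trans (reflexive (≡.cong ι (γ≗ t))) (trans (ι-+ (vec α t) (vec β t))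
        (+-cong (trans (sym (vector-ι α t)) (sym (*-identityˡ (vector α t))))
          (trans (sym (vector-ι β t)) (sym (*-identityˡ (vector β t)))))))
      where
      open RealNumbers ℝ using (trans; sym; reflexive; +-cong; *-identityˡ)
      open IntegerEmbedding ℝ using (ι; ι-+; ι-nonneg; 0≤-resp)
      0≤1 : 0# ≤ 1#
      0≤1 = 0≤-resp ι-1 (ι-nonneg {1ℤ} (+≤+ z≤n))

    -- If s_ζ x = x s_α₁ ⋯ s_αₘ for a palindrome, then ζ = x γ with γ built from the αᵢ by
    -- adding one root at a time, from the centre outwards.
    centre : ∀ {αs} → Palindrome αs → ∀ x ζ → Root ζ → Pos ζ → All (member C) αs → Ascending x αs →
      (∀ v → actᶻ x (actᶻ (product αs) v) ≗ reflect ζ (actᶻ x v)) →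
      ∃[ γ ] member C γ × actᶻ x (vec γ) ≗ ζ
    centre empty x ζ rζ pζ _ _ eq = contradiction
      (Neg-resp (λ t → ≡.sym (fixed t)) (Pos⇒Neg-neg pζ)) (not-both rζ pζ)
      where
      fixed : ζ ≗ neg ζ
      fixed t = ≡.trans (≡.sym (actᶻ-reverseʳ x ζ t)) (≡.trans (eq (actᶻ (reverse x) ζ) t)
        (≡.trans (reflect-cong {u = ζ} (λ _ → ≡.refl) (actᶻ-reverseʳ x ζ) t) (reflect-self rζ t)))
    centre (single β) x ζ rζ pζ (β∈C ∷ []) (p ∷ []) eq = β , β∈C ,
      same-reflection (Root-actᶻ x (vec-Root β)) rζ (ascends⁻ x β p) pζ flipped
      where
      flipped : neg (actᶻ x (vec β)) ≗ reflect ζ (actᶻ x (vec β))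
      flipped t = ≡.trans (≡.sym (actᶻ-neg x (vec β) t)) (≡.trans (actᶻ-cong x (λ t →
        ≡.trans (≡.sym (reflect-self (vec-Root β) t)) (≡.sym
          (≡.trans (≡.cong-app (actᶻ-++ (reflection β) [] (vec β)) t)
          (actᶻ-reflection β (vec β) t)))) t)
        (eq (vec β) t))
    centre (wrap {β} {β′} {αs} β≈β′ pal) x ζ rζ pζ (β∈C ∷ members) (p ∷ ps) eq =
      outer ⟪ vec β , vec γ′ ⟫ ≡.refl (≥-1 (vec-Root β) (vec-Root γ′) (vec-Pos β) (vec-Pos γ′))
      where
      β≗β′ : vec β ≗ vec β′
      β≗β′ = ≈ᶲ⇒≗ {β} {β′} β≈β′
      y : Word
      y = x ++ reflection β
      ascent : Ascending y αs × Pos (actᶻ y (actᶻ (product αs) (vec β′)))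
      ascent = ascending-∷ʳ⁻ y αs β′ ps
      -- Let P be the inner product. From `x s_β P s_β = s_ζ x`, cancelling the right-hand s_β gives
      -- `y P = s_ζ y` for `y = x s_β`, so ζ is unchanged in the recursion.
      eq-inner : ∀ v → actᶻ y (actᶻ (product αs) v) ≗ reflect ζ (actᶻ y v)
      eq-inner v t = begin
        actᶻ y (actᶻ (product αs) v) t
          ≡⟨ actᶻ-++-reflection x β (actᶻ (product αs) v) t ⟩
        actᶻ x (reflect (vec β) (actᶻ (product αs) v)) t
          ≡⟨ actᶻ-cong x (reflect-cong {u = vec β} (λ _ → ≡.refl) (actᶻ-cong (product αs) λ t →
               ≡.sym (≡.trans (reflect-cong {v = reflect (vec β) v} (λ t → ≡.sym (β≗β′ t))
                 (λ _ → ≡.refl) t) (reflect-involutive (vec-Root β) v t)))) t ⟩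
        actᶻ x (reflect (vec β) (actᶻ (product αs) (reflect (vec β′) (reflect (vec β) v)))) t
          ≡⟨ actᶻ-cong x (λ t → ≡.sym (≡.trans
            (actᶻ-product-∷ β (αs ++ [ β′ ]) (reflect (vec β) v) t)
               (reflect-cong {u = vec β} (λ _ → ≡.refl) (actᶻ-product-∷ʳ αs β′ (reflect (vec β) v))
                 t))) t ⟩
        actᶻ x (actᶻ (product (β ∷ αs ++ [ β′ ])) (reflect (vec β) v)) t
          ≡⟨ eq (reflect (vec β) v) t ⟩
        reflect ζ (actᶻ x (reflect (vec β) v)) t
          ≡⟨ reflect-cong {u = ζ} (λ _ → ≡.refl) (actᶻ-++-reflection x β v) t ⟨
        reflect ζ (actᶻ y v) t ∎
        where open ≡.≡-Reasoning
      inner : ∃[ γ ] member C γ × actᶻ y (vec γ) ≗ ζ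
      inner = centre pal y ζ rζ pζ (Allₚ.++⁻ˡ αs members) (proj₁ ascent) eq-inner
      γ′ : Φ⁺
      γ′ = proj₁ inner
      xsγ′ : actᶻ x (reflect (vec β) (vec γ′)) ≗ ζ
      xsγ′ t = ≡.trans (≡.sym (actᶻ-++-reflection x β (vec γ′) t)) (proj₂ (proj₂ inner) t)
      -- This is the last ascent of the palindrome: `y P β = s_ζ y β = - s_ζ x β` is positive.
      descends : Neg (reflect ζ (actᶻ x (vec β)))
      descends = Neg-resp (λ t → ℤ.neg-involutive (reflect ζ (actᶻ x (vec β)) t))
        (Pos⇒Neg-neg (Pos-resp flipped (proj₂ ascent)))
        where
        flipped : actᶻ y (actᶻ (product αs) (vec β′)) ≗ neg (reflect ζ (actᶻ x (vec β)))
        flipped t = ≡.trans (actᶻ-cong y (actᶻ-cong (product αs) (λ t → ≡.sym (β≗β′ t))) t)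
          (≡.trans (eq-inner (vec β) t)
          (≡.trans (reflect-cong {u = ζ} (λ _ → ≡.refl)
            (λ t → ≡.trans (actᶻ-++-reflection x β (vec β) t)
            (≡.trans (actᶻ-cong x (reflect-self (vec-Root β)) t) (actᶻ-neg x (vec β) t))) t)
          (reflect-neg ζ (actᶻ x (vec β)) t)))
      xβζ : ⟪ actᶻ x (vec β) , ζ ⟫ ≡ Int.- ⟪ vec β , vec γ′ ⟫
      xβζ = begin
        ⟪ actᶻ x (vec β) , ζ ⟫                                  ≡⟨ ⟨⟩-cong {u = actᶻ x (vec β)}
          (λ _ → ≡.refl) (λ t → ≡.sym (xsγ′ t)) ⟩
        ⟪ actᶻ x (vec β) , actᶻ x (reflect (vec β) (vec γ′)) ⟫  ≡⟨ actᶻ-isometry x (vec β)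
          (reflect (vec β) (vec γ′)) ⟩
        ⟪ vec β , reflect (vec β) (vec γ′) ⟫                    ≡⟨ ⟨⟩-sym (vec β)
          (reflect (vec β) (vec γ′)) ⟩
        ⟪ reflect (vec β) (vec γ′) , vec β ⟫                    ≡⟨ ⟨reflect,root⟩ (vec-Root β)
          (vec γ′) ⟩
        Int.- ⟪ vec γ′ , vec β ⟫                                ≡⟨ ≡.cong (λ x → Int.- x)
          (⟨⟩-sym (vec γ′) (vec β)) ⟩
        Int.- ⟪ vec β , vec γ′ ⟫                                ∎
        where open ≡.≡-Reasoning
      outer : ∀ d → d ≡ ⟪ vec β , vec γ′ ⟫ → -[1+ 0 ] Int.≤ d → ∃[ γ ] member C γ × actᶻ x (vec γ) ≗
        ζ
      -- Here `s_ζ x β = x β + d ζ`, and `x β` is positive by the first ascent, contrary to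
      -- `descends`.
      outer (+ d) d≡ _ = contradiction descends
        (not-both (Root-reflect rζ (Root-actᶻ x (vec-Root β))) λ t →
        ≡.subst (0ℤ Int.≤_) (≡.sym (formula t)) (ℤ.+-mono-≤ (ascends⁻ x β p t)
          (*-nonneg {+ d} {ζ t} (+≤+ z≤n) (pζ t))))
        where
        unsign : ∀ z d w → z Int.- (Int.- d) Int.* w ≡ z Int.+ d Int.* w
        unsign = solve-∀
        formula : ∀ t → reflect ζ (actᶻ x (vec β)) t ≡ actᶻ x (vec β) t Int.+ + d Int.* ζ t
        formula t = ≡.trans (≡.cong (λ c → actᶻ x (vec β) t Int.- c Int.* ζ t)
          (≡.trans xβζ (≡.cong (λ x → Int.- x) (≡.sym d≡))))
          (unsign (actᶻ x (vec β) t) (+ d) (ζ t))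
      -- The new root is `β + γ′ = s_β γ′`, and x maps it to `y γ′ = ζ`.
      outer -[1+ 0 ] d≡ _ = proj₁ total , closed-+ β γ′ (proj₁ total) β∈C (proj₁ (proj₂ inner))
        (proj₂ total) , λ t →
        ≡.trans (actᶻ-cong x (λ t → ≡.trans (proj₂ total t) (≡.trans (ℤ.+-comm (vec β t) (vec γ′ t))
          (≡.sym (reflect-adjacent (≡.trans (⟨⟩-sym (vec γ′) (vec β)) (≡.sym d≡)) t)))) t) (xsγ′ t)
        where
        total : ∃[ γ ] vec γ ≗ vec β ⊕ vec γ′
        total = root-sum β γ′ (≡.sym d≡)
      outer -[1+ ℕ.suc d ] _ (-≤- ())

  preclosure⇒closure : ∀ {a} (A : Subset a) → PalindromicBruhatPreclosure A ⊆ TwoClosure A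
  preclosure⇒closure A {ζ} (αs , members , product∼ , ascending , pal) C closed A⊆C =
    Subset.respects C (≗⇒≈ᶲ {proj₁ root} {ζ} (proj₂ (proj₂ root))) (proj₁ (proj₂ root))
    where
    root : ∃[ γ ] member C γ × vec γ ≗ vec ζ
    root = centre C closed (palindrome (length αs) αs ℕₚ.≤-refl pal) [] (vec ζ) (vec-Root ζ)
      (vec-Pos ζ)
      (All.map A⊆C members) (linked⇒ascending [] αs ascending)
      λ v t → ≡.trans (≡.sym (actᶻ-∼ product∼ v t)) (actᶻ-reflection ζ v t)

  -- Chain roots form a 2-closed subset at the same universe level as A, so the intersection
  -- defining the 2-closure can be tested on them.
  closure⇒preclosure : ∀ {a} (A : Subset a) → TwoClosure A ⊆ PalindromicBruhatPreclosure A
  closure⇒preclosure A ζ∈ = chain⇒preclosure (ζ∈ (chainSubset A) (chainSubset-closed A) base)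

theorem1p5 : (ℝ : RealNumbers) {n : ℕ} (M : CoxeterMatrix n) (simplyLaced : SimplyLaced M) →
    Coxeter.IsFinite M →
    let open RootSystem ℝ M simplyLaced in
    {a : Level} (A : Subset a) →
    PalindromicBruhatPreclosure A ≐ TwoClosure A
theorem1p5 ℝ M simplyLaced finite A = preclosure⇒closure A , closure⇒preclosure A
  where open Preclosure ℝ M simplyLaced finite
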